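{- Let $\Bbbk$ be a field of arbitrary characteristic and let $v,w\in S_n$. With respect to the term order $\prec$, the essential minors of $I_{v,w}$ form a Gr\"obner basis of the Kazhdan--Lusztig ideal $I_{v,w}\subseteq \Bbbk[\mathbf{z}^{(v)}]$.
   Context: Positions in an $n\times n$ matrix are written $(i,j)$, meaning the $i$-th row counted from the BOTTOM and the $j$-th column counted from the left. For $v\in S_n$, let $Z^{(v)}$ be the $n\times n$ matrix such that for each $j$: the entry at $(n-v(j)+1,j)$ is $1$; the entries at positions $(n-v(j)+1,a)$ with $a>j$ and at positions $(b,j)$ with $b>n-v(j)+1$ are $0$; every remaining entry, at position $(i,j)$, is a distinct indeterminate $z_{ij}$. Let $\mathbf{z}^{(v)}$ be the set of these indeterminates. (Their positions form the Rothe diagram $D(u)=\{(i,j): i<n-u(j)+1,\ j<u^{ -1}(n-i+1)\}$ for $u=v$.) For $w\in S_n$ let $r^w_{ij}=\#\{k\le j : w(k)\ge n-i+1\}$. Let $Z^{(v)}_{ij}$ be the submatrix of $Z^{(v)}$ consisting of the bottom $i$ rows and leftmost $j$ columns. The Kazhdan--Lusztig ideal $I_{v,w}\subseteq\Bbbk[\mathbf{z}^{(v)}]$ is generated by all minors of size $1+r^w_{ij}$ of $Z^{(v)}_{ij}$, for all $1\le i,j\le n$. The essential set of $w$ is $\mathcal{E}(w)=\{(i,j)\in D(w): (i+1,j)\notin D(w),\ (i,j+1)\notin D(w)\}$, and the essential minors of $I_{v,w}$ are the minors of size $1+r^w_{ij}$ of $Z^{(v)}_{ij}$ for $(i,j)\in\mathcal{E}(w)$.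 The term order $\prec$ is the pure lexicographic order on monomials in $\mathbf{z}^{(v)}$ induced by favoring variables further to the right, breaking ties in a column by favoring variables further down: $z_{ij}\prec z_{kl}$ if $j<l$, or if $j=l$ and $i>k$. The leading term is the $\prec$-largest term. -}

module Defs where

open import Level using (Level; _⊔_) renaming (suc to lsuc)
open import Algebra.Bundles using (CommutativeRing)
open import Data.Nat as ℕ using (ℕ; zero; suc)
open import Data.Fin as Fin using (Fin; toℕ; opposite; punchIn; _≟_)
open import Data.Fin.Properties using (all?)
open import Data.Fin.Permutation using (Permutation′; _⟨$⟩ʳ_; _⟨$⟩ˡ_)
open import Data.List as List using (List; []; _∷_; _++_; length; filter; concatMap; allFin; foldr)
open import Data.List.Relation.Unary.All using (All)
open import Data.Product using (Σ; ∃; ∃₂; _×_; _,_; proj₁; proj₂)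
open import Data.Sum using (_⊎_)
open import Relation.Nullary using (¬_; Dec; yes; no)
open import Relation.Nullary.Decidable using (_×-dec_)
open import Relation.Binary.PropositionalEquality using (_≡_)

record Field (c ℓ : Level) : Set (lsuc (c ⊔ ℓ)) where
  field
    commutativeRing : CommutativeRing c ℓ
  open CommutativeRing commutativeRing public
  field
    1#≉0#   : ¬ (1# ≈ 0#)
    inverse : ∀ x → ¬ (x ≈ 0#) → ∃ λ y → (x * y) ≈ 1#

-- Positions.  A position of an n×n matrix is a pair (a , b) of
-- 0-indexed coordinates a b : Fin n, where a is the row counted from
-- the BOTTOM and b the column counted from the left; it corresponds to
-- the paper's (i , j) = (a+1 , b+1).
-- A permutation u ∈ S_n is a  Permutation′ n ; its 1-indexed value
-- u(j) is  toℕ (u ⟨$⟩ʳ (j-1)) + 1.  The paper's row  n - u(j) + 1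
-- is 0-indexed  opposite (u ⟨$⟩ʳ b), and  u⁻¹(n - i + 1) is
-- 1 + toℕ (u ⟨$⟩ˡ opposite a).

-- Rothe diagram  D(u) = {(i,j) : i < n-u(j)+1 , j < u⁻¹(n-i+1)}
InD : ∀ {n} → Permutation′ n → Fin n → Fin n → Set
InD u a b = (a Fin.< opposite (u ⟨$⟩ʳ b)) × (b Fin.< u ⟨$⟩ˡ opposite a)

InD? : ∀ {n} (u : Permutation′ n) a b → Dec (InD u a b)
InD? u a b = (a Fin.<? opposite (u ⟨$⟩ʳ b)) ×-dec (b Fin.<? u ⟨$⟩ˡ opposite a)

rank : ∀ {n} → Permutation′ n → Fin n → Fin n → ℕ
rank w a b = length (filter (λ k → (k Fin.≤? b) ×-dec (opposite a Fin.≤? (w ⟨$⟩ʳ k))) (allFin _))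

-- essential set: (i,j) ∈ D(w), (i+1,j) ∉ D(w), (i,j+1) ∉ D(w)
-- (positions outside the n×n grid are not in D(w))
IsEssential : ∀ {n} → Permutation′ n → Fin n → Fin n → Set
IsEssential w a b =
  InD w a b
  × (∀ a′ → toℕ a′ ≡ suc (toℕ a) → ¬ InD w a′ b)
  × (∀ b′ → toℕ b′ ≡ suc (toℕ b) → ¬ InD w a b′)

Mon : ℕ → Set
Mon n = Fin n → Fin n → ℕ

_≺v_ : ∀ {n} → Fin n × Fin n → Fin n × Fin n → Set
(a , b) ≺v (c , d) = (b Fin.< d) ⊎ ((b ≡ d) × (c Fin.< a))

_≺ₘ_ : ∀ {n} → Mon n → Mon n → Set
_≺ₘ_ {n} m m′ = ∃₂ λ (a b : Fin n) → (m a b ℕ.< m′ a b)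
                 × (∀ c d → (a , b) ≺v (c , d) → m c d ≡ m′ c d)

_∣ₘ_ : ∀ {n} → Mon n → Mon n → Set
m ∣ₘ m′ = ∀ a b → m a b ℕ.≤ m′ a b

_⊕ₘ_ : ∀ {n} → Mon n → Mon n → Mon n
(m ⊕ₘ m′) a b = m a b ℕ.+ m′ a b

monEq? : ∀ {n} (m m′ : Mon n) → Dec (∀ a b → m a b ≡ m′ a b)
monEq? m m′ = all? (λ a → all? (λ b → m a b ℕ.≟ m′ a b))

SupportedMon : ∀ {n} → (Fin n → Fin n → Set) → Mon n → Set
SupportedMon S m = ∀ a b → ¬ S a b → m a b ≡ 0

module Polynomials {c ℓ} (K : Field c ℓ) (n : ℕ) where
  open Field K

  Term : Set c
  Term = Carrier × Mon n

  Poly : Set c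
  Poly = List Term

  coeff : Poly → Mon n → Carrier
  coeff [] m = 0#
  coeff ((k , m′) ∷ p) m with monEq? m′ m
  ... | yes _ = k + coeff p m
  ... | no  _ = coeff p m

  _≈ₚ_ : Poly → Poly → Set ℓ
  p ≈ₚ q = ∀ m → coeff p m ≈ coeff q m

  0ₚ : Poly
  0ₚ = []

  1ₘ : Mon n
  1ₘ _ _ = 0

  1ₚ : Poly
  1ₚ = (1# , 1ₘ) ∷ []

  var : Fin n → Fin n → Poly
  var a b = (1# , (λ c d → unit (a ≟ c) (b ≟ d))) ∷ []
    where
    unit : ∀ {x y : Fin n} {x′ y′ : Fin n} → Dec (x ≡ x′) → Dec (y ≡ y′) → ℕ
    unit (yes _) (yes _) = 1
    unit _ _ = 0

  _+ₚ_ : Poly → Poly → Poly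
  _+ₚ_ = _++_

  -ₚ_ : Poly → Poly
  -ₚ_ = List.map (λ t → (- proj₁ t , proj₂ t))

  _*ₚ_ : Poly → Poly → Poly
  p *ₚ q = concatMap (λ t → List.map (λ t′ → (proj₁ t * proj₁ t′ , proj₂ t ⊕ₘ proj₂ t′)) q) p

  SupportedPoly : (Fin n → Fin n → Set) → Poly → Set c
  SupportedPoly S p = All (λ t → SupportedMon S (proj₂ t)) p

  alt : ℕ → Poly → Poly
  alt zero p = p
  alt (suc k) p = -ₚ (alt k p)

  det : ∀ k → (Fin k → Fin k → Poly) → Poly
  det zero M = 1ₚ
  det (suc k) M = go (allFin (suc k))
    where
    signed : Fin (suc k) → Poly → Poly
    signed j p = alt (toℕ j) p
    go : List (Fin (suc k)) → Poly
    go [] = 0ₚ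
    go (j ∷ js) = signed j (M Fin.zero j *ₚ det k (λ r s → M (Fin.suc r) (punchIn j s))) +ₚ go js

  IsLeadingMonomial : Poly → Mon n → Set ℓ
  IsLeadingMonomial f m = (¬ (coeff f m ≈ 0#)) × (∀ m′ → m ≺ₘ m′ → coeff f m′ ≈ 0#)

  -- ideal generated by the polynomials satisfying G in the polynomial
  -- ring K[ z_{ab} : S a b ]: finite combinations Σ hᵢ gᵢ
  data Combination {p} (S : Fin n → Fin n → Set) (G : Poly → Set p) : Poly → Set (c ⊔ p) where
    nil  : Combination S G 0ₚ
    cons : ∀ {h g q} → SupportedPoly S h → G g → Combination S G q
           → Combination S G ((h *ₚ g) +ₚ q)

  InIdeal : ∀ {p} (S : Fin n → Fin n → Set) (G : Poly → Set p) → Poly → Set (c ⊔ ℓ ⊔ p)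
  InIdeal S G f = ∃ λ q → Combination S G q × (f ≈ₚ q)

  IsGroebnerBasis : ∀ {p q} (S : Fin n → Fin n → Set) (B : Poly → Set q) (G : Poly → Set p) → Set (c ⊔ ℓ ⊔ p ⊔ q)
  IsGroebnerBasis S B G =
    (∀ g → B g → InIdeal S G g)
    × (∀ f → InIdeal S G f → ∀ m → IsLeadingMonomial f m →
         ∃ λ g → B g × ∃ λ mg → IsLeadingMonomial g mg × (mg ∣ₘ m))

  Z : Permutation′ n → Fin n → Fin n → Poly
  Z v a b with a ≟ opposite (v ⟨$⟩ʳ b)
  ... | yes _ = 1ₚ
  ... | no  _ with InD? v a b
  ...   | yes _ = var a b
  ...   | no  _ = 0ₚ

  StrictlyIncreasing : ∀ {k} → (Fin k → Fin n) → Set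
  StrictlyIncreasing f = ∀ s t → s Fin.< t → f s Fin.< f t

  IsMinor : Permutation′ n → (k : ℕ) → Fin n → Fin n → Poly → Set c
  IsMinor v k a b g =
    Σ (Fin k → Fin n) λ R → Σ (Fin k → Fin n) λ C →
      StrictlyIncreasing R × StrictlyIncreasing C
      × (∀ t → R t Fin.≤ a) × (∀ t → C t Fin.≤ b)
      × (g ≡ det k (λ s t → Z v (R s) (C t)))

  KLGenerator : Permutation′ n → Permutation′ n → Poly → Set c
  KLGenerator v w g = ∃₂ λ a b → IsMinor v (suc (rank w a b)) a b g

  EssentialMinor : Permutation′ n → Permutation′ n → Poly → Set c
  EssentialMinor v w g = ∃₂ λ a b → IsEssential w a b × IsMinor v (suc (rank w a b)) a b g

{-# OPTIONS --safe #-}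
module Submission where

-- Write u, x for v, w with values reversed, so that u(b) is the row of the 1 in column b, counted from
-- the bottom. The largest variable y lies in the column j of the last descent of u, column j + 1 is a unit
-- vector E, and column j is y E + c. Exchanging the two columns and setting y = 0 gives the chart of
-- v s_j, so the charts are iterated one-variable extensions of the identity matrix. If x has no descent at j,
-- I_{v,w} is extended from the chart of v s_j. Otherwise put N = I_{v s_j, w s_j} and C = I_{v s_j, w};
-- then I_{v,w} is generated by N and by elements y q + r, where the q generate C modulo N, and
-- q r' - q' r lies in N by a determinantal identity. If moreover N : C = N, comparing coefficients of y
-- shows that the leading coefficient in y of an element of I_{v,w} lies in C, and in N if its degree is 0.
-- The property I_{v,w'} : I_{v,w} = I_{v,w'} for w below w' follows along the same recursion, which replaces
-- primality of the ideals and any use of geometry. On the side of the minors, the distinct terms of a minor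
-- of Z^(v) are distinct monomials, so leading terms are maximal matchings, which satisfy this recursion too.

open import Defs
open import Level using (_⊔_)
open import Algebra.Bundles using (CommutativeRing)
import Algebra.Properties.Ring as RingProperties
open import Data.Empty using (⊥; ⊥-elim)
open import Data.Fin as Fin using (Fin; zero; suc; toℕ; fromℕ<; punchIn; opposite)
open import Data.Fin.Permutation as Permutation using (Permutation′; _⟨$⟩ʳ_; _⟨$⟩ˡ_)
import Data.Fin.Properties as Fin
open import Data.List using (List; []; _∷_; _++_; map; length; concat; concatMap; tabulate; allFin; filter; lookup; applyUpTo)
import Data.List.Membership.DecPropositional as DecMembership
open import Data.List.Membership.Propositional using (_∈_; _∉_)
open import Data.List.Membership.Propositional.Properties using (∈-map⁺; ∈-map⁻; ∈-∃++; ∈-tabulate⁻; ∈-lookup)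
open import Data.List.Properties using (length-map; length-applyUpTo; map-∘; map-id; map-tabulate; tabulate-lookup; tabulate-cong)
open import Data.List.Relation.Binary.Permutation.Propositional using (_↭_; ↭-refl; ↭-sym; ↭-trans; ↭⇒↭ₛ; prep; swap)
import Data.List.Relation.Binary.Permutation.Propositional.Properties as ↭
import Data.List.Relation.Binary.Permutation.Setoid.Properties as ↭ₛ
open import Data.List.Relation.Unary.All as All using (All; []; _∷_)
import Data.List.Relation.Unary.All.Properties as All
open import Data.List.Relation.Unary.AllPairs as AllPairs using (AllPairs; []; _∷_)
open import Data.List.Relation.Unary.Any using (here; there)
import Data.List.Relation.Unary.Linked.Properties as Linked
open import Data.List.Relation.Unary.Unique.Propositional using (Unique)
import Data.List.Relation.Unary.Unique.Propositional.Properties as Unique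
import Data.List.Sort
open import Data.Nat as ℕ using (ℕ; zero; suc; _<_; _≤_; z≤n; s≤s; _<?_)
import Data.Nat.Properties as ℕ
open import Data.Product using (_,_; _×_; ∃; ∃₂; proj₁; proj₂)
import Data.Product.Properties as Product
open import Data.Sum as Sum using (_⊎_; inj₁; inj₂)
open import Data.Unit using (⊤)
open import Function using (_∘_)
open import Relation.Binary using (tri<; tri≈; tri>)
open import Relation.Binary.PropositionalEquality as ≡ using (_≡_; _≢_; _≗_; cong; cong₂; subst)
import Relation.Binary.Reasoning.Setoid as SetoidReasoning
open import Relation.Nullary using (¬_; Dec; yes; no)
open import Relation.Nullary.Decidable using (_×-dec_)

-- Polynomials in one variable

-- No S-pairs and no Hilbert functions occur. The two sides meet in the set `Initial`, defined by
-- recursion on ranks and exponents alone: leading monomials of elements of the ideal lie in it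
-- (`leading∈initial`), and each of its members is divisible by the leading monomial of an essential
-- minor (`reached`, `essential-divides`). The algebraic obstacle is that cancelling the factors q
-- modulo N concerns the smaller chart, while the recursion needs the same cancellation again in the
-- next one. Hence the colon property is carried for all comparable rank functions and reproved at
-- each step from the statement on top coefficients. It starts in the identity chart, where a strict
-- inequality of ranks puts 1 into the larger ideal. The combinatorial obstacle is that a maximal
-- term of a minor in the smaller chart need not stay maximal in the larger one, since terms with
-- the new variable may exceed it. So rows and columns of the candidate minor are adjusted at each
-- step, its size remaining one more than the rank at a box of the diagram. The coefficient of such
-- a term is a sign, so the argument is the same in every characteristic.

module PolynomialRing {c ℓ} (A : CommutativeRing c ℓ) where
  open CommutativeRing A hiding (zero)
  open RingProperties ring using (-0#≈0#)
  open SetoidReasoning setoid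

  medial : ∀ w x y z → (w + x) + (y + z) ≈ (w + y) + (x + z)
  medial w x y z = begin
    (w + x) + (y + z) ≈⟨ +-assoc w x (y + z) ⟩
    w + (x + (y + z)) ≈⟨ +-congˡ (+-assoc x y z) ⟨
    w + ((x + y) + z) ≈⟨ +-congˡ (+-congʳ (+-comm x y)) ⟩
    w + ((y + x) + z) ≈⟨ +-congˡ (+-assoc y x z) ⟩
    w + (y + (x + z)) ≈⟨ +-assoc w y (x + z) ⟨
    (w + y) + (x + z) ∎

  -- The ring laws are proved for coefficient sequences and then transferred: equality of lists
  -- means equality of coefficients, so trailing zeros are harmless.
  Series : Set c
  Series = ℕ → Carrier

  infix 4 _≋_
  _≋_ : Series → Series → Set ℓ
  p ≋ q = ∀ d → p d ≈ q d

  tail : Series → Series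
  tail p d = p (suc d)

  infixl 7 _⊛_
  _⊛_ : Series → Series → Series
  (p ⊛ q) zero    = p 0 * q 0
  (p ⊛ q) (suc d) = p 0 * q (suc d) + (tail p ⊛ q) d

  ⊛-cong : ∀ {p p′ q q′} → p ≋ p′ → q ≋ q′ → p ⊛ q ≋ p′ ⊛ q′
  ⊛-cong e f zero    = *-cong (e 0) (f 0)
  ⊛-cong e f (suc d) = +-cong (*-cong (e 0) (f (suc d))) (⊛-cong (λ i → e (suc i)) f d)

  ⊛-zeroˡ : ∀ {p} q → (∀ d → p d ≈ 0#) → ∀ d → (p ⊛ q) d ≈ 0#
  ⊛-zeroˡ q e zero    = trans (*-congʳ (e 0)) (zeroˡ _)
  ⊛-zeroˡ q e (suc d) = trans (+-cong (trans (*-congʳ (e 0)) (zeroˡ _)) (⊛-zeroˡ q (λ i → e (suc i)) d)) (+-identityˡ 0#)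

  ⊛-distribʳ : ∀ p q r → (λ d → p d + q d) ⊛ r ≋ (λ d → (p ⊛ r) d + (q ⊛ r) d)
  ⊛-distribʳ p q r zero    = distribʳ _ _ _
  ⊛-distribʳ p q r (suc d) = trans (+-cong (distribʳ _ _ _) (⊛-distribʳ (tail p) (tail q) r d)) (medial _ _ _ _)

  ⊛-scale : ∀ k p q → (λ d → k * p d) ⊛ q ≋ (λ d → k * (p ⊛ q) d)
  ⊛-scale k p q zero    = *-assoc _ _ _
  ⊛-scale k p q (suc d) = trans (+-cong (*-assoc _ _ _) (⊛-scale k (tail p) q d)) (sym (distribˡ _ _ _))

  ⊛-assoc : ∀ p q r → (p ⊛ q) ⊛ r ≋ p ⊛ (q ⊛ r)
  ⊛-assoc p q r zero    = *-assoc _ _ _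
  ⊛-assoc p q r (suc d) = begin
    p 0 * q 0 * r (suc d) + (tail (p ⊛ q) ⊛ r) d
      ≈⟨ +-cong (*-assoc _ _ _) (⊛-distribʳ (λ i → p 0 * q (suc i)) (tail p ⊛ q) r d) ⟩
    p 0 * (q 0 * r (suc d)) + (((λ i → p 0 * q (suc i)) ⊛ r) d + ((tail p ⊛ q) ⊛ r) d)
      ≈⟨ +-assoc _ _ _ ⟨
    p 0 * (q 0 * r (suc d)) + ((λ i → p 0 * q (suc i)) ⊛ r) d + ((tail p ⊛ q) ⊛ r) d
      ≈⟨ +-cong (+-congˡ (⊛-scale (p 0) (tail q) r d)) (⊛-assoc (tail p) q r d) ⟩
    p 0 * (q 0 * r (suc d)) + p 0 * (tail q ⊛ r) d + (tail p ⊛ (q ⊛ r)) d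
      ≈⟨ +-congʳ (sym (distribˡ _ _ _)) ⟩
    p 0 * (q 0 * r (suc d) + (tail q ⊛ r) d) + (tail p ⊛ (q ⊛ r)) d ∎

  -- Peels the constant term off the right factor, where the definition peels it off the left one;
  -- the induction for `⊛-comm` needs both.
  ⊛-unfoldʳ : ∀ p q d → (p ⊛ q) (suc d) ≈ q 0 * p (suc d) + (p ⊛ tail q) d
  ⊛-unfoldʳ p q zero    = trans (+-comm _ _) (+-congʳ (*-comm _ _))
  ⊛-unfoldʳ p q (suc d) = begin
    p 0 * q (suc (suc d)) + (tail p ⊛ q) (suc d)
      ≈⟨ +-congˡ (⊛-unfoldʳ (tail p) q d) ⟩
    p 0 * q (suc (suc d)) + (q 0 * p (suc (suc d)) + (tail p ⊛ tail q) d)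
      ≈⟨ trans (sym (+-assoc _ _ _)) (trans (+-congʳ (+-comm _ _)) (+-assoc _ _ _)) ⟩
    q 0 * p (suc (suc d)) + (p 0 * q (suc (suc d)) + (tail p ⊛ tail q) d) ∎

  ⊛-comm : ∀ p q → p ⊛ q ≋ q ⊛ p
  ⊛-comm p q zero    = *-comm _ _
  ⊛-comm p q (suc d) = trans (⊛-unfoldʳ p q d) (+-congˡ (⊛-comm p (tail q) d))

  Poly : Set c
  Poly = List Carrier

  coeff : Poly → Series
  coeff []      _       = 0#
  coeff (a ∷ p) zero    = a
  coeff (a ∷ p) (suc d) = coeff p d

  infix 4 _≈ₚ_
  _≈ₚ_ : Poly → Poly → Set ℓ
  p ≈ₚ q = coeff p ≋ coeff q

  infixl 6 _+ₚ_
  _+ₚ_ : Poly → Poly → Poly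
  []      +ₚ q       = q
  (a ∷ p) +ₚ []      = a ∷ p
  (a ∷ p) +ₚ (b ∷ q) = (a + b) ∷ (p +ₚ q)

  infixl 7 _*ₚ_
  _*ₚ_ : Poly → Poly → Poly
  []      *ₚ q = []
  (a ∷ p) *ₚ q = map (a *_) q +ₚ (0# ∷ p *ₚ q)

  coeff-+ : ∀ p q d → coeff (p +ₚ q) d ≈ coeff p d + coeff q d
  coeff-+ []      q       d       = sym (+-identityˡ _)
  coeff-+ (a ∷ p) []      d       = sym (+-identityʳ _)
  coeff-+ (a ∷ p) (b ∷ q) zero    = refl
  coeff-+ (a ∷ p) (b ∷ q) (suc d) = coeff-+ p q d

  coeff-neg : ∀ p d → coeff (map (-_) p) d ≈ - coeff p d
  coeff-neg []      d       = sym -0#≈0#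
  coeff-neg (a ∷ p) zero    = refl
  coeff-neg (a ∷ p) (suc d) = coeff-neg p d

  coeff-scale : ∀ k p d → coeff (map (k *_) p) d ≈ k * coeff p d
  coeff-scale k []      d       = sym (zeroʳ _)
  coeff-scale k (a ∷ p) zero    = refl
  coeff-scale k (a ∷ p) (suc d) = coeff-scale k p d

  coeff-* : ∀ p q d → coeff (p *ₚ q) d ≈ (coeff p ⊛ coeff q) d
  coeff-* []      q d = sym (⊛-zeroˡ (coeff q) (λ _ → refl) d)
  coeff-* (a ∷ p) q d = trans (coeff-+ (map (a *_) q) (0# ∷ p *ₚ q) d) (split d)
    where
    split : ∀ d → coeff (map (a *_) q) d + coeff (0# ∷ p *ₚ q) d ≈ (coeff (a ∷ p) ⊛ coeff q) d
    split zero    = trans (+-identityʳ _) (coeff-scale a q 0)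
    split (suc d) = +-cong (coeff-scale a q (suc d)) (coeff-* p q d)

  polyRing : CommutativeRing c ℓ
  polyRing = record
    { Carrier = Poly
    ; _≈_ = _≈ₚ_
    ; _+_ = _+ₚ_
    ; _*_ = _*ₚ_
    ; -_ = map (-_)
    ; 0# = []
    ; 1# = 1# ∷ []
    ; isCommutativeRing = record
      { isRing = record
        { +-isAbelianGroup = record
          { isGroup = record
            { isMonoid = record
              { isSemigroup = record
                { isMagma = record
                  { isEquivalence = record
                    { refl = λ _ → refl
                    ; sym = λ e d → sym (e d)
                    ; trans = λ e f d → trans (e d) (f d)
                    }
                  ; ∙-cong = λ {p} {p′} {q} {q′} e f d →
                      trans (coeff-+ p q d) (trans (+-cong (e d) (f d)) (sym (coeff-+ p′ q′ d)))
                  }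
                ; assoc = λ p q r d → begin
                    coeff (p +ₚ q +ₚ r) d                   ≈⟨ coeff-+ (p +ₚ q) r d ⟩
                    coeff (p +ₚ q) d + coeff r d            ≈⟨ +-congʳ (coeff-+ p q d) ⟩
                    coeff p d + coeff q d + coeff r d       ≈⟨ +-assoc _ _ _ ⟩
                    coeff p d + (coeff q d + coeff r d)     ≈⟨ +-congˡ (coeff-+ q r d) ⟨
                    coeff p d + coeff (q +ₚ r) d            ≈⟨ coeff-+ p (q +ₚ r) d ⟨
                    coeff (p +ₚ (q +ₚ r)) d                 ∎
                }
              ; identity = (λ _ _ → refl) , λ p d → trans (coeff-+ p [] d) (+-identityʳ _)
              }
            ; inverse = (λ p d → trans (coeff-+ (map (-_) p) p d) (trans (+-congʳ (coeff-neg p d)) (-‿inverseˡ _)))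
                      , (λ p d → trans (coeff-+ p (map (-_) p) d) (trans (+-congˡ (coeff-neg p d)) (-‿inverseʳ _)))
            ; ⁻¹-cong = λ {p} {q} e d → trans (coeff-neg p d) (trans (-‿cong (e d)) (sym (coeff-neg q d)))
            }
          ; comm = λ p q d → trans (coeff-+ p q d) (trans (+-comm _ _) (sym (coeff-+ q p d)))
          }
        ; *-cong = λ {p} {p′} {q} {q′} e f d →
            trans (coeff-* p q d) (trans (⊛-cong e f d) (sym (coeff-* p′ q′ d)))
        ; *-assoc = λ p q r d → begin
            coeff (p *ₚ q *ₚ r) d                   ≈⟨ coeff-* (p *ₚ q) r d ⟩
            (coeff (p *ₚ q) ⊛ coeff r) d            ≈⟨ ⊛-cong (coeff-* p q) (λ _ → refl) d ⟩
            ((coeff p ⊛ coeff q) ⊛ coeff r) d       ≈⟨ ⊛-assoc (coeff p) (coeff q) (coeff r) d ⟩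
            (coeff p ⊛ (coeff q ⊛ coeff r)) d       ≈⟨ ⊛-cong (λ _ → refl) (coeff-* q r) d ⟨
            (coeff p ⊛ coeff (q *ₚ r)) d            ≈⟨ coeff-* p (q *ₚ r) d ⟨
            coeff (p *ₚ (q *ₚ r)) d                 ∎
        ; *-identity = one-* , (λ p d → trans (*ₚ-comm p (1# ∷ []) d) (one-* p d))
        ; distrib = (λ p q r d → trans (*ₚ-comm p (q +ₚ r) d) (trans (*-+ q r p d)
                      (trans (coeff-+ (q *ₚ p) (r *ₚ p) d)
                      (trans (+-cong (*ₚ-comm q p d) (*ₚ-comm r p d)) (sym (coeff-+ (p *ₚ q) (p *ₚ r) d))))))
                  , (λ p q r → *-+ q r p)
        }
      ; *-comm = *ₚ-comm
      }
    }
    where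
    *ₚ-comm : ∀ p q → p *ₚ q ≈ₚ q *ₚ p
    *ₚ-comm p q d = trans (coeff-* p q d) (trans (⊛-comm (coeff p) (coeff q) d) (sym (coeff-* q p d)))
    one-* : ∀ p → (1# ∷ []) *ₚ p ≈ₚ p
    one-* p d = trans (coeff-* (1# ∷ []) p d) (one d)
      where
      one : ∀ d → (coeff (1# ∷ []) ⊛ coeff p) d ≈ coeff p d
      one zero    = *-identityˡ _
      one (suc d) = trans (+-cong (*-identityˡ _) (⊛-zeroˡ (coeff p) (λ _ → refl) d)) (+-identityʳ _)
    *-+ : ∀ p q r → (p +ₚ q) *ₚ r ≈ₚ p *ₚ r +ₚ q *ₚ r
    *-+ p q r d = begin
      coeff ((p +ₚ q) *ₚ r) d                              ≈⟨ coeff-* (p +ₚ q) r d ⟩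
      (coeff (p +ₚ q) ⊛ coeff r) d                         ≈⟨ ⊛-cong (coeff-+ p q) (λ _ → refl) d ⟩
      ((λ i → coeff p i + coeff q i) ⊛ coeff r) d          ≈⟨ ⊛-distribʳ (coeff p) (coeff q) (coeff r) d ⟩
      (coeff p ⊛ coeff r) d + (coeff q ⊛ coeff r) d        ≈⟨ +-cong (coeff-* p r d) (coeff-* q r d) ⟨
      coeff (p *ₚ r) d + coeff (q *ₚ r) d                  ≈⟨ coeff-+ (p *ₚ r) (q *ₚ r) d ⟨
      coeff (p *ₚ r +ₚ q *ₚ r) d                           ∎

  const-* : ∀ k p d → coeff ((k ∷ []) *ₚ p) d ≈ k * coeff p d
  const-* k p zero    = coeff-* (k ∷ []) p 0
  const-* k p (suc d) = trans (coeff-* (k ∷ []) p (suc d))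
    (trans (+-congˡ (⊛-zeroˡ (coeff p) (λ _ → refl) d)) (+-identityʳ _))

opaque
  -- Opaque, so that iterated polynomial rings are used only through the coefficient laws in
  -- `Coefficients`.
  _[y] : ∀ {c ℓ} → CommutativeRing c ℓ → CommutativeRing c ℓ
  A [y] = PolynomialRing.polyRing A

module Coefficients {c ℓ} (A : CommutativeRing c ℓ) where
  open CommutativeRing A hiding (zero)
  open RingProperties ring using (-0#≈0#)
  open PolynomialRing A using (Series; _⊛_; _≋_)
  private
    module P = PolynomialRing A
    module B = CommutativeRing (A [y])

  opaque
    unfolding _[y]

    const : Carrier → B.Carrier
    const a = a ∷ []

    Y : B.Carrier
    Y = 0# ∷ 1# ∷ []

    coeff : B.Carrier → Series
    coeff = P.coeff

    coeff-cong : ∀ {p q} → p B.≈ q → coeff p ≋ coeff q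
    coeff-cong e = e

    coeff-ext : ∀ {p q} → coeff p ≋ coeff q → p B.≈ q
    coeff-ext e = e

    coeff-0 : ∀ d → coeff B.0# d ≈ 0#
    coeff-0 d = refl

    coeff-1 : B.1# B.≈ const 1#
    coeff-1 d = refl

    coeff-+ : ∀ p q d → coeff (p B.+ q) d ≈ coeff p d + coeff q d
    coeff-+ = P.coeff-+

    coeff-neg : ∀ p d → coeff (B.- p) d ≈ - coeff p d
    coeff-neg = P.coeff-neg

    coeff-* : ∀ p q → coeff (p B.* q) ≋ coeff p ⊛ coeff q
    coeff-* = P.coeff-*

    coeff-const-zero : ∀ a → coeff (const a) 0 ≈ a
    coeff-const-zero a = refl

    coeff-const-suc : ∀ a d → coeff (const a) (suc d) ≈ 0#
    coeff-const-suc a d = refl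

    coeff-const-* : ∀ a p d → coeff (const a B.* p) d ≈ a * coeff p d
    coeff-const-* = P.const-*

    coeff-Y*-zero : ∀ p → coeff (Y B.* p) 0 ≈ 0#
    coeff-Y*-zero p = trans (P.coeff-* Y p 0) (zeroˡ _)

    coeff-Y*-suc : ∀ p d → coeff (Y B.* p) (suc d) ≈ coeff p d
    coeff-Y*-suc p d = trans (P.coeff-* Y p (suc d)) (trans (+-congʳ (zeroˡ _)) (trans (+-identityˡ _)
      (trans (sym (P.coeff-* (const 1#) p d)) (trans (P.const-* 1# p d) (*-identityˡ _)))))

    degree : B.Carrier → ℕ
    degree = length

    coeff-degree : ∀ p d → degree p ℕ.≤ d → coeff p d ≈ 0#
    coeff-degree []      d       _            = refl
    coeff-degree (a ∷ p) (suc d) (ℕ.s≤s n≤d) = coeff-degree p d n≤d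

  coeff-const : ∀ {a b} → a ≈ b → coeff (const a) ≋ coeff (const b)
  coeff-const e zero    = trans (coeff-const-zero _) (trans e (sym (coeff-const-zero _)))
  coeff-const e (suc d) = trans (coeff-const-suc _ d) (sym (coeff-const-suc _ d))

  const-cong : ∀ {a b} → a ≈ b → const a B.≈ const b
  const-cong e = coeff-ext (coeff-const e)

  const-0 : const 0# B.≈ B.0#
  const-0 = coeff-ext λ
    { zero → trans (coeff-const-zero _) (sym (coeff-0 0)) ; (suc d) → trans (coeff-const-suc _ d) (sym (coeff-0 (suc d))) }

  const-+ : ∀ a b → const (a + b) B.≈ const a B.+ const b
  const-+ a b = coeff-ext λ
    { zero → trans (coeff-const-zero _) (sym (trans (coeff-+ _ _ 0) (+-cong (coeff-const-zero _) (coeff-const-zero _))))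
    ; (suc d) → trans (coeff-const-suc _ d) (sym (trans (coeff-+ _ _ (suc d))
        (trans (+-cong (coeff-const-suc _ d) (coeff-const-suc _ d)) (+-identityˡ 0#)))) }

  const-neg : ∀ a → const (- a) B.≈ B.- const a
  const-neg a = coeff-ext λ
    { zero → trans (coeff-const-zero _) (sym (trans (coeff-neg _ 0) (-‿cong (coeff-const-zero _))))
    ; (suc d) → trans (coeff-const-suc _ d) (sym (trans (coeff-neg _ (suc d)) (trans (-‿cong (coeff-const-suc _ d)) -0#≈0#))) }

  const-* : ∀ a b → const (a * b) B.≈ const a B.* const b
  const-* a b = coeff-ext λ
    { zero → trans (coeff-const-zero _) (sym (trans (coeff-const-* _ _ 0) (*-congˡ (coeff-const-zero _))))
    ; (suc d) → trans (coeff-const-suc _ d) (sym (trans (coeff-const-* _ _ (suc d)) (trans (*-congˡ (coeff-const-suc _ d)) (zeroʳ _)))) }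

-- Determinants

set : ∀ {a} {B : Set a} {k} → Fin k → B → (Fin k → B) → Fin k → B
set zero    v X zero    = v
set zero    v X (suc r) = X (suc r)
set (suc i) v X zero    = X zero
set (suc i) v X (suc r) = set i v (X ∘ suc) r

set-∘ : ∀ {a b} {B : Set a} {C : Set b} (f : B → C) {k} (i : Fin k) v X r → f (set i v X r) ≡ set i (f v) (f ∘ X) r
set-∘ f zero    v X zero    = ≡.refl
set-∘ f zero    v X (suc r) = ≡.refl
set-∘ f (suc i) v X zero    = ≡.refl
set-∘ f (suc i) v X (suc r) = set-∘ f i v (X ∘ suc) r

set-≡ : ∀ {a} {B : Set a} {k} (i : Fin k) (v : B) X → set i v X i ≡ v
set-≡ zero    v X = ≡.refl
set-≡ (suc i) v X = set-≡ i v (X ∘ suc)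

set-≢ : ∀ {a} {B : Set a} {k} {i r : Fin k} (v : B) X → r ≢ i → set i v X r ≡ X r
set-≢ {i = zero}  {zero}  v X r≢i = ⊥-elim (r≢i ≡.refl)
set-≢ {i = zero}  {suc r} v X r≢i = ≡.refl
set-≢ {i = suc i} {zero}  v X r≢i = ≡.refl
set-≢ {i = suc i} {suc r} v X r≢i = set-≢ v (X ∘ suc) (r≢i ∘ cong suc)

set-self : ∀ {a} {B : Set a} {k} (i : Fin k) (X : Fin k → B) → set i (X i) X ≗ X
set-self zero    X zero    = ≡.refl
set-self zero    X (suc r) = ≡.refl
set-self (suc i) X zero    = ≡.refl
set-self (suc i) X (suc r) = set-self i (X ∘ suc) r

set-comm : ∀ {a} {B : Set a} {k} {i j : Fin k} (v w : B) X → i ≢ j →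
           set i v (set j w X) ≗ set j w (set i v X)
set-comm {i = zero}  {zero}  v w X i≢j r       = ⊥-elim (i≢j ≡.refl)
set-comm {i = zero}  {suc j} v w X i≢j zero    = ≡.refl
set-comm {i = zero}  {suc j} v w X i≢j (suc r) = ≡.refl
set-comm {i = suc i} {zero}  v w X i≢j zero    = ≡.refl
set-comm {i = suc i} {zero}  v w X i≢j (suc r) = ≡.refl
set-comm {i = suc i} {suc j} v w X i≢j zero    = ≡.refl
set-comm {i = suc i} {suc j} v w X i≢j (suc r) = set-comm v w (X ∘ suc) (i≢j ∘ cong suc) r

module Determinant {c ℓ} (A : CommutativeRing c ℓ) where
  open CommutativeRing A hiding (zero)
  open RingProperties ring using (-0#≈0#; -‿+-comm; -‿distribʳ-*)
  open SetoidReasoning setoid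
  open PolynomialRing A using (medial)

  Vector : ℕ → Set c
  Vector k = Fin k → Carrier

  opaque
    -- Nested subtraction produces the signs of a Laplace expansion, so no powers of -1 have to be
    -- tracked.
    asum : ∀ k → Vector k → Carrier
    asum zero    f = 0#
    asum (suc k) f = f zero + - asum k (f ∘ suc)

    asum-cong : ∀ {k} {f g : Vector k} → (∀ i → f i ≈ g i) → asum k f ≈ asum k g
    asum-cong {zero}  e = refl
    asum-cong {suc k} e = +-cong (e zero) (-‿cong (asum-cong (e ∘ suc)))

    asum-+ : ∀ {k} (f g : Vector k) → asum k (λ i → f i + g i) ≈ asum k f + asum k g
    asum-+ {zero}  f g = sym (+-identityˡ _)
    asum-+ {suc k} f g = begin
      (f zero + g zero) + - asum k (λ i → f (suc i) + g (suc i))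
        ≈⟨ +-congˡ (trans (-‿cong (asum-+ (f ∘ suc) (g ∘ suc))) (sym (-‿+-comm _ _))) ⟩
      (f zero + g zero) + (- asum k (f ∘ suc) + - asum k (g ∘ suc)) ≈⟨ medial _ _ _ _ ⟩
      asum (suc k) f + asum (suc k) g ∎

    asum-zero : ∀ {k} {f : Vector k} → (∀ i → f i ≈ 0#) → asum k f ≈ 0#
    asum-zero {zero}  e = refl
    asum-zero {suc k} e = trans (+-cong (e zero) (trans (-‿cong (asum-zero (e ∘ suc))) -0#≈0#)) (+-identityˡ _)

    asum-* : ∀ {k} a (f : Vector k) → asum k (λ i → a * f i) ≈ a * asum k f
    asum-* {zero}  a f = sym (zeroʳ _)
    asum-* {suc k} a f = trans (+-congˡ (trans (-‿cong (asum-* a (f ∘ suc))) (-‿distribʳ-* _ _))) (sym (distribˡ _ _ _))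

    asum-neg : ∀ {k} (f : Vector k) → asum k (λ i → - f i) ≈ - asum k f
    asum-neg {zero}  f = sym -0#≈0#
    asum-neg {suc k} f = trans (+-congˡ (-‿cong (asum-neg (f ∘ suc)))) (-‿+-comm _ _)

    asum-swap : ∀ {k l} (f : Fin k → Fin l → Carrier) →
                asum k (λ i → asum l (f i)) ≈ asum l (λ j → asum k (λ i → f i j))
    asum-swap {zero}  {l} f = sym (asum-zero {l} (λ _ → refl))
    asum-swap {suc k} {l} f = begin
      asum l (f zero) + - asum k (λ i → asum l (f (suc i))) ≈⟨ +-congˡ (-‿cong (asum-swap (f ∘ suc))) ⟩
      asum l (f zero) + - asum l (λ j → asum k (λ i → f (suc i) j)) ≈⟨ +-congˡ (asum-neg {l} _) ⟨
      asum l (f zero) + asum l (λ j → - asum k (λ i → f (suc i) j)) ≈⟨ asum-+ {l} _ _ ⟨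
      asum l (λ j → asum (suc k) (λ i → f i j)) ∎

    asum-suc : ∀ {k} (f : Vector (suc k)) → asum (suc k) f ≡ f zero + - asum k (f ∘ suc)
    asum-suc f = ≡.refl

  opaque
    det : ∀ k → (Fin k → Vector k) → Carrier
    det zero    X = 1#
    det (suc k) X = asum (suc k) (λ j → X zero j * det k (λ r s → X (suc r) (punchIn j s)))

    det-zero : ∀ X → det 0 X ≡ 1#
    det-zero X = ≡.refl

    det-row : ∀ k X → det (suc k) X ≡ asum (suc k) (λ j → X zero j * det k (λ r s → X (suc r) (punchIn j s)))
    det-row k X = ≡.refl

    det-cong : ∀ k {X Y : Fin k → Vector k} → (∀ r s → X r s ≈ Y r s) → det k X ≈ det k Y
    det-cong zero    e = refl
    det-cong (suc k) e = asum-cong (λ j → *-cong (e zero j) (det-cong k (λ r s → e (suc r) (punchIn j s))))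

  exchange : ∀ x y z → x * (y * z) ≈ y * (x * z)
  exchange x y z = trans (sym (*-assoc _ _ _)) (trans (*-congʳ (*-comm _ _)) (*-assoc _ _ _))

  -- Apart from the corner term, expand along the first row and then each minor along its first
  -- column. The resulting double sum treats rows and columns alike, and `asum-swap` reads it the
  -- other way.
  det-column : ∀ k (X : Fin (suc k) → Vector (suc k)) →
    det (suc k) X ≈ asum (suc k) (λ i → X i zero * det k (λ r s → X (punchIn i r) (suc s)))
  det-column zero    X = begin
    det 1 X ≡⟨ det-row 0 X ⟩
    asum 1 _ ≈⟨ asum-cong (λ { zero → *-congˡ (det-cong 0 (λ ())) }) ⟩
    asum 1 _ ∎
  det-column (suc k) X = begin
    det (2 ℕ.+ k) X ≡⟨ ≡.trans (det-row (suc k) X) (asum-suc _) ⟩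
    X zero zero * det (suc k) (λ r s → X (suc r) (suc s)) +
      - asum (suc k) (λ j → X zero (suc j) * det (suc k) (λ r s → X (suc r) (punchIn (suc j) s)))
      ≈⟨ +-congˡ (-‿cong (begin
    asum (suc k) (λ j → X zero (suc j) * det (suc k) (λ r s → X (suc r) (punchIn (suc j) s)))
      ≈⟨ asum-cong (λ j → *-congˡ (det-column k (λ r s → X (suc r) (punchIn (suc j) s)))) ⟩
    asum (suc k) (λ j → X zero (suc j) * asum (suc k) (λ i → X (suc i) zero * E i j))
      ≈⟨ asum-cong (λ j → asum-* _ _) ⟨
    asum (suc k) (λ j → asum (suc k) (λ i → X zero (suc j) * (X (suc i) zero * E i j)))
      ≈⟨ asum-swap _ ⟩
    asum (suc k) (λ i → asum (suc k) (λ j → X zero (suc j) * (X (suc i) zero * E i j)))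
      ≈⟨ asum-cong (λ i → trans (asum-cong (λ j → exchange _ _ _)) (asum-* _ _)) ⟩
    asum (suc k) (λ i → X (suc i) zero * asum (suc k) (λ j → X zero (suc j) * E i j))
      ≈⟨ asum-cong (λ i → *-congˡ (reflexive (≡.sym (det-row k (λ r s → X (punchIn (suc i) r) (suc s)))))) ⟩
    asum (suc k) (λ i → X (suc i) zero * det (suc k) (λ r s → X (punchIn (suc i) r) (suc s))) ∎)) ⟩
    X zero zero * det (suc k) (λ r s → X (suc r) (suc s)) +
      - asum (suc k) (λ i → X (suc i) zero * det (suc k) (λ r s → X (punchIn (suc i) r) (suc s))) 
      ≡⟨ asum-suc _ ⟨
    asum (2 ℕ.+ k) (λ i → X i zero * det (suc k) (λ r s → X (punchIn i r) (suc s))) ∎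
    where
    E : Fin (suc k) → Fin (suc k) → Carrier
    E i j = det k (λ r s → X (suc (punchIn i r)) (suc (punchIn j s)))

  det-transpose : ∀ k (X : Fin k → Vector k) → det k X ≈ det k (λ r s → X s r)
  det-transpose zero    X = det-cong 0 (λ ())
  det-transpose (suc k) X = trans (det-column k X) (trans
    (asum-cong (λ i → *-congˡ (det-transpose k (λ r s → X (punchIn i r) (suc s)))))
    (reflexive (≡.sym (det-row k _))))

  private
    set-minor : ∀ {k} (i : Fin k) (v : Vector (suc k)) (X : Fin (suc k) → Vector (suc k)) j →
      det k (λ r s → set (suc i) v X (suc r) (punchIn j s)) ≈
      det k (set i (v ∘ punchIn j) (λ r → X (suc r) ∘ punchIn j))
    set-minor {k} i v X j = det-cong k (λ r s → reflexive (≡.cong (λ f → f s) (set-∘ (_∘ punchIn j) i v (X ∘ suc) r)))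

  det-+ : ∀ {k} (i : Fin k) (v w : Vector k) X →
    det k (set i (λ s → v s + w s) X) ≈ det k (set i v X) + det k (set i w X)
  det-+ {suc k} i v w X = begin
    det (suc k) (set i (λ s → v s + w s) X) ≡⟨ det-row k _ ⟩
    asum (suc k) _                          ≈⟨ asum-cong (expand i) ⟩
    asum (suc k) _                          ≈⟨ asum-+ _ _ ⟩
    asum (suc k) _ + asum (suc k) _         ≡⟨ ≡.cong₂ _+_ (det-row k _) (det-row k _) ⟨
    det (suc k) (set i v X) + det (suc k) (set i w X) ∎
    where
    expand : ∀ i j →
      set i (λ s → v s + w s) X zero j * det k (λ r s → set i (λ s → v s + w s) X (suc r) (punchIn j s)) ≈
      set i v X zero j * det k (λ r s → set i v X (suc r) (punchIn j s)) +
      set i w X zero j * det k (λ r s → set i w X (suc r) (punchIn j s))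
    expand zero    j = distribʳ _ _ _
    expand (suc i) j = trans (*-congˡ (
      trans (set-minor i _ X j) (trans (det-+ i (v ∘ punchIn j) (w ∘ punchIn j) (λ r → X (suc r) ∘ punchIn j))
      (sym (+-cong (set-minor i v X j) (set-minor i w X j)))))) (distribˡ _ _ _)

  det-* : ∀ {k} (i : Fin k) a (v : Vector k) X →
    det k (set i (λ s → a * v s) X) ≈ a * det k (set i v X)
  det-* {suc k} i a v X = begin
    det (suc k) (set i (λ s → a * v s) X) ≡⟨ det-row k _ ⟩
    asum (suc k) _                        ≈⟨ asum-cong (expand i) ⟩
    asum (suc k) _                        ≈⟨ asum-* _ _ ⟩
    a * asum (suc k) _                    ≡⟨ cong (a *_) (det-row k _) ⟨
    a * det (suc k) (set i v X) ∎
    where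
    expand : ∀ i j →
      set i (λ s → a * v s) X zero j * det k (λ r s → set i (λ s → a * v s) X (suc r) (punchIn j s)) ≈
      a * (set i v X zero j * det k (λ r s → set i v X (suc r) (punchIn j s)))
    expand zero    j = *-assoc _ _ _
    expand (suc i) j = trans (*-congˡ (
      trans (set-minor i _ X j) (trans (det-* i a (v ∘ punchIn j) (λ r → X (suc r) ∘ punchIn j))
      (*-congˡ (sym (set-minor i v X j)))))) (exchange _ _ _)

  det-set-cong : ∀ {k} (i : Fin k) {v w : Vector k} X → (∀ s → v s ≈ w s) → det k (set i v X) ≈ det k (set i w X)
  det-set-cong {k} i {v} {w} X e = det-cong k (pointwise i X)
    where
    pointwise : ∀ {l} (i : Fin l) (X : Fin l → Vector k) r s → set i v X r s ≈ set i w X r s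
    pointwise zero    X zero    s = e s
    pointwise zero    X (suc r) s = refl
    pointwise (suc i) X zero    s = refl
    pointwise (suc i) X (suc r) s = pointwise i (X ∘ suc) r s

  det-≗ : ∀ k {X X′ : Fin k → Vector k} → X ≗ X′ → det k X ≈ det k X′
  det-≗ k e = det-cong k (λ r s → reflexive (≡.cong (λ f → f s) (e r)))

  -- Polarization: expand the vanishing determinant with v + w in both rows. The converse would
  -- divide by 2, which is why alternation is taken as the starting point.
  alternating⇒antisymmetric : ∀ {k} {i j : Fin k} (X : Fin k → Vector k) → i ≢ j →
    (∀ v → det k (set i v (set j v X)) ≈ 0#) →
    ∀ v w → det k (set i v (set j w X)) ≈ - det k (set i w (set j v X))
  alternating⇒antisymmetric {k} {i} {j} X i≢j alt v w = sym (+-inverseˡ-unique′ (begin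
    D v w + D w v                       ≈⟨ +-cong (+-identityˡ _) (+-identityʳ _) ⟨
    (0# + D v w) + (D w v + 0#)         ≈⟨ +-cong (+-congʳ (alt v)) (+-congˡ (alt w)) ⟨
    (D v v + D v w) + (D w v + D w w)   ≈⟨ +-cong (linʳ v) (linʳ w) ⟨
    D v v+w + D w v+w                   ≈⟨ det-+ i v w _ ⟨
    D v+w v+w                           ≈⟨ alt v+w ⟩
    0#                                  ∎))
    where
    D : Vector k → Vector k → Carrier
    D v w = det k (set i v (set j w X))
    v+w : Vector k
    v+w s = v s + w s
    flip : ∀ u u′ → D u u′ ≈ det k (set j u′ (set i u X))
    flip u u′ = det-≗ k (set-comm u u′ X i≢j)
    linʳ : ∀ u → D u v+w ≈ D u v + D u w
    linʳ u = trans (flip u v+w) (trans (det-+ j v w _) (sym (+-cong (flip u v) (flip u w))))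
    +-inverseˡ-unique′ : ∀ {x y} → x + y ≈ 0# → - y ≈ x
    +-inverseˡ-unique′ {x} {y} e = sym (begin
      x             ≈⟨ +-identityʳ x ⟨
      x + 0#        ≈⟨ +-congˡ (-‿inverseʳ y) ⟨
      x + (y + - y) ≈⟨ +-assoc _ _ _ ⟨
      x + y + - y   ≈⟨ +-congʳ e ⟩
      0# + - y      ≈⟨ +-identityˡ _ ⟩
      - y           ∎)

  private
    -- In the expansion along the first column the terms of rows 0 and 1 cancel, and the minor in
    -- every other term still has two equal top rows.
    det-alternating₀₁ : ∀ k (X : Fin (2 ℕ.+ k) → Vector (2 ℕ.+ k)) →
      (∀ s → X zero s ≈ X (suc zero) s) → det (2 ℕ.+ k) X ≈ 0#
    det-alternating₀₁ k X e = begin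
      det (2 ℕ.+ k) X         ≈⟨ det-column (suc k) X ⟩
      asum (2 ℕ.+ k) f        ≡⟨ ≡.trans (asum-suc f) (cong (λ z → f zero + - z) (asum-suc (f ∘ suc))) ⟩
      f zero + - (f (suc zero) + - asum k (λ i → f (suc (suc i))))
        ≈⟨ +-congˡ (-‿cong (trans (+-congˡ (trans (-‿cong (asum-zero (others k X e))) -0#≈0#)) (+-identityʳ _))) ⟩
      f zero + - f (suc zero)
        ≈⟨ +-congʳ (*-cong (e zero) (det-cong (suc k) λ { zero s → sym (e (suc s)) ; (suc r) s → refl })) ⟩
      f (suc zero) + - f (suc zero) ≈⟨ -‿inverseʳ _ ⟩
      0# ∎
      where
      f : Vector (2 ℕ.+ k)
      f i = X i zero * det (suc k) (λ r s → X (punchIn i r) (suc s))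
      others : ∀ k (X : Fin (2 ℕ.+ k) → Vector (2 ℕ.+ k)) → (∀ s → X zero s ≈ X (suc zero) s) → (t : Fin k) →
        X (suc (suc t)) zero * det (suc k) (λ r s → X (punchIn (suc (suc t)) r) (suc s)) ≈ 0#
      others (suc k) X e t = trans (*-congˡ (det-alternating₀₁ k (λ r s → X (punchIn (suc (suc t)) r) (suc s)) (e ∘ suc))) (zeroʳ _)

    det-row-zero : ∀ k (X : Fin (suc k) → Vector (suc k)) →
      (∀ t → det k (λ r s → X (suc r) (punchIn t s)) ≈ 0#) → det (suc k) X ≈ 0#
    det-row-zero k X e = trans (reflexive (det-row k X)) (asum-zero (λ t → trans (*-congˡ (e t)) (zeroʳ _)))

    -- Two equal rows below the first survive in all minors of the expansion along the first row. If
    -- row 0 is one of them, exchanging it with row 1 leads back to this case, unless row 1 is the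
    -- other.
    det-alternating-< : ∀ k (X : Fin k → Vector k) {i j} → i Fin.< j → (∀ s → X i s ≈ X j s) → det k X ≈ 0#
    det-alternating-< (suc k) X {suc i} {suc j} (s≤s i<j) e = det-row-zero k X (λ t →
      det-alternating-< k (λ r s → X (suc r) (punchIn t s)) i<j (e ∘ punchIn t))
    det-alternating-< (suc (suc k)) X {zero} {suc zero}    _ e = det-alternating₀₁ k X e
    det-alternating-< (suc (suc k)) X {zero} {suc (suc j)} _ e = begin
      det (2 ℕ.+ k) X
        ≈⟨ det-cong (2 ℕ.+ k) (λ { zero _ → refl ; (suc zero) _ → refl ; (suc (suc r)) _ → refl }) ⟩
      det (2 ℕ.+ k) (set zero (X zero) (set (suc zero) (X (suc zero)) X))
        ≈⟨ alternating⇒antisymmetric {i = zero} {suc zero} X (λ ()) (λ v → det-alternating₀₁ k _ (λ _ → refl)) _ _ ⟩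
      - det (2 ℕ.+ k) (set zero (X (suc zero)) (set (suc zero) (X zero) X))
        ≈⟨ -‿cong (det-row-zero (suc k) _ (λ t → det-alternating-< (suc k)
             (λ r s → set zero (X (suc zero)) (set (suc zero) (X zero) X) (suc r) (punchIn t s))
             {zero} {suc j} (s≤s z≤n) (e ∘ punchIn t))) ⟩
      - 0# ≈⟨ -0#≈0# ⟩
      0# ∎

  det-alternating : ∀ k (X : Fin k → Vector k) {i j} → i ≢ j → (∀ s → X i s ≈ X j s) → det k X ≈ 0#
  det-alternating k X {i} {j} i≢j e with Fin.<-cmp i j
  ... | tri< i<j _ _ = det-alternating-< k X i<j e
  ... | tri≈ _ i≡j _ = ⊥-elim (i≢j i≡j)
  ... | tri> _ _ j<i = det-alternating-< k X j<i (sym ∘ e)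

  det-swap : ∀ {k} {i j : Fin k} (X : Fin k → Vector k) → i ≢ j → ∀ v w →
    det k (set i v (set j w X)) ≈ - det k (set i w (set j v X))
  det-swap {k} {i} {j} X i≢j = alternating⇒antisymmetric X i≢j (λ v → det-alternating k _ i≢j (λ s →
    reflexive (≡.cong (λ f → f s) (≡.trans (set-≡ i v _) (≡.sym (≡.trans (set-≢ v (set j v X) (i≢j ∘ ≡.sym)) (set-≡ j v X)))))))

-- Rank functions of permutations

[_<_] : ℕ → ℕ → ℕ
[ _     < zero ]  = 0
[ zero  < suc _ ] = 1
[ suc k < suc a ] = [ k < a ]

[<]-yes : ∀ {k a} → k < a → [ k < a ] ≡ 1
[<]-yes {zero}  {suc a} _         = ≡.refl
[<]-yes {suc k} {suc a} (s≤s k<a) = [<]-yes k<a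

[<]-no : ∀ {k a} → a ≤ k → [ k < a ] ≡ 0
[<]-no {k}     {zero}  _         = ≡.refl
[<]-no {suc k} {suc a} (s≤s a≤k) = [<]-no a≤k

-- Here x k is the row, counted from the bottom, of the dot of w in column k; rk x a b counts the
-- dots in the bottom a rows and leftmost b columns.
rk : (ℕ → ℕ) → ℕ → ℕ → ℕ
rk x a zero    = 0
rk x a (suc b) = [ x b < a ] ℕ.+ rk x a b

rk-cong : ∀ {x y : ℕ → ℕ} a b → (∀ k → k < b → x k ≡ y k) → rk x a b ≡ rk y a b
rk-cong a zero    e = ≡.refl
rk-cong a (suc b) e = cong₂ ℕ._+_ (cong (λ z → [ z < a ]) (e b ℕ.≤-refl)) (rk-cong a b (λ k k<b → e k (ℕ.m<n⇒m<1+n k<b)))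

rk≤ : ∀ x a b → rk x a b ≤ b
rk≤ x a zero = z≤n
rk≤ x a (suc b) with x b <? a
... | yes p = subst (λ i → i ℕ.+ rk x a b ≤ suc b) (≡.sym ([<]-yes p)) (s≤s (rk≤ x a b))
... | no ¬p = subst (λ i → i ℕ.+ rk x a b ≤ suc b) (≡.sym ([<]-no (ℕ.≮⇒≥ ¬p))) (ℕ.m≤n⇒m≤1+n (rk≤ x a b))

sw : ℕ → ℕ → ℕ
sw zero    zero          = 1
sw zero    (suc zero)    = 0
sw zero    (suc (suc k)) = suc (suc k)
sw (suc j) zero          = 0
sw (suc j) (suc k)       = suc (sw j k)

sw-j : ∀ j → sw j j ≡ suc j
sw-j zero    = ≡.refl
sw-j (suc j) = cong suc (sw-j j)

sw-1+j : ∀ j → sw j (suc j) ≡ j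
sw-1+j zero    = ≡.refl
sw-1+j (suc j) = cong suc (sw-1+j j)

sw-else : ∀ j {k} → k ≢ j → k ≢ suc j → sw j k ≡ k
sw-else zero    {zero}        p q = ⊥-elim (p ≡.refl)
sw-else zero    {suc zero}    p q = ⊥-elim (q ≡.refl)
sw-else zero    {suc (suc k)} p q = ≡.refl
sw-else (suc j) {zero}        p q = ≡.refl
sw-else (suc j) {suc k}       p q = cong suc (sw-else j (p ∘ cong suc) (q ∘ cong suc))

sw-involutive : ∀ j k → sw j (sw j k) ≡ k
sw-involutive zero    zero          = ≡.refl
sw-involutive zero    (suc zero)    = ≡.refl
sw-involutive zero    (suc (suc k)) = ≡.refl
sw-involutive (suc j) zero          = ≡.refl
sw-involutive (suc j) (suc k)       = cong suc (sw-involutive j k)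

-- In terms of w this is an ascent at j, since x reverses the values of w.
Inv : ℕ → (ℕ → ℕ) → Set
Inv j x = x (suc j) < x j

up : ℕ → (ℕ → ℕ) → ℕ → ℕ
up j x with x (suc j) <? x j
... | yes _ = x ∘ sw j
... | no  _ = x

up-inv : ∀ {j x} → Inv j x → up j x ≡ x ∘ sw j
up-inv {j} {x} i with x (suc j) <? x j
... | yes _ = ≡.refl
... | no ¬i = ⊥-elim (¬i i)

up-noninv : ∀ {j x} → ¬ Inv j x → up j x ≡ x
up-noninv {j} {x} ¬i with x (suc j) <? x j
... | yes i = ⊥-elim (¬i i)
... | no _  = ≡.refl

rk-sw-≤ : ∀ x j a b → b ≤ j → rk (x ∘ sw j) a b ≡ rk x a b
rk-sw-≤ x j a b b≤j = rk-cong a b (λ k k<b → let k<j = ℕ.<-≤-trans k<b b≤j in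
  cong x (sw-else j (ℕ.<⇒≢ k<j) (ℕ.<⇒≢ (ℕ.m<n⇒m<1+n k<j))))

rk-sw-mid : ∀ x j a → rk (x ∘ sw j) a (suc j) ≡ [ x (suc j) < a ] ℕ.+ rk x a j
rk-sw-mid x j a = cong₂ (λ k → [ x k < a ] ℕ.+_) (sw-j j) (rk-sw-≤ x j a j ℕ.≤-refl)

+-exchange : ∀ p q r → p ℕ.+ (q ℕ.+ r) ≡ q ℕ.+ (p ℕ.+ r)
+-exchange p q r = ≡.trans (≡.sym (ℕ.+-assoc p q r)) (≡.trans (cong (ℕ._+ r) (ℕ.+-comm p q)) (ℕ.+-assoc q p r))

rk-sw-> : ∀ x j a b → suc (suc j) ≤ b → rk (x ∘ sw j) a b ≡ rk x a b
rk-sw-> x j a (suc b) (s≤s j<b) with ℕ.m≤n⇒m<n∨m≡n j<b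
... | inj₁ j+1<b  = cong₂ (λ k → [ x k < a ] ℕ.+_) (sw-else j (ℕ.>⇒≢ j<b) (ℕ.>⇒≢ j+1<b)) (rk-sw-> x j a b j+1<b)
... | inj₂ ≡.refl = ≡.trans (cong₂ (λ k → [ x k < a ] ℕ.+_) (sw-1+j j) (rk-sw-mid x j a)) (+-exchange [ x j < a ] [ x (suc j) < a ] (rk x a j))

rk-up-≢ : ∀ x j a b → b ≢ suc j → rk (up j x) a b ≡ rk x a b
rk-up-≢ x j a b b≢ with x (suc j) <? x j
... | no  _ = ≡.refl
... | yes _ with ℕ.<-cmp b (suc j)
...   | tri< (s≤s b≤j) _ _ = rk-sw-≤ x j a b b≤j
...   | tri≈ _ b≡ _ = ⊥-elim (b≢ b≡)
...   | tri> _ _ j<b = rk-sw-> x j a b j<b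

-- After `up` the smaller of the two values comes first, so the middle rank is as large as its
-- neighbours permit. Only the ranks at j and j + 2 enter, so `up j` forgets the rank condition at j
-- + 1.
rk-up-mid : ∀ x j a → rk (up j x) a (suc j) ≡ suc (rk x a j) ℕ.⊓ rk x a (suc (suc j))
rk-up-mid x j a with x (suc j) <? x j
... | yes i = ≡.trans (rk-sw-mid x j a) eq
  where
  eq : [ x (suc j) < a ] ℕ.+ rk x a j ≡ suc (rk x a j) ℕ.⊓ ([ x (suc j) < a ] ℕ.+ ([ x j < a ] ℕ.+ rk x a j))
  eq with x (suc j) <? a | x j <? a
  ... | yes p | yes q rewrite [<]-yes p | [<]-yes q = cong suc (≡.sym (ℕ.m≤n⇒m⊓n≡m (ℕ.n≤1+n _)))
  ... | yes p | no ¬q rewrite [<]-yes p | [<]-no (ℕ.≮⇒≥ ¬q) = cong suc (≡.sym (ℕ.⊓-idem _))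
  ... | no ¬p | yes q = ⊥-elim (¬p (ℕ.<-trans i q))
  ... | no ¬p | no ¬q rewrite [<]-no (ℕ.≮⇒≥ ¬p) | [<]-no (ℕ.≮⇒≥ ¬q) = ≡.sym (ℕ.m≥n⇒m⊓n≡n (ℕ.n≤1+n _))
... | no ¬i = eq
  where
  eq : [ x j < a ] ℕ.+ rk x a j ≡ suc (rk x a j) ℕ.⊓ ([ x (suc j) < a ] ℕ.+ ([ x j < a ] ℕ.+ rk x a j))
  eq with x (suc j) <? a | x j <? a
  ... | yes p | yes q rewrite [<]-yes p | [<]-yes q = cong suc (≡.sym (ℕ.m≤n⇒m⊓n≡m (ℕ.n≤1+n _)))
  ... | no ¬p | yes q rewrite [<]-no (ℕ.≮⇒≥ ¬p) | [<]-yes q = cong suc (≡.sym (ℕ.⊓-idem _))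
  ... | yes p | no ¬q = ⊥-elim (¬q (ℕ.≤-<-trans (ℕ.≮⇒≥ ¬i) p))
  ... | no ¬p | no ¬q rewrite [<]-no (ℕ.≮⇒≥ ¬p) | [<]-no (ℕ.≮⇒≥ ¬q) = ≡.sym (ℕ.m≥n⇒m⊓n≡n (ℕ.n≤1+n _))

-- The three possible shapes of the ranks in row a around columns j and j+1.
data InvRank (x : ℕ → ℕ) (j a : ℕ) : Set where
  equalʳ : rk x a (suc j) ≡ rk x a (suc (suc j)) → InvRank x j a
  stepˡ  : rk x a (suc j) ≡ suc (rk x a j) → InvRank x j a
  middle : rk x a (suc j) ≡ rk x a j → rk x a (suc (suc j)) ≡ suc (rk x a j) → InvRank x j a

invRank : ∀ x j a → Inv j x → InvRank x j a
invRank x j a i with x (suc j) <? a | x j <? a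
... | yes p | yes q = stepˡ (cong (ℕ._+ rk x a j) ([<]-yes q))
... | yes p | no ¬q = middle (cong (ℕ._+ rk x a j) ([<]-no (ℕ.≮⇒≥ ¬q)))
                             (cong₂ (λ m n → m ℕ.+ (n ℕ.+ rk x a j)) ([<]-yes p) ([<]-no (ℕ.≮⇒≥ ¬q)))
... | no ¬p | _     = equalʳ (cong (ℕ._+ rk x a (suc j)) (≡.sym ([<]-no (ℕ.≮⇒≥ ¬p))))

-- Dual to `rk-up-mid`: at an inversion the middle rank is as small as its neighbours permit.
rk-inv-mid : ∀ x j a → Inv j x → rk x a (suc j) ≡ rk x a j ℕ.⊔ (rk x a (suc (suc j)) ℕ.∸ 1)
rk-inv-mid x j a i with x (suc j) <? a | x j <? a
... | yes p | yes q rewrite [<]-yes p | [<]-yes q = ≡.sym (ℕ.m≤n⇒m⊔n≡n (ℕ.n≤1+n _))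
... | yes p | no ¬q rewrite [<]-yes p | [<]-no (ℕ.≮⇒≥ ¬q) = ≡.sym (ℕ.⊔-idem _)
... | no ¬p | yes q = ⊥-elim (¬p (ℕ.<-trans i q))
... | no ¬p | no ¬q rewrite [<]-no (ℕ.≮⇒≥ ¬p) | [<]-no (ℕ.≮⇒≥ ¬q) = ≡.sym (ℕ.m≥n⇒m⊔n≡m (ℕ.m∸n≤m _ 1))

rk-mono-b : ∀ x a {b b′} → b ≤ b′ → rk x a b ≤ rk x a b′
rk-mono-b x a {b} {zero}   z≤n = z≤n
rk-mono-b x a {b} {suc b′} b≤b′ with ℕ.m≤n⇒m<n∨m≡n b≤b′
... | inj₁ (s≤s b≤b″) = ℕ.≤-trans (rk-mono-b x a b≤b″) (ℕ.m≤n+m _ _)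
... | inj₂ ≡.refl     = ℕ.≤-refl

rk≤up : ∀ x j a b → rk x a b ≤ rk (up j x) a b
rk≤up x j a b with b ℕ.≟ suc j
... | no  b≢     = ℕ.≤-reflexive (≡.sym (rk-up-≢ x j a b b≢))
... | yes ≡.refl = ℕ.≤-trans (ℕ.⊓-glb lower (rk-mono-b x a (ℕ.n≤1+n (suc j)))) (ℕ.≤-reflexive (≡.sym (rk-up-mid x j a)))
  where
  lower : rk x a (suc j) ≤ suc (rk x a j)
  lower with x j <? a
  ... | yes p rewrite [<]-yes p = ℕ.≤-refl
  ... | no ¬p rewrite [<]-no (ℕ.≮⇒≥ ¬p) = ℕ.n≤1+n _

-- For a permutation this holds because a row contains one dot. In the identity chart it makes a
-- minor of size at most the rank fit into the bottom a rows, as `rk≤` does for the columns.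
RankBounded : (ℕ → ℕ) → Set
RankBounded x = ∀ a b → rk x a b ≤ a

up-bounded : ∀ {x} j → RankBounded x → RankBounded (up j x)
up-bounded {x} j bd a b with b ℕ.≟ suc j
... | no  b≢     = subst (_≤ a) (≡.sym (rk-up-≢ x j a b b≢)) (bd a b)
... | yes ≡.refl = subst (_≤ a) (≡.sym (rk-up-mid x j a)) (ℕ.≤-trans (ℕ.m⊓n≤n _ _) (bd a (suc (suc j))))

infix 4 _⊏_
-- Strict Bruhat order in terms of ranks. Larger ranks mean larger generating minors, so the ideal
-- of `x′` is contained in that of `x`.
record _⊏_ (x x′ : ℕ → ℕ) : Set where
  field
    le     : ∀ a b → rk x a b ≤ rk x′ a b
    strict : ∃₂ λ a b → rk x a b < rk x′ a b

-- The witness is the row bound just above the dot of column j + 1: it admits that dot but not the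
-- higher one of column j, so exchanging the columns raises the rank at j + 1.
⊏-up : ∀ {j x} → Inv j x → x ⊏ up j x
⊏-up {j} {x} i = record { le = rk≤up x j ; strict = suc (x (suc j)) , suc j , (begin-strict
    [ x j < suc (x (suc j)) ] ℕ.+ rk x (suc (x (suc j))) j          ≡⟨ cong (ℕ._+ rk x (suc (x (suc j))) j) ([<]-no i) ⟩
    rk x (suc (x (suc j))) j                                      <⟨ ℕ.n<1+n _ ⟩
    suc (rk x (suc (x (suc j))) j)                                ≡⟨ cong (ℕ._+ rk x (suc (x (suc j))) j) ([<]-yes (ℕ.n<1+n (x (suc j)))) ⟨
    [ x (suc j) < suc (x (suc j)) ] ℕ.+ rk x (suc (x (suc j))) j    ≡⟨ rk-sw-mid x j _ ⟨
    rk (x ∘ sw j) (suc (x (suc j))) (suc j)                       ≡⟨ cong (λ y → rk y (suc (x (suc j))) (suc j)) (up-inv {j} {x} i) ⟨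
    rk (up j x) (suc (x (suc j))) (suc j)                         ∎) }
  where
  open ℕ.≤-Reasoning

-- Strictness could be lost only at j + 1, where `up` forgets the rank. If both have an inversion,
-- `rk-inv-mid` shows that a strict inequality there forces one at j or j + 2. If `x` has none, `up`
-- leaves `x` alone and only raises the rank of `x′`.
up-⊏ : ∀ {j x x′} → Inv j x′ → x ⊏ x′ → up j x ⊏ up j x′
up-⊏ {j} {x} {x′} i′ x⊏x′ = record { le = le′ ; strict = strict′ strict }
  where
  open _⊏_ x⊏x′
  le′ : ∀ a b → rk (up j x) a b ≤ rk (up j x′) a b
  le′ a b with b ℕ.≟ suc j
  ... | no b≢ = ≡.subst₂ _≤_ (≡.sym (rk-up-≢ x j a b b≢)) (≡.sym (rk-up-≢ x′ j a b b≢)) (le a b)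
  ... | yes ≡.refl = ≡.subst₂ _≤_ (≡.sym (rk-up-mid x j a)) (≡.sym (rk-up-mid x′ j a))
                       (ℕ.⊓-mono-≤ (s≤s (le a j)) (le a (suc (suc j))))
  move : ∀ {a b} → b ≢ suc j → rk x a b < rk x′ a b → ∃₂ λ a b → rk (up j x) a b < rk (up j x′) a b
  move {a} {b} b≢ p = a , b , ≡.subst₂ _<_ (≡.sym (rk-up-≢ x j a b b≢)) (≡.sym (rk-up-≢ x′ j a b b≢)) p
  strict′ : (∃₂ λ a b → rk x a b < rk x′ a b) → ∃₂ λ a b → rk (up j x) a b < rk (up j x′) a b
  strict′ (a , b , p) with b ℕ.≟ suc j
  ... | no b≢ = move b≢ p
  ... | yes ≡.refl with x (suc j) <? x j
  ...   | no ¬i = a , suc j , ℕ.<-≤-trans p (rk≤up x′ j a (suc j))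
  ...   | yes i with rk x a j <? rk x′ a j | rk x a (suc (suc j)) <? rk x′ a (suc (suc j))
  ...     | yes q | _     = a , j , ≡.subst₂ _<_ (≡.sym (rk-sw-≤ x j a j ℕ.≤-refl)) (≡.sym (rk-up-≢ x′ j a j (λ ()))) q
  ...     | no _  | yes q = a , suc (suc j) , ≡.subst₂ _<_ (≡.sym (rk-sw-> x j a (suc (suc j)) ℕ.≤-refl))
                              (≡.sym (rk-up-≢ x′ j a (suc (suc j)) (λ ()))) q
  ...     | no ¬q | no ¬q′ = ⊥-elim (ℕ.<⇒≱ p (≡.subst₂ _≤_ (≡.sym (rk-inv-mid x′ j a i′)) (≡.sym (rk-inv-mid x j a i))
                              (ℕ.⊔-mono-≤ (ℕ.≮⇒≥ ¬q) (ℕ.∸-monoˡ-≤ 1 (ℕ.≮⇒≥ ¬q′)))))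

-- Ideals of minors

infixr 5 _◂_
_◂_ : ∀ {a} {B : Set a} {k} → B → (Fin k → B) → Fin (suc k) → B
(b ◂ f) zero    = b
(b ◂ f) (suc t) = f t

Below : ∀ {k} → (Fin k → ℕ) → ℕ → Set
Below R a = ∀ t → R t < a

◂-below : ∀ {k b a} {R : Fin k → ℕ} → b < a → Below R a → Below (b ◂ R) a
◂-below p q zero    = p
◂-below p q (suc t) = q t

data Slots {k} (C : Fin k → ℕ) (j : ℕ) : Set where
  none : Below C j → Slots C j
  one  : ∀ s → C s ≡ j → (∀ t → t ≢ s → C t < j) → Slots C j
  two  : ∀ s s′ → s ≢ s′ → C s ≡ C s′ → Slots C j

slots : ∀ {k} (C : Fin k → ℕ) j → Below C (suc j) → Slots C j
slots {zero}  C j C< = none λ ()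
slots {suc k} C j C< with C zero ℕ.≟ j | slots (C ∘ suc) j (C< ∘ suc)
... | _      | two s s′ s≢s′ e = two (suc s) (suc s′) (s≢s′ ∘ Fin.suc-injective) e
... | yes e  | none h = one zero e λ { zero t≢ → ⊥-elim (t≢ ≡.refl) ; (suc t) _ → h t }
... | yes e  | one s e′ _ = two zero (suc s) (λ ()) (≡.trans e (≡.sym e′))
... | no C≢j | none h = none λ { zero → ℕ.≤∧≢⇒< (ℕ.s≤s⁻¹ (C< zero)) C≢j ; (suc t) → h t }
... | no C≢j | one s e h = one (suc s) e λ { zero _ → ℕ.≤∧≢⇒< (ℕ.s≤s⁻¹ (C< zero)) C≢j ; (suc t) t≢ → h t (t≢ ∘ cong suc) }

module Minors {c ℓ} (A : CommutativeRing c ℓ) where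
  open CommutativeRing A hiding (zero)
  open RingProperties ring using (-1*x≈-x)
  open SetoidReasoning setoid
  open Determinant A

  record IsIdeal {q} (J : Carrier → Set q) : Set (c ⊔ ℓ ⊔ q) where
    field
      resp : ∀ {f g} → f ≈ g → J f → J g
      0∈   : J 0#
      +∈   : ∀ {f g} → J f → J g → J (f + g)
      *∈   : ∀ h {f} → J f → J (h * f)
    zero∈ : ∀ {f} → f ≈ 0# → J f
    zero∈ e = resp (sym e) 0∈
    neg∈ : ∀ {f} → J f → J (- f)
    neg∈ {f} m = resp (-1*x≈-x f) (*∈ (- 1#) m)
    ∈* : ∀ h {f} → J f → J (f * h)
    ∈* h m = resp (*-comm _ _) (*∈ h m)
    opaque
      unfolding asum
      asum∈ : ∀ {k} {f : Vector k} → (∀ i → J (f i)) → J (asum k f)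
      asum∈ {zero}  m = 0∈
      asum∈ {suc k} m = +∈ (m zero) (neg∈ (asum∈ (m ∘ suc)))

  Matrix : Set c
  Matrix = ℕ → ℕ → Carrier

  -- Indexed by (column, row), so that the row operations of det act on the columns of M.
  minor : Matrix → ∀ {k} → (R C : Fin k → ℕ) → Carrier
  minor M {k} R C = det k (λ t s → M (R s) (C t))

  minor-congᶜ : ∀ (M : Matrix) {k} (R : Fin k → ℕ) {C C′ : Fin k → ℕ} → C ≗ C′ → minor M R C ≈ minor M R C′
  minor-congᶜ M {k} R e = det-cong k (λ t s → reflexive (cong (M (R s)) (e t)))

  minor-cong : ∀ {M M′ : Matrix} {k} (R C : Fin k → ℕ) → (∀ s t → M (R s) (C t) ≈ M′ (R s) (C t)) → minor M R C ≈ minor M′ R C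
  minor-cong {k = k} R C e = det-cong k (λ t s → e s t)

  minor-expand : ∀ M {k} (R : Fin (suc k) → ℕ) c (C : Fin k → ℕ) →
    minor M R (c ◂ C) ≈ asum (suc k) (λ s → M (R s) c * minor M (R ∘ punchIn s) C)
  minor-expand M R c C = reflexive (det-row _ _)

  -- The index maps need not increase. This adds only zeros and generators up to sign, and lets
  -- columns and rows be prepended without sorting.
  data MinorIdeal (M : Matrix) (r : ℕ → ℕ → ℕ) : Carrier → Set (c ⊔ ℓ) where
    gen  : ∀ {k} a b (R C : Fin k → ℕ) → k ≡ suc (r a b) → Below R a → Below C b → MinorIdeal M r (minor M R C)
    resp : ∀ {f g} → f ≈ g → MinorIdeal M r f → MinorIdeal M r g
    0∈   : MinorIdeal M r 0#
    +∈   : ∀ {f g} → MinorIdeal M r f → MinorIdeal M r g → MinorIdeal M r (f + g)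
    *∈   : ∀ h {f} → MinorIdeal M r f → MinorIdeal M r (h * f)

  minorIdeal : ∀ M r → IsIdeal (MinorIdeal M r)
  minorIdeal M r = record { resp = resp ; 0∈ = 0∈ ; +∈ = +∈ ; *∈ = *∈ }

  MinorIdeal-elim : ∀ {q} {M r} {J : Carrier → Set q} → IsIdeal J →
    (∀ {k} a b (R C : Fin k → ℕ) → k ≡ suc (r a b) → Below R a → Below C b → J (minor M R C)) →
    ∀ {f} → MinorIdeal M r f → J f
  MinorIdeal-elim {M = M} {r} {J} I g = go
    where
    go : ∀ {f} → MinorIdeal M r f → J f
    go (gen a b R C e R< C<) = g a b R C e R< C<
    go (resp e m) = IsIdeal.resp I e (go m)
    go 0∈ = IsIdeal.0∈ I
    go (+∈ m n) = IsIdeal.+∈ I (go m) (go n)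
    go (*∈ h m) = IsIdeal.*∈ I h (go m)

  -- Expansion along the front column lowers the size by one until it is that of a generator.
  large : ∀ {M r} {k} a b (R C : Fin k → ℕ) → r a b < k → Below R a → Below C b → MinorIdeal M r (minor M R C)
  large {M} {r} {suc k} a b R C (s≤s r≤k) R< C< with ℕ.m≤n⇒m<n∨m≡n r≤k
  ... | inj₂ ≡.refl = gen a b R C ≡.refl R< C<
  ... | inj₁ r<k = resp (reflexive (≡.sym (det-row k _)))
        (IsIdeal.asum∈ (minorIdeal M r) (λ s → *∈ _ (large a b (R ∘ punchIn s) (C ∘ suc) r<k (R< ∘ punchIn s) (C< ∘ suc))))

  MinorIdeal-antitone : ∀ {M r r′} → (∀ a b → r a b ≤ r′ a b) → ∀ {f} → MinorIdeal M r′ f → MinorIdeal M r f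
  MinorIdeal-antitone {M} {r} r≤r′ = MinorIdeal-elim (minorIdeal M r)
    λ { a b R C ≡.refl R< C< → large a b R C (s≤s (r≤r′ a b)) R< C< }

  module _ {q} {J : Carrier → Set q} (I : IsIdeal J) where
    open IsIdeal I renaming (resp to respJ; 0∈ to 0∈J; +∈ to +∈J; *∈ to *∈J)

    -- A last column index occurring once in C is moved to the front at the cost of a sign; one occurring twice gives 0.
    minor-cases : ∀ {M k} (R : Fin (suc k) → ℕ) {j} →
      (∀ C → Below C j → J (minor M R C)) →
      (∀ C → Below C j → J (minor M R (j ◂ C))) →
      ∀ C → Below C (suc j) → J (minor M R C)
    minor-cases {M} {k} R {j} h₀ h₁ C C< with slots C j C<
    ... | none C<j = h₀ C C<j
    ... | two s s′ s≢s′ e = zero∈ (det-alternating (suc k) _ s≢s′ (λ i → reflexive (cong (M (R i)) e)))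
    ... | one zero e h = respJ (minor-congᶜ M R λ { zero → ≡.sym e ; (suc t) → ≡.refl })
                           (h₁ (C ∘ suc) (λ t → h (suc t) (λ ())))
    ... | one (suc s) e h = respJ swapped (neg∈ (h₁ C₀ C₀<j))
      where
      C₀ : Fin k → ℕ
      C₀ = set s (C zero) (C ∘ suc)
      C₀<j : Below C₀ j
      C₀<j t with t Fin.≟ s
      ... | yes ≡.refl = subst (_< j) (≡.sym (set-≡ s (C zero) (C ∘ suc))) (h zero (λ ()))
      ... | no t≢s     = subst (_< j) (≡.sym (set-≢ (C zero) (C ∘ suc) t≢s)) (h (suc t) (t≢s ∘ Fin.suc-injective))
      col : ℕ → Vector (suc k)
      col b i = M (R i) b
      X : Fin (suc k) → Vector (suc k)
      X = col ∘ C
      swapped : - minor M R (j ◂ C₀) ≈ minor M R C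
      swapped = sym (begin
        det (suc k) X
          ≈⟨ det-≗ (suc k) (λ t → ≡.sym (≡.trans (set-same t) (set-self (suc s) X t))) ⟩
        det (suc k) (set zero (X zero) (set (suc s) (X (suc s)) X))
          ≈⟨ det-swap {i = zero} {suc s} X (λ ()) _ _ ⟩
        - det (suc k) (set zero (X (suc s)) (set (suc s) (X zero) X))
          ≈⟨ -‿cong (det-≗ (suc k) (λ { zero → cong col e ; (suc t) → ≡.sym (set-∘ col s (C zero) (C ∘ suc) t) })) ⟩
        - minor M R (j ◂ C₀) ∎)
        where
        set-same : ∀ t → set zero (X zero) (set (suc s) (X (suc s)) X) t ≡ set (suc s) (X (suc s)) X t
        set-same zero    = ≡.refl
        set-same (suc t) = ≡.refl

    minor-front : ∀ {M k} (R : Fin (suc k) → ℕ) {a} c (C : Fin k → ℕ) → Below R a →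
      (∀ R′ → Below R′ a → J (minor M R′ C)) → J (minor M R (c ◂ C))
    minor-front {M} R c C R< h = respJ (sym (minor-expand M R c C)) (asum∈ (λ s → *∈J _ (h (R ∘ punchIn s) (R< ∘ punchIn s))))

    data Span {q} {k} (S : Vector k → Set q) : Vector k → Set (c ⊔ ℓ ⊔ q) where
      incl   : ∀ {v} → S v → Span S v
      add    : ∀ {v w} → Span S v → Span S w → Span S (λ s → v s + w s)
      scale  : ∀ a {v} → Span S v → Span S (λ s → a * v s)
      respᵛ  : ∀ {v w} → (∀ s → v s ≈ w s) → Span S v → Span S w

    -- Multilinearity, one row at a time: in `go n` the rows from n on have already been replaced by
    -- elements of `S`, and those below n are still in its span.
    det-span : ∀ {q k} {S : Vector k → Set q} →
      (∀ X → (∀ t → S (X t)) → J (det k X)) → ∀ X → (∀ t → Span S (X t)) → J (det k X)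
    det-span {k = k} {S} h X X∈ = go k X (λ t _ → X∈ t) (λ t k≤t → ⊥-elim (ℕ.<⇒≱ (Fin.toℕ<n t) k≤t))
      where
      go : ∀ n X → (∀ t → toℕ t < n → Span S (X t)) → (∀ t → n ≤ toℕ t → S (X t)) → J (det k X)
      go zero    X span base = h X (λ t → base t z≤n)
      go (suc n) X span base with n ℕ.<? k
      ... | no  n≮k = go n X (λ t t<n → span t (ℕ.m<n⇒m<1+n t<n)) (λ t n≤t → ⊥-elim (n≮k (ℕ.≤-<-trans n≤t (Fin.toℕ<n t))))
      ... | yes n<k = respJ (det-≗ k (set-self i X)) (one-slot (span i (s≤s (ℕ.≤-reflexive (Fin.toℕ-fromℕ< n<k)))))
        where
        i : Fin k
        i = fromℕ< n<k
        toℕ≢ : ∀ {t : Fin k} → toℕ t ≢ n → t ≢ i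
        toℕ≢ ≢n ≡.refl = ≢n (Fin.toℕ-fromℕ< n<k)
        one-slot : ∀ {v} → Span S v → J (det k (set i v X))
        one-slot (incl {v} m) = go n (set i v X)
          (λ t t<n → subst (Span S) (≡.sym (set-≢ v X (toℕ≢ (ℕ.<⇒≢ t<n)))) (span t (ℕ.m<n⇒m<1+n t<n)))
          base′
          where
          base′ : ∀ t → n ≤ toℕ t → S (set i v X t)
          base′ t n≤t with t Fin.≟ i
          ... | yes ≡.refl = subst S (≡.sym (set-≡ i v X)) m
          ... | no t≢i = subst S (≡.sym (set-≢ v X t≢i)) (base t (ℕ.≤∧≢⇒< n≤t
                           (λ n≡t → t≢i (Fin.toℕ-injective (≡.trans (≡.sym n≡t) (≡.sym (Fin.toℕ-fromℕ< n<k)))))))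
        one-slot (add m m′) = respJ (sym (det-+ i _ _ X)) (+∈J (one-slot m) (one-slot m′))
        one-slot (scale a m) = respJ (sym (det-* i a _ X)) (*∈J a (one-slot m))
        one-slot (respᵛ e m) = respJ (det-set-cong i X e) (one-slot m)

  -- By the pigeonhole principle two columns or two rows coincide.
  oversized-minor : ∀ M {k} a b (R C : Fin k → ℕ) → Below R a → Below C b → a < k ⊎ b < k → minor M R C ≈ 0#
  oversized-minor M {k} a b R C R< C< (inj₂ b<k) with Fin.pigeonhole b<k (λ t → fromℕ< (C< t))
  ... | s , t , s<t , e = det-alternating k _ (λ s≡t → Fin.<⇒≢ s<t s≡t) (λ i → reflexive (cong (M (R i))
        (≡.trans (≡.sym (Fin.toℕ-fromℕ< (C< s))) (≡.trans (cong toℕ e) (Fin.toℕ-fromℕ< (C< t))))))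
  oversized-minor M {k} a b R C R< C< (inj₁ a<k) with Fin.pigeonhole a<k (λ t → fromℕ< (R< t))
  ... | s , t , s<t , e = trans (det-transpose k _) (det-alternating k _ (λ s≡t → Fin.<⇒≢ s<t s≡t)
        (λ i → reflexive (cong (λ r → M r (C i))
          (≡.trans (≡.sym (Fin.toℕ-fromℕ< (R< s))) (≡.trans (cong toℕ e) (Fin.toℕ-fromℕ< (R< t)))))))

module Pairs {c ℓ} (A : CommutativeRing c ℓ) (M : ℕ → ℕ → CommutativeRing.Carrier A) (j : ℕ) where
  open CommutativeRing A hiding (zero)
  open RingProperties ring using (-‿+-comm; -‿involutive)
  open SetoidReasoning setoid
  open Determinant A
  open Minors A

  -- Column j of a generator at (a , j+1) enters linearly; the pair consists of the minors
  -- in which that column is replaced by columns j and j+1 of M respectively.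
  data Pair (x : ℕ → ℕ) : Carrier → Carrier → Set c where
    pair : ∀ {k} a (R : Fin (suc k) → ℕ) (C : Fin k → ℕ) → k ≡ rk x a (suc j) → Below R a → Below C j →
           Pair x (minor M R (j ◂ C)) (minor M R (suc j ◂ C))

  I : (ℕ → ℕ) → Carrier → Set (c ⊔ ℓ)
  I x = MinorIdeal M (rk x)

  isIdeal : ∀ x → IsIdeal (I x)
  isIdeal x = minorIdeal M (rk x)

  -- A Plücker-type relation. Expand the minors on rows `R₁ s`, `R₂` and columns `D` along the row
  -- `R₁ s`, and sum them against the cofactors `α s`. The result is the alternating sum of the
  -- products `F (D t) * m t`. Its first two terms are the difference sought; in the others the
  -- columns of the first factor are `C₂ t` and `C₁`, so these terms lie in `J`.
  crossed : ∀ {q} {J : Carrier → Set q} → IsIdeal J → ∀ {k₁ k₂}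
    (R₁ : Fin (suc k₁) → ℕ) (C₁ : Fin k₁ → ℕ) (R₂ : Fin (suc k₂) → ℕ) (C₂ : Fin k₂ → ℕ) →
    (∀ s → J (minor M (R₁ s ◂ R₂) (j ◂ suc j ◂ C₂))) →
    (∀ t → J (minor M R₁ (C₂ t ◂ C₁))) →
    J (minor M R₁ (j ◂ C₁) * minor M R₂ (suc j ◂ C₂) + - (minor M R₂ (j ◂ C₂) * minor M R₁ (suc j ◂ C₁)))
  crossed {J = J} Jᴵ {k₁} {k₂} R₁ C₁ R₂ C₂ hY hF = respJ split (+∈J Y∈ (neg∈ S∈))
    where
    open IsIdeal Jᴵ renaming (resp to respJ; 0∈ to 0∈J; +∈ to +∈J; *∈ to *∈J)
    F G : ℕ → Carrier
    F c = minor M R₁ (c ◂ C₁)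
    G c = minor M R₂ (c ◂ C₂)
    D : Fin (suc (suc k₂)) → ℕ
    D = j ◂ suc j ◂ C₂
    m : Vector (suc (suc k₂))
    m t = minor M R₂ (D ∘ punchIn t)
    α : Vector (suc k₁)
    α s = minor M (R₁ ∘ punchIn s) C₁
    Y S : Carrier
    Y = asum (suc (suc k₂)) (λ t → F (D t) * m t)
    S = asum k₂ (λ t → F (C₂ t) * m (suc (suc t)))
    -- Y is the determinant whose extra row is the combination of the rows R₁ with coefficients α.
    Y≈ : asum (suc k₁) (λ s → α s * minor M (R₁ s ◂ R₂) D) ≈ Y
    Y≈ = begin
      asum (suc k₁) (λ s → α s * minor M (R₁ s ◂ R₂) D)
        ≈⟨ asum-cong (λ s → *-congˡ (det-column (suc k₂) _)) ⟩
      asum (suc k₁) (λ s → α s * asum (2 ℕ.+ k₂) (λ t → M (R₁ s) (D t) * m t))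
        ≈⟨ asum-cong (λ s → asum-* _ _) ⟨
      asum (suc k₁) (λ s → asum (2 ℕ.+ k₂) (λ t → α s * (M (R₁ s) (D t) * m t)))
        ≈⟨ asum-swap _ ⟩
      asum (2 ℕ.+ k₂) (λ t → asum (suc k₁) (λ s → α s * (M (R₁ s) (D t) * m t)))
        ≈⟨ asum-cong (λ t → trans (asum-cong (λ s → rearrange (α s) (M (R₁ s) (D t)) (m t))) (asum-* (m t) _)) ⟩
      asum (2 ℕ.+ k₂) (λ t → m t * asum (suc k₁) (λ s → M (R₁ s) (D t) * α s))
        ≈⟨ asum-cong (λ t → trans (*-congˡ (sym (minor-expand M R₁ (D t) C₁))) (*-comm _ _)) ⟩
      Y ∎
      where
      rearrange : ∀ a b d → a * (b * d) ≈ d * (b * a)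
      rearrange a b d = trans (*-comm _ _) (trans (*-congʳ (*-comm _ _)) (*-assoc _ _ _))
    Y∈ : J Y
    Y∈ = respJ Y≈ (asum∈ (λ s → *∈J _ (hY s)))
    S∈ : J S
    S∈ = asum∈ (λ t → ∈* _ (hF t))
    split : Y + - S ≈ F j * G (suc j) + - (G j * F (suc j))
    split = begin
      Y + - S ≡⟨ cong (_+ - S) (≡.trans (asum-suc _) (cong (λ z → F j * m zero + - z) (asum-suc _))) ⟩
      F j * m zero + - (F (suc j) * m (suc zero) + - S) + - S
        ≈⟨ +-congʳ (+-congˡ (trans (sym (-‿+-comm _ _)) (+-congˡ (-‿involutive S)))) ⟩
      F j * m zero + (- (F (suc j) * m (suc zero)) + S) + - S
        ≈⟨ trans (+-congʳ (sym (+-assoc _ _ _))) (trans (+-assoc _ _ _) (trans (+-congˡ (-‿inverseʳ S)) (+-identityʳ _))) ⟩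
      F j * m zero + - (F (suc j) * m (suc zero))
        ≈⟨ +-cong (*-congˡ (minor-congᶜ M R₂ (λ { zero → ≡.refl ; (suc _) → ≡.refl })))
             (-‿cong (trans (*-comm _ _) (*-congʳ (minor-congᶜ M R₂ (λ { zero → ≡.refl ; (suc _) → ≡.refl }))))) ⟩
      F j * G (suc j) + - (G j * F (suc j)) ∎

  -- By `invRank` either a pair consists of members of the ideal, through the condition at j or at j
  -- + 2, or it has the shape `middle`. For two pairs of that shape the ranks are exactly those that
  -- make the two kinds of minors in `crossed` generators at j + 2 and at j.
  pair-crossed : ∀ {x q₁ r₁ q₂ r₂} → Inv j x → Pair x q₁ r₁ → Pair x q₂ r₂ → I (up j x) (q₁ * r₂ + - (q₂ * r₁))
  pair-crossed {x} inv (pair a₁ R₁ C₁ e₁ R₁< C₁<) (pair a₂ R₂ C₂ e₂ R₂< C₂<)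
    with ∈N⊎mid R₁ C₁ e₁ R₁< C₁< | ∈N⊎mid R₂ C₂ e₂ R₂< C₂<
    where
    open IsIdeal (isIdeal (up j x)) using (neg∈; ∈*)
    ∈N⊎mid : ∀ {k a} (R : Fin (suc k) → ℕ) (C : Fin k → ℕ) → k ≡ rk x a (suc j) → Below R a → Below C j →
      (I (up j x) (minor M R (j ◂ C)) × I (up j x) (minor M R (suc j ◂ C))) ⊎ (k ≡ rk x a j × rk x a (suc (suc j)) ≡ suc k)
    ∈N⊎mid {k} {a} R C e R< C< with invRank x j a inv
    ... | equalʳ e′ = inj₁ (member j (ℕ.m<n⇒m<1+n (ℕ.n<1+n j)) , member (suc j) (ℕ.n<1+n (suc j)))
      where
      member : ∀ c → c < suc (suc j) → I (up j x) (minor M R (c ◂ C))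
      member c c< = gen a (suc (suc j)) R (c ◂ C) (cong suc (≡.trans e (≡.trans e′ (≡.sym (rk-up-≢ x j a (suc (suc j)) (λ ()))))))
        R< (◂-below c< (λ t → ℕ.m<n⇒m<1+n (ℕ.m<n⇒m<1+n (C< t))))
    ... | stepˡ e′ = inj₁ (member j , member (suc j))
      where
      member : ∀ c → I (up j x) (minor M R (c ◂ C))
      member c = minor-front (isIdeal (up j x)) {M} R c C R< (λ R′ R′< →
        gen a j R′ C (≡.trans e (≡.trans e′ (cong suc (≡.sym (rk-up-≢ x j a j (λ ())))))) R′< C<)
    ... | middle e′ e″ = inj₂ (≡.trans e e′ , ≡.trans e″ (cong suc (≡.sym (≡.trans e e′))))
  ... | inj₁ (q , r) | _ = IsIdeal.+∈ (isIdeal (up j x)) (IsIdeal.∈* (isIdeal (up j x)) _ q) (IsIdeal.neg∈ (isIdeal (up j x)) (*∈ _ r))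
  ... | inj₂ _ | inj₁ (q , r) = IsIdeal.+∈ (isIdeal (up j x)) (*∈ _ r) (IsIdeal.neg∈ (isIdeal (up j x)) (IsIdeal.∈* (isIdeal (up j x)) _ q))
  ... | inj₂ (e₁′ , e₁″) | inj₂ (e₂′ , e₂″) with ℕ.≤-total a₁ a₂
  -- A row of `R₁` is adjoined to `R₂`, so the pair with the larger row bound has to come second.
  ...   | inj₁ a₁≤a₂ = crossed (isIdeal (up j x)) R₁ C₁ R₂ C₂
          (λ s → gen a₂ (suc (suc j)) _ _ (cong suc (≡.trans (≡.sym e₂″) (≡.sym (rk-up-≢ x j a₂ (suc (suc j)) (λ ())))))
             (◂-below (ℕ.<-≤-trans (R₁< s) a₁≤a₂) R₂<)
             (◂-below (ℕ.m<n⇒m<1+n (ℕ.n<1+n j)) (◂-below (ℕ.n<1+n (suc j)) (λ t → ℕ.m<n⇒m<1+n (ℕ.m<n⇒m<1+n (C₂< t))))))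
          (λ t → gen a₁ j _ _ (cong suc (≡.trans e₁′ (≡.sym (rk-up-≢ x j a₁ j (λ ()))))) R₁< (◂-below (C₂< t) C₁<))
  ...   | inj₂ a₂≤a₁ = resp flip (IsIdeal.neg∈ (isIdeal (up j x)) (crossed (isIdeal (up j x)) R₂ C₂ R₁ C₁
          (λ s → gen a₁ (suc (suc j)) _ _ (cong suc (≡.trans (≡.sym e₁″) (≡.sym (rk-up-≢ x j a₁ (suc (suc j)) (λ ())))))
             (◂-below (ℕ.<-≤-trans (R₂< s) a₂≤a₁) R₁<)
             (◂-below (ℕ.m<n⇒m<1+n (ℕ.n<1+n j)) (◂-below (ℕ.n<1+n (suc j)) (λ t → ℕ.m<n⇒m<1+n (ℕ.m<n⇒m<1+n (C₁< t))))))
          (λ t → gen a₂ j _ _ (cong suc (≡.trans e₂′ (≡.sym (rk-up-≢ x j a₂ j (λ ()))))) R₂< (◂-below (C₁< t) C₂<))))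
    where
    flip : ∀ {p q} → - (p + - q) ≈ q + - p
    flip {p} {q} = trans (sym (-‿+-comm _ _)) (trans (+-congˡ (-‿involutive q)) (+-comm _ _))

-- The degeneration with respect to the last variable

module Step {c ℓ} (A : CommutativeRing c ℓ) (M′ : ℕ → ℕ → CommutativeRing.Carrier A) (j : ℕ) where
  open CommutativeRing A hiding (zero)
  open RingProperties ring using (-‿distribˡ-*; -‿+-comm; -‿involutive)
  open Coefficients A
  open PolynomialRing A using (_⊛_)
  private
    module B = CommutativeRing (A [y])
    module BP = RingProperties B.ring
    module ≈ = SetoidReasoning setoid
    module ≈B = SetoidReasoning B.setoid
    module DA = Determinant A
    module DB = Determinant (A [y])
    module MA = Minors A
    module MB = Minors (A [y])
  open Pairs A M′ j using (Pair; pair; pair-crossed)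

  M : ℕ → ℕ → B.Carrier
  M a b with b ℕ.≟ j | b ℕ.≟ suc j
  ... | yes _ | _     = Y B.* const (M′ a j) B.+ const (M′ a (suc j))
  ... | no _  | yes _ = const (M′ a j)
  ... | no _  | no _  = const (M′ a b)

  M-j : ∀ a → M a j ≡ Y B.* const (M′ a j) B.+ const (M′ a (suc j))
  M-j a with j ℕ.≟ j | j ℕ.≟ suc j
  ... | yes _ | _ = ≡.refl
  ... | no ≢  | _ = ⊥-elim (≢ ≡.refl)

  M-1+j : ∀ a → M a (suc j) ≡ const (M′ a j)
  M-1+j a with suc j ℕ.≟ j | suc j ℕ.≟ suc j
  ... | yes e | _     = ⊥-elim (ℕ.1+n≢n e)
  ... | no _  | yes _ = ≡.refl
  ... | no _  | no ≢  = ⊥-elim (≢ ≡.refl)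

  M-else : ∀ a {b} → b ≢ j → b ≢ suc j → M a b ≡ const (M′ a b)
  M-else a {b} ≢j ≢1+j with b ℕ.≟ j | b ℕ.≟ suc j
  ... | yes e | _     = ⊥-elim (≢j e)
  ... | no _  | yes e = ⊥-elim (≢1+j e)
  ... | no _  | no _  = ≡.refl

  M-< : ∀ a {b} → b < j → M a b ≡ const (M′ a b)
  M-< a b<j = M-else a (ℕ.<⇒≢ b<j) (ℕ.<⇒≢ (ℕ.m<n⇒m<1+n b<j))

  IA : (ℕ → ℕ) → Carrier → Set (c ⊔ ℓ)
  IA x = MA.MinorIdeal M′ (rk x)

  IB : (ℕ → ℕ) → B.Carrier → Set (c ⊔ ℓ)
  IB x = MB.MinorIdeal M (rk x)

  idealA : ∀ x → MA.IsIdeal (IA x)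
  idealA x = MA.minorIdeal M′ (rk x)

  idealB : ∀ x → MB.IsIdeal (IB x)
  idealB x = MB.minorIdeal M (rk x)

  opaque
    unfolding DA.asum DA.det

    const-asum : ∀ {k} (f : Fin k → Carrier) → DB.asum k (const ∘ f) B.≈ const (DA.asum k f)
    const-asum {zero}  f = B.sym const-0
    const-asum {suc k} f = B.trans (B.+-congˡ (B.trans (B.-‿cong (const-asum (f ∘ suc))) (B.sym (const-neg _)))) (B.sym (const-+ _ _))

    const-det : ∀ k (X : Fin k → Fin k → Carrier) → DB.det k (λ r s → const (X r s)) B.≈ const (DA.det k X)
    const-det zero    X = coeff-1
    const-det (suc k) X = B.trans
      (DB.asum-cong (λ t → B.trans (B.*-congˡ (const-det k (λ r s → X (suc r) (punchIn t s)))) (B.sym (const-* (X zero t) (DA.det k (λ r s → X (suc r) (punchIn t s)))))))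
      (const-asum (λ t → X zero t * DA.det k (λ r s → X (suc r) (punchIn t s))))

  minor-< : ∀ {k} (R C : Fin k → ℕ) → Below C j → MB.minor M R C B.≈ const (MA.minor M′ R C)
  minor-< {k} R C C<j = B.trans (MB.minor-cong {M} {λ a b → const (M′ a b)} R C (λ s t → B.reflexive (M-< (R s) (C<j t)))) (const-det k _)

  -- Only the front column involves y, so the minor is linear in it; the two coefficients are the
  -- components recorded by `Pair`.
  minor-j : ∀ {k} (R : Fin (suc k) → ℕ) (C : Fin k → ℕ) → Below C j →
    MB.minor M R (j ◂ C) B.≈ Y B.* const (MA.minor M′ R (j ◂ C)) B.+ const (MA.minor M′ R (suc j ◂ C))
  minor-j {k} R C C<j = begin
    MB.minor M R (j ◂ C)
      ≈⟨ DB.det-cong (suc k) (λ { zero s → B.reflexive (M-j (R s)) ; (suc t) s → B.reflexive (M-< (R s) (C<j t)) }) ⟩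
    DB.det (suc k) (DB′ (λ s → Y B.* col j s B.+ col (suc j) s))
      ≈⟨ DB.det-+ zero _ _ X ⟩
    DB.det (suc k) (DB′ (λ s → Y B.* col j s)) B.+ DB.det (suc k) (DB′ (col (suc j)))
      ≈⟨ B.+-congʳ (DB.det-* zero _ _ X) ⟩
    Y B.* DB.det (suc k) (DB′ (col j)) B.+ DB.det (suc k) (DB′ (col (suc j)))
      ≈⟨ B.+-cong (B.*-congˡ (replaced j)) (replaced (suc j)) ⟩
    Y B.* const (MA.minor M′ R (j ◂ C)) B.+ const (MA.minor M′ R (suc j ◂ C)) ∎
    where
    open ≈B
    col : ℕ → Fin (suc k) → B.Carrier
    col b s = const (M′ (R s) b)
    X : Fin (suc k) → Fin (suc k) → B.Carrier
    X = col ∘ (j ◂ C)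
    DB′ : (Fin (suc k) → B.Carrier) → Fin (suc k) → Fin (suc k) → B.Carrier
    DB′ v = set zero v X
    replaced : ∀ b → DB.det (suc k) (DB′ (col b)) B.≈ const (MA.minor M′ R (b ◂ C))
    replaced b = B.trans (DB.det-≗ (suc k) {X′ = col ∘ (b ◂ C)} (λ { zero → ≡.refl ; (suc t) → ≡.refl })) (const-det (suc k) _)

  infix 30 _⟦y⟧
  -- For an ideal `J` this is the ideal that it generates in the polynomial ring, described without
  -- generators.
  _⟦y⟧ : ∀ {q} → (Carrier → Set q) → B.Carrier → Set q
  (J ⟦y⟧) f = ∀ d → J (coeff f d)

  extended : ∀ {q} {J : Carrier → Set q} → MA.IsIdeal J → MB.IsIdeal (J ⟦y⟧)
  extended {J = J} I = record
    { resp = λ e m d → resp (coeff-cong e d) (m d)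
    ; 0∈ = λ d → resp (sym (coeff-0 d)) 0∈
    ; +∈ = λ m m′ d → resp (sym (coeff-+ _ _ d)) (+∈ (m d) (m′ d))
    ; *∈ = λ h {f} m d → resp (sym (coeff-* h f d)) (conv (coeff h) (coeff f) m d)
    }
    where
    open MA.IsIdeal I
    conv : ∀ p q → (∀ d → J (q d)) → ∀ d → J ((p ⊛ q) d)
    conv p q m zero    = *∈ _ (m 0)
    conv p q m (suc d) = +∈ (*∈ _ (m (suc d))) (conv _ q m d)

  const∈ : ∀ {q} {J : Carrier → Set q} → MA.IsIdeal J → ∀ {a} → J a → (J ⟦y⟧) (const a)
  const∈ I m zero    = MA.IsIdeal.resp I (sym (coeff-const-zero _)) m
  const∈ I m (suc d) = MA.IsIdeal.resp I (sym (coeff-const-suc _ d)) (MA.IsIdeal.0∈ I)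

  contracted : ∀ {q} {J : B.Carrier → Set q} → MB.IsIdeal J → MA.IsIdeal (J ∘ const)
  contracted I = record
    { resp = resp ∘ const-cong
    ; 0∈ = resp (B.sym const-0) 0∈
    ; +∈ = λ m m′ → resp (B.sym (const-+ _ _)) (+∈ m m′)
    ; *∈ = λ h m → resp (B.sym (const-* _ _)) (*∈ _ m)
    }
    where
    open MB.IsIdeal I

  -- Away from position j + 1, truncation of the columns is compatible with the change of columns from M′ to M.
  private
    suc-j-< : ∀ {b} → b ≢ suc j → j < b → suc j < b
    suc-j-< b≢ j<b = ℕ.≤∧≢⇒< j<b (b≢ ∘ ≡.sym)

  span-M : ∀ {q} {J : B.Carrier → Set q} → MB.IsIdeal J → ∀ b → b ≢ suc j → ∀ {k} (R : Fin k → ℕ) →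
    (∀ C → Below C b → J (const (MA.minor M′ R C))) → ∀ C → Below C b → J (MB.minor M R C)
  span-M {J = J} I b b≢ {k} R h C C< = MB.det-span I {S = S} base _ spans
    where
    S : (Fin k → B.Carrier) → Set c
    S v = ∃ λ t → t < b × v ≡ (λ s → const (M′ (R s) t))
    base : ∀ X → (∀ t → S (X t)) → J (DB.det k X)
    base X X∈ = MB.IsIdeal.resp I (B.sym (B.trans (DB.det-≗ k (λ t → proj₂ (proj₂ (X∈ t)))) (const-det k _)))
      (h (proj₁ ∘ X∈) (λ t → proj₁ (proj₂ (X∈ t))))
    spans : ∀ t → MB.Span I S (λ s → M (R s) (C t))
    spans t with C t ℕ.≟ j | C t ℕ.≟ suc j
    ... | yes e | _ = MB.add (MB.scale Y (MB.incl (j , j<b , ≡.refl))) (MB.incl (suc j , suc-j-< b≢ j<b , ≡.refl))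
      where
      j<b : j < b
      j<b = subst (_< b) e (C< t)
    ... | no _  | yes e = MB.incl (j , ℕ.<-trans (ℕ.n<1+n j) (subst (_< b) e (C< t)) , ≡.refl)
    ... | no _  | no _  = MB.incl (C t , C< t , ≡.refl)

  span-M′ : ∀ {q} {J : B.Carrier → Set q} → MB.IsIdeal J → ∀ b → b ≢ suc j → ∀ {k} (R : Fin k → ℕ) →
    (∀ C → Below C b → J (MB.minor M R C)) → ∀ C → Below C b → J (const (MA.minor M′ R C))
  span-M′ {J = J} I b b≢ {k} R h C C< = MB.IsIdeal.resp I (const-det k _) (MB.det-span I {S = S} base _ spans)
    where
    S : (Fin k → B.Carrier) → Set c
    S v = ∃ λ t → t < b × v ≡ (λ s → M (R s) t)
    base : ∀ X → (∀ t → S (X t)) → J (DB.det k X)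
    base X X∈ = MB.IsIdeal.resp I (B.sym (DB.det-≗ k (λ t → proj₂ (proj₂ (X∈ t)))))
      (h (proj₁ ∘ X∈) (λ t → proj₁ (proj₂ (X∈ t))))
    spans : ∀ t → MB.Span I S (λ s → const (M′ (R s) (C t)))
    spans t with C t ℕ.≟ j | C t ℕ.≟ suc j
    ... | yes e | _ = MB.respᵛ (λ s → B.reflexive (≡.trans (M-1+j (R s)) (cong (λ z → const (M′ (R s) z)) (≡.sym e))))
            (MB.incl (suc j , suc-j-< b≢ (subst (_< b) e (C< t)) , ≡.refl))
    -- The inverse column operation: column j + 1 of `M′` is column j of `M` minus y times column j
    -- + 1 of `M`.
    ... | no _  | yes e = MB.respᵛ (λ s → B.trans (cancel s) (B.reflexive (cong (λ z → const (M′ (R s) z)) (≡.sym e))))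
            (MB.add (MB.incl (j , ℕ.<-trans (ℕ.n<1+n j) 1+j<b , ≡.refl)) (MB.scale (B.- Y) (MB.incl (suc j , 1+j<b , ≡.refl))))
      where
      1+j<b : suc j < b
      1+j<b = subst (_< b) e (C< t)
      cancel : ∀ s → M (R s) j B.+ (B.- Y) B.* M (R s) (suc j) B.≈ const (M′ (R s) (suc j))
      cancel s = begin
        M (R s) j B.+ (B.- Y) B.* M (R s) (suc j) ≡⟨ ≡.cong₂ (λ u v → u B.+ (B.- Y) B.* v) (M-j (R s)) (M-1+j (R s)) ⟩
        u B.+ w B.+ (B.- Y) B.* v                 ≈⟨ B.+-cong (B.+-comm _ _) (B.sym (BP.-‿distribˡ-* _ _)) ⟩
        w B.+ u B.+ B.- u                         ≈⟨ B.+-assoc _ _ _ ⟩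
        w B.+ (u B.+ B.- u)                       ≈⟨ B.+-congˡ (B.-‿inverseʳ u) ⟩
        w B.+ B.0#                                ≈⟨ B.+-identityʳ w ⟩
        w ∎
        where
        open ≈B
        u v w : B.Carrier
        v = const (M′ (R s) j)
        w = const (M′ (R s) (suc j))
        u = Y B.* v
    ... | no ≢j | no ≢1+j = MB.respᵛ (λ s → B.reflexive (M-else (R s) ≢j ≢1+j)) (MB.incl (C t , C< t , ≡.refl))

  private
    -- One of the two arguments of the minimum is attained. So the condition of `up j x` at j + 1
    -- follows from the one at j by expansion along a column, or from the one at j + 2 by inclusion
    -- of columns.
    rk-up-cases : ∀ x a → rk (up j x) a (suc j) ≡ suc (rk x a j) ⊎ rk (up j x) a (suc j) ≡ rk x a (suc (suc j))
    rk-up-cases x a with ℕ.⊓-sel (suc (rk x a j)) (rk x a (suc (suc j)))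
    ... | inj₁ e = inj₁ (≡.trans (rk-up-mid x j a) e)
    ... | inj₂ e = inj₂ (≡.trans (rk-up-mid x j a) e)

    below-up : ∀ {k} {C : Fin k → ℕ} {b} → Below C b → Below C (suc b)
    below-up C< t = ℕ.m<n⇒m<1+n (C< t)

  minor∈extended : ∀ x {k} a b (R C : Fin k → ℕ) → b ≢ suc j → rk x a b < k → Below R a → Below C b →
    (IA x ⟦y⟧) (MB.minor M R C)
  minor∈extended x a b R C b≢ r<k R< C< = span-M (extended (idealA x)) b b≢ R
    (λ C′ C′< → const∈ (idealA x) (MA.large a b R C′ r<k R< C′<)) C C<

  minor∈contracted : ∀ x {k} a b (R C : Fin k → ℕ) → b ≢ suc j → rk x a b < k → Below R a → Below C b →
    IB x (const (MA.minor M′ R C))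
  minor∈contracted x a b R C b≢ r<k R< C< = span-M′ (idealB x) b b≢ R
    (λ C′ C′< → MB.large a b R C′ r<k R< C′<) C C<

  -- The conditions at j + 1 are redundant for `up j x`, and all other truncations span the same
  -- columns in both charts; hence this ideal is generated by constants in y.
  up⊆extended : ∀ x {f} → IB (up j x) f → (IA (up j x) ⟦y⟧) f
  up⊆extended x = MB.MinorIdeal-elim J go
    where
    J : MB.IsIdeal (IA (up j x) ⟦y⟧)
    J = extended (idealA (up j x))
    rk≡ : ∀ a b → b ≢ suc j → rk x a b ≡ rk (up j x) a b
    rk≡ a b b≢ = ≡.sym (rk-up-≢ x j a b b≢)
    go : ∀ {k} a b (R C : Fin k → ℕ) → k ≡ suc (rk (up j x) a b) → Below R a → Below C b → (IA (up j x) ⟦y⟧) (MB.minor M R C)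
    go a b R C ≡.refl R< C< with b ℕ.≟ suc j
    ... | no b≢ = minor∈extended (up j x) a b R C b≢ ℕ.≤-refl R< C<
    ... | yes ≡.refl with rk-up-cases x a
    ...   | inj₂ e = minor∈extended (up j x) a (suc (suc j)) R C (λ ())
                       (s≤s (ℕ.≤-reflexive (≡.trans (≡.sym (rk≡ a _ (λ ()))) (≡.sym e)))) R< (below-up C<)
    ...   | inj₁ e = MB.minor-cases J {M} R
              (λ C′ C′< → small R C′ (ℕ.m<n⇒m<1+n size) R< C′<)
              (λ C′ C′< → MB.minor-front J {M} R j C′ R< (λ R′ R′< → small R′ C′ size R′< C′<)) C C<
      where
      size : rk (up j x) a j < rk (up j x) a (suc j)
      size = ℕ.≤-reflexive (≡.trans (cong suc (≡.sym (rk≡ a j (λ ())))) (≡.sym e))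
      small : ∀ {k} (R C : Fin k → ℕ) → rk (up j x) a j < k → Below R a → Below C j → (IA (up j x) ⟦y⟧) (MB.minor M R C)
      small R C r<k R< C< = minor∈extended (up j x) a j R C (λ ()) r<k R< C<

  -- The inclusion of N in the ideal of `x`, with N read in the smaller chart and the ideal of `x`
  -- in the larger.
  up⊆contracted : ∀ x {g} → IA (up j x) g → IB x (const g)
  up⊆contracted x = MA.MinorIdeal-elim J go
    where
    J : MA.IsIdeal (IB x ∘ const)
    J = contracted (idealB x)
    go : ∀ {k} a b (R C : Fin k → ℕ) → k ≡ suc (rk (up j x) a b) → Below R a → Below C b → IB x (const (MA.minor M′ R C))
    go a b R C ≡.refl R< C< with b ℕ.≟ suc j
    ... | no b≢ = minor∈contracted x a b R C b≢ (s≤s (ℕ.≤-reflexive (≡.sym (rk-up-≢ x j a b b≢)))) R< C<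
    ... | yes ≡.refl with rk-up-cases x a
    ...   | inj₂ e = minor∈contracted x a (suc (suc j)) R C (λ ()) (s≤s (ℕ.≤-reflexive (≡.sym e))) R< (below-up C<)
    ...   | inj₁ e = MA.minor-cases J {M′} R
              (λ C′ C′< → small R C′ (ℕ.m<n⇒m<1+n size) R< C′<)
              (λ C′ C′< → MA.minor-front J {M′} R j C′ R< (λ R′ R′< → small R′ C′ size R′< C′<)) C C<
      where
      size : rk x a j < rk (up j x) a (suc j)
      size = ℕ.≤-reflexive (≡.sym e)
      small : ∀ {k} (R C : Fin k → ℕ) → rk x a j < k → Below R a → Below C j → IB x (const (MA.minor M′ R C))
      small R C r<k R< C< = minor∈contracted x a j R C (λ ()) r<k R< C<

  Lifts : (ℕ → ℕ) → Carrier → Set (c ⊔ ℓ)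
  Lifts x g = ∃ λ r → IB x (Y B.* const g B.+ const r)

  -- A generator at j + 1 through column j is the coefficient of y in `minor-j`. Every other
  -- generator lies in the ideal as a constant and can be multiplied by y. Together with `top` this
  -- identifies `IA x` as the ideal of leading coefficients in positive degree.
  lift : ∀ x {g} → IA x g → Lifts x g
  lift x = MA.MinorIdeal-elim J go
    where
    open ≈B
    module Bᴵ = MB.IsIdeal (idealB x)
    J : MA.IsIdeal (Lifts x)
    J = record
      { resp = λ e (r , m) → r , Bᴵ.resp (B.+-congʳ (B.*-congˡ (const-cong e))) m
      ; 0∈ = 0# , Bᴵ.zero∈ (B.trans (B.+-cong (B.trans (B.*-congˡ const-0) (B.zeroʳ _)) const-0) (B.+-identityˡ _))
      ; +∈ = λ {f} {g} (r , m) (r′ , m′) → r + r′ , Bᴵ.resp (begin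
          (Y B.* const f B.+ const r) B.+ (Y B.* const g B.+ const r′)
            ≈⟨ PolynomialRing.medial (A [y]) _ _ _ _ ⟩
          (Y B.* const f B.+ Y B.* const g) B.+ (const r B.+ const r′)
            ≈⟨ B.+-cong (B.trans (B.sym (B.distribˡ _ _ _)) (B.*-congˡ (B.sym (const-+ _ _)))) (B.sym (const-+ _ _)) ⟩
          Y B.* const (f + g) B.+ const (r + r′) ∎) (Bᴵ.+∈ m m′)
      ; *∈ = λ h {f} (r , m) → h * r , Bᴵ.resp (begin
          const h B.* (Y B.* const f B.+ const r)
            ≈⟨ B.distribˡ _ _ _ ⟩
          const h B.* (Y B.* const f) B.+ const h B.* const r
            ≈⟨ B.+-cong (B.trans (DB.exchange _ _ _) (B.*-congˡ (B.sym (const-* _ _)))) (B.sym (const-* _ _)) ⟩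
          Y B.* const (h * f) B.+ const (h * r) ∎) (Bᴵ.*∈ (const h) m)
      }
    fromConst : ∀ {g} → IB x (const g) → Lifts x g
    fromConst m = 0# , Bᴵ.resp (B.sym (B.trans (B.+-congˡ const-0) (B.+-identityʳ _))) (Bᴵ.*∈ Y m)
    go : ∀ {k} a b (R C : Fin k → ℕ) → k ≡ suc (rk x a b) → Below R a → Below C b → Lifts x (MA.minor M′ R C)
    go a b R C ≡.refl R< C< with b ℕ.≟ suc j
    ... | no b≢ = fromConst (minor∈contracted x a b R C b≢ ℕ.≤-refl R< C<)
    ... | yes ≡.refl = MA.minor-cases J {M′} R
      (λ C C< → fromConst (Bᴵ.resp (minor-< R C C<) (MB.gen a (suc j) R C ≡.refl R< (below-up C<))))
      (λ C C< → _ , Bᴵ.resp (minor-j R C C<) (MB.gen a (suc j) R (j ◂ C) ≡.refl R< (◂-below (ℕ.n<1+n j) (below-up C<)))) C C<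

  -- The last coefficient of an element of degree at most e in y lies in this ideal.
  TopIdeal : ℕ → (ℕ → ℕ) → Carrier → Set (c ⊔ ℓ)
  TopIdeal zero    x = IA (up j x)
  TopIdeal (suc _) x = IA x

  -- The nontrivial inclusion of the colon identity. It is quantified over all comparable pairs
  -- because the recursion applies it to `x` and `up j x`, to `x` and `x′`, and to `up j x` and
  -- `up j x′`.
  Colon : Set (c ⊔ ℓ)
  Colon = ∀ {x x′} → RankBounded x′ → x ⊏ x′ → ∀ h → (∀ g → IA x g → IA x′ (h * g)) → IA x′ h

  module Degeneration (colon : Colon) where

    -- Only the q have to be tested: the generators of `IA x` at other positions, and those at j + 1
    -- that avoid column j, already lie in `IA (up j x)`.
    colon-pairs : ∀ {x} → RankBounded x → Inv j x → ∀ h → (∀ {q r} → Pair x q r → IA (up j x) (h * q)) → IA (up j x) h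
    colon-pairs {x} bd inv h h*q = colon (up-bounded j bd) (⊏-up inv) h (λ g → MA.MinorIdeal-elim J go)
      where
      J : MA.IsIdeal (λ g → IA (up j x) (h * g))
      J = record
        { resp = λ e → resp (*-congˡ e)
        ; 0∈ = resp (sym (zeroʳ h)) 0∈
        ; +∈ = λ m m′ → resp (sym (distribˡ _ _ _)) (+∈ m m′)
        ; *∈ = λ k m → resp (DA.exchange _ _ _) (*∈ k m)
        }
        where
        open MA.IsIdeal (idealA (up j x))
      go : ∀ {k} a b (R C : Fin k → ℕ) → k ≡ suc (rk x a b) → Below R a → Below C b → IA (up j x) (h * MA.minor M′ R C)
      go a b R C ≡.refl R< C< with b ℕ.≟ suc j
      ... | no b≢ = MA.*∈ h (MA.gen a b R C (cong suc (≡.sym (rk-up-≢ x j a b b≢))) R< C<)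
      ... | yes ≡.refl = MA.minor-cases J {M′} R
        (λ C C< → MA.*∈ h (MA.large a j R C (s≤s (ℕ.≤-trans (ℕ.≤-reflexive (rk-up-≢ x j a j (λ ())))
                    (rk-mono-b x a (ℕ.n≤1+n j)))) R< C<))
        (λ C C< → h*q (pair a R C ≡.refl R< C<)) C C<

    module _ {x} (inv : Inv j x) where
      private
        N : Carrier → Set (c ⊔ ℓ)
        N = IA (up j x)
        NB : B.Carrier → Set (c ⊔ ℓ)
        NB = N ⟦y⟧
        module Nᴵ = MA.IsIdeal (idealA (up j x))
        module NBᴵ = MB.IsIdeal (extended (idealA (up j x)))
        L : Carrier → Carrier → B.Carrier
        L q r = Y B.* const q B.+ const r

      -- f is modulo N a multiple, with "factor" g / q, of each linear generator q y + r.
      Proportional : B.Carrier → B.Carrier → Set (c ⊔ ℓ)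
      Proportional f g = (IA x ⟦y⟧) g × (∀ {q r} → Pair x q r → NB (const q B.* f B.+ B.- (g B.* L q r)))

      proportional : MB.IsIdeal (λ f → ∃ (Proportional f))
      proportional = record
        { resp = λ e (g , m , p) → g , m , λ π → NBᴵ.resp (B.+-congʳ (B.*-congˡ e)) (p π)
        ; 0∈ = B.0# , XBᴵ.0∈ , λ {q} {r} π → NBᴵ.zero∈ (begin
            const q B.* B.0# B.+ B.- (B.0# B.* L q r)
              ≈⟨ B.+-cong (B.zeroʳ _) (B.trans (B.-‿cong (B.zeroˡ _)) BP.-0#≈0#) ⟩
            B.0# B.+ B.0# ≈⟨ B.+-identityˡ _ ⟩
            B.0# ∎)
        ; +∈ = λ {f} {f′} (g , m , p) (g′ , m′ , p′) → g B.+ g′ , XBᴵ.+∈ m m′ , λ {q} {r} π → NBᴵ.resp (begin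
            (const q B.* f B.+ B.- (g B.* L q r)) B.+ (const q B.* f′ B.+ B.- (g′ B.* L q r))
              ≈⟨ PolynomialRing.medial (A [y]) _ _ _ _ ⟩
            (const q B.* f B.+ const q B.* f′) B.+ (B.- (g B.* L q r) B.+ B.- (g′ B.* L q r))
              ≈⟨ B.+-cong (B.sym (B.distribˡ _ _ _)) (B.trans (BP.-‿+-comm _ _) (B.-‿cong (B.sym (B.distribʳ _ _ _)))) ⟩
            const q B.* (f B.+ f′) B.+ B.- ((g B.+ g′) B.* L q r) ∎) (NBᴵ.+∈ (p π) (p′ π))
        ; *∈ = λ h {f} (g , m , p) → h B.* g , XBᴵ.*∈ h m , λ {q} {r} π → NBᴵ.resp (begin
            h B.* (const q B.* f B.+ B.- (g B.* L q r))
              ≈⟨ B.distribˡ _ _ _ ⟩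
            h B.* (const q B.* f) B.+ h B.* (B.- (g B.* L q r))
              ≈⟨ B.+-cong (DB.exchange _ _ _) (B.trans (B.sym (BP.-‿distribʳ-* _ _)) (B.-‿cong (B.sym (B.*-assoc _ _ _)))) ⟩
            const q B.* (h B.* f) B.+ B.- (h B.* g B.* L q r) ∎) (NBᴵ.*∈ h (p π))
        }
        where
        open ≈B
        module XBᴵ = MB.IsIdeal (extended (idealA x))

      -- Elements of N take the factor 0, and q₀ y + r₀ takes the factor q₀: the terms in y then
      -- cancel, leaving q r₀ - q₀ r, which is in N by `pair-crossed`.
      generators-proportional : ∀ {f} → IB x f → ∃ (Proportional f)
      generators-proportional = MB.MinorIdeal-elim proportional go
        where
        open ≈B
        fromN : ∀ {f} → NB f → ∃ (Proportional f)
        fromN {f} m = B.0# , MB.IsIdeal.0∈ (extended (idealA x)) , λ {q} {r} π → NBᴵ.resp (begin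
          const q B.* f                              ≈⟨ B.+-identityʳ _ ⟨
          const q B.* f B.+ B.0#                     ≈⟨ B.+-congˡ (B.trans (B.-‿cong (B.zeroˡ _)) BP.-0#≈0#) ⟨
          const q B.* f B.+ B.- (B.0# B.* L q r)     ∎) (NBᴵ.*∈ (const q) m)
        fromPair : ∀ {q₀ r₀} → Pair x q₀ r₀ → IA x q₀ → ∃ (Proportional (L q₀ r₀))
        fromPair {q₀} {r₀} π₀ m = const q₀ , const∈ (idealA x) m , λ {q} {r} π →
          NBᴵ.resp (B.sym (identity q r)) (const∈ (idealA (up j x)) (pair-crossed inv π π₀))
          where
          identity : ∀ q r → const q B.* L q₀ r₀ B.+ B.- (const q₀ B.* L q r) B.≈ const (q * r₀ + - (q₀ * r))
          identity q r = begin
            const q B.* L q₀ r₀ B.+ B.- (const q₀ B.* L q r)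
              ≈⟨ B.+-cong (B.distribˡ _ _ _) (B.-‿cong (B.trans (B.distribˡ _ _ _)
                   (B.+-congʳ (B.trans (DB.exchange _ _ _) (B.trans (B.*-congˡ (B.*-comm _ _)) (DB.exchange _ _ _)))))) ⟩
            (u B.+ const q B.* const r₀) B.+ B.- (u B.+ const q₀ B.* const r)
              ≈⟨ B.+-cong (B.+-comm _ _) (B.sym (BP.-‿+-comm _ _)) ⟩
            (const q B.* const r₀ B.+ u) B.+ (B.- u B.+ B.- (const q₀ B.* const r))
              ≈⟨ B.trans (B.+-assoc _ _ _) (B.+-congˡ (B.trans (B.sym (B.+-assoc _ _ _)) (B.trans (B.+-congʳ (B.-‿inverseʳ u)) (B.+-identityˡ _)))) ⟩
            const q B.* const r₀ B.+ B.- (const q₀ B.* const r)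
              ≈⟨ B.+-cong (const-* _ _) (B.trans (const-neg _) (B.-‿cong (const-* _ _))) ⟨
            const (q * r₀) B.+ const (- (q₀ * r))
              ≈⟨ const-+ _ _ ⟨
            const (q * r₀ + - (q₀ * r)) ∎
            where
            u : B.Carrier
            u = const q B.* (Y B.* const q₀)
        go : ∀ {k} a b (R C : Fin k → ℕ) → k ≡ suc (rk x a b) → Below R a → Below C b → ∃ (Proportional (MB.minor M R C))
        go a b R C ≡.refl R< C< with b ℕ.≟ suc j
        ... | no b≢ = fromN (minor∈extended (up j x) a b R C b≢ (s≤s (ℕ.≤-reflexive (rk-up-≢ x j a b b≢))) R< C<)
        ... | yes ≡.refl = MB.minor-cases proportional {M} R
          (λ C C< → fromN (minor∈extended (up j x) a j R C (λ ()) (s≤s (ℕ.≤-trans (ℕ.≤-reflexive (rk-up-≢ x j a j (λ ())))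
                    (rk-mono-b x a (ℕ.n≤1+n j)))) R< C<))
          (λ C C< → MB.IsIdeal.resp proportional (B.sym (minor-j R C C<)) (fromPair (pair a R C ≡.refl R< C<)
            (MA.gen a (suc j) R (j ◂ C) ≡.refl R< (◂-below (ℕ.n<1+n j) (below-up C<))))) C C<

      coeff-L-zero : ∀ q r f g → coeff (const q B.* f B.+ B.- (g B.* L q r)) 0 ≈ q * coeff f 0 + - (coeff g 0 * r)
      coeff-L-zero q r f g = begin
        coeff (const q B.* f B.+ B.- (g B.* L q r)) 0
          ≈⟨ trans (coeff-+ _ _ 0) (+-cong (coeff-const-* q f 0) (trans (coeff-neg _ 0) (-‿cong (coeff-* _ _ 0)))) ⟩
        q * coeff f 0 + - (coeff g 0 * coeff (L q r) 0)
          ≈⟨ +-congˡ (-‿cong (*-congˡ (trans (coeff-+ _ _ 0) (trans (+-cong (coeff-Y*-zero _) (coeff-const-zero r)) (+-identityˡ r))))) ⟩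
        q * coeff f 0 + - (coeff g 0 * r) ∎
        where
        open ≈

      coeff-L-suc : ∀ q r f g d → coeff (const q B.* f B.+ B.- (g B.* L q r)) (suc d) ≈
        q * coeff f (suc d) + - (coeff g d * q + coeff g (suc d) * r)
      coeff-L-suc q r f g d = begin
        coeff (const q B.* f B.+ B.- (g B.* L q r)) (suc d)
          ≈⟨ trans (coeff-+ _ _ (suc d)) (+-cong (coeff-const-* q f (suc d)) (coeff-neg _ (suc d))) ⟩
        q * coeff f (suc d) + - coeff (g B.* L q r) (suc d)
          ≈⟨ +-congˡ (-‿cong (trans (coeff-cong rewriteL (suc d)) (coeff-+ _ _ (suc d)))) ⟩
        q * coeff f (suc d) + - (coeff (Y B.* (const q B.* g)) (suc d) + coeff (const r B.* g) (suc d))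
          ≈⟨ +-congˡ (-‿cong (+-cong (trans (coeff-Y*-suc _ d) (trans (coeff-const-* q g d) (*-comm _ _)))
               (trans (coeff-const-* r g (suc d)) (*-comm _ _)))) ⟩
        q * coeff f (suc d) + - (coeff g d * q + coeff g (suc d) * r) ∎
        where
        open ≈
        rewriteL : g B.* L q r B.≈ Y B.* (const q B.* g) B.+ const r B.* g
        rewriteL = B.trans (B.distribˡ _ _ _) (B.+-cong (B.trans (DB.exchange _ _ _) (B.*-congˡ (B.*-comm _ _))) (B.*-comm _ _))

      cancelʳ : ∀ {u v} → N v → N (u + - v) → N u
      cancelʳ {u} {v} m n = Nᴵ.resp (begin
        u + - v + v     ≈⟨ +-assoc _ _ _ ⟩
        u + (- v + v)   ≈⟨ +-congˡ (-‿inverseˡ v) ⟩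
        u + 0#          ≈⟨ +-identityʳ u ⟩
        u ∎) (Nᴵ.+∈ n m)
        where
        open ≈

      -- The coefficients of q f - g (q y + r), which lie in N, are compared degree by degree. Since
      -- f stops at degree e, the coefficients of g from e on lie in N; what remains in degree e is
      -- a multiple of q for every pair, and `colon-pairs` removes the q.
      top-inv : RankBounded x → ∀ f e → IB x f → (∀ d → e < d → coeff f d ≈ 0#) → TopIdeal e x (coeff f e)
      top-inv bd f e m f>e with generators-proportional m
      ... | g , g∈ , p = top e f>e (descend e f>e)
        where
        descend : ∀ e → (∀ d → e < d → coeff f d ≈ 0#) → ∀ d → e ≤ d → N (coeff g d)
        descend e f>e d e≤d = go (degree g) d e≤d (ℕ.m≤m+n _ d)
          where
          go : ∀ n d → e ≤ d → degree g ≤ n ℕ.+ d → N (coeff g d)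
          go zero    d e≤d le = Nᴵ.zero∈ (coeff-degree g d le)
          -- As f has no coefficient in degree d + 1, the relation there puts
          -- `coeff g d * q + coeff g (suc d) * r` into N, and its second summand is in N by the
          -- downward induction.
          go (suc n) d e≤d le = colon-pairs bd inv _ λ {q} {r} π → cancelʳ (Nᴵ.neg∈ (Nᴵ.∈* r above-d)) (cancelʳ
            (Nᴵ.zero∈ (trans (*-congˡ (f>e (suc d) (s≤s e≤d))) (zeroʳ q))) (Nᴵ.resp (flip q r) (Nᴵ.neg∈ (p π (suc d)))))
            where
            open ≈
            above-d : N (coeff g (suc d))
            above-d = go n (suc d) (ℕ.m≤n⇒m≤1+n e≤d) (subst (degree g ≤_) (≡.sym (ℕ.+-suc n d)) le)
            flip : ∀ q r → - coeff (const q B.* f B.+ B.- (g B.* L q r)) (suc d) ≈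
              coeff g d * q + - - (coeff g (suc d) * r) + - (q * coeff f (suc d))
            flip q r = begin
              - coeff (const q B.* f B.+ B.- (g B.* L q r)) (suc d)
                ≈⟨ -‿cong (coeff-L-suc q r f g d) ⟩
              - (q * coeff f (suc d) + - (coeff g d * q + coeff g (suc d) * r))
                ≈⟨ trans (sym (-‿+-comm _ _)) (trans (+-comm _ _) (+-congʳ (-‿involutive _))) ⟩
              coeff g d * q + coeff g (suc d) * r + - (q * coeff f (suc d))
                ≈⟨ +-congʳ (+-congˡ (-‿involutive _)) ⟨
              coeff g d * q + - - (coeff g (suc d) * r) + - (q * coeff f (suc d)) ∎
        top : ∀ e → (∀ d → e < d → coeff f d ≈ 0#) → (∀ d → e ≤ d → N (coeff g d)) → TopIdeal e x (coeff f e)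
        top zero f>e g≥e = colon-pairs bd inv _ λ {q} {r} π → cancelʳ (Nᴵ.∈* r (g≥e 0 z≤n))
          (Nᴵ.resp (trans (coeff-L-zero q r f g) (+-congʳ (*-comm _ _))) (p π 0))
        -- The coefficient is split as its difference from `coeff g e`, which is in N and so in
        -- `IA x`, plus `coeff g e`, which is in `IA x` because g has all its coefficients there.
        top (suc e) f>e g≥e = IA.resp (trans (+-assoc _ _ _) (trans (+-congˡ (-‿inverseˡ _)) (+-identityʳ _)))
          (IA.+∈ (MA.MinorIdeal-antitone (rk≤up x j) difference) (g∈ e))
          where
          module IA = MA.IsIdeal (idealA x)
          difference : N (coeff f (suc e) + - coeff g e)
          difference = colon-pairs bd inv _ λ {q} {r} π → cancelʳ (Nᴵ.∈* r (g≥e (suc e) ℕ.≤-refl))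
            (Nᴵ.resp (identity q r) (p π (suc e)))
            where
            open ≈
            identity : ∀ q r → coeff (const q B.* f B.+ B.- (g B.* L q r)) (suc e) ≈
              (coeff f (suc e) + - coeff g e) * q + - (coeff g (suc e) * r)
            identity q r = begin
              coeff (const q B.* f B.+ B.- (g B.* L q r)) (suc e)  ≈⟨ coeff-L-suc q r f g e ⟩
              q * coeff f (suc e) + - (coeff g e * q + coeff g (suc e) * r)
                ≈⟨ +-cong (*-comm _ _) (sym (-‿+-comm _ _)) ⟩
              coeff f (suc e) * q + (- (coeff g e * q) + - (coeff g (suc e) * r))
                ≈⟨ +-assoc _ _ _ ⟨
              coeff f (suc e) * q + - (coeff g e * q) + - (coeff g (suc e) * r)
                ≈⟨ +-congʳ (trans (+-congˡ (-‿distribˡ-* _ _)) (sym (distribʳ _ _ _))) ⟩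
              (coeff f (suc e) + - coeff g e) * q + - (coeff g (suc e) * r) ∎

    -- Without an inversion `up j` changes nothing and the ideal is extended from the smaller chart,
    -- so all coefficients lie in it.
    top : ∀ {x} → RankBounded x → ∀ f e → IB x f → (∀ d → e < d → coeff f d ≈ 0#) → TopIdeal e x (coeff f e)
    top {x} bd f e m f>e with x (suc j) <? x j
    ... | yes inv = top-inv inv bd f e m f>e
    ... | no ¬inv = noninv e
      where
      m′ : ∀ d → IA (up j x) (coeff f d)
      m′ = up⊆extended x (subst (λ z → IB z f) (≡.sym (up-noninv ¬inv)) m)
      noninv : ∀ e → TopIdeal e x (coeff f e)
      noninv zero    = m′ 0
      noninv (suc e) = subst (λ z → IA z (coeff f (suc e))) (up-noninv ¬inv) (m′ (suc e))

    -- Induction on the degree of h: once the top coefficient is known to lie in `IA x′`, a multiple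
    -- of a lift linear in y is subtracted. A constant leaves no room for such a lift and must be
    -- placed in the smaller ideal `IA (up j x′)`.
    colon-step : ∀ {x x′} → RankBounded x′ → x ⊏ x′ → ∀ h → (∀ g → IB x g → IB x′ (h B.* g)) → IB x′ h
    colon-step {x} {x′} bd x⊏x′ h h* = go (degree h) h (coeff-degree h) h*
      where
      open ≈
      module Bᴵ = MB.IsIdeal (idealB x′)
      shift : ℕ → B.Carrier → B.Carrier
      shift zero    p = p
      shift (suc n) p = Y B.* shift n p
      shift∈ : ∀ n {p} → IB x′ p → IB x′ (shift n p)
      shift∈ zero    m = m
      shift∈ (suc n) m = Bᴵ.*∈ Y (shift∈ n m)
      coeff-shift : ∀ n p d → coeff (shift n p) (n ℕ.+ d) ≈ coeff p d
      coeff-shift zero    p d = refl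
      coeff-shift (suc n) p d = trans (coeff-Y*-suc _ _) (coeff-shift n p d)
      coeff-Y+const-one : ∀ a b → coeff (Y B.* const a B.+ const b) 1 ≈ a
      coeff-Y+const-one a b = trans (coeff-+ _ _ 1) (trans (+-cong (trans (coeff-Y*-suc _ 0) (coeff-const-zero a)) (coeff-const-suc b 0)) (+-identityʳ a))
      coeff-Y+const-high : ∀ a b d → coeff (Y B.* const a B.+ const b) (suc (suc d)) ≈ 0#
      coeff-Y+const-high a b d = trans (coeff-+ _ _ _) (trans (+-cong (trans (coeff-Y*-suc _ _) (coeff-const-suc a d)) (coeff-const-suc b _)) (+-identityˡ 0#))
      const≈ : ∀ h → (∀ d → 1 ≤ d → coeff h d ≈ 0#) → const (coeff h 0) B.≈ h
      const≈ h h≥1 = coeff-ext λ { zero → coeff-const-zero _ ; (suc d) → trans (coeff-const-suc _ d) (sym (h≥1 (suc d) (s≤s z≤n))) }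
      -- Multiplication by a lift y g + r turns the top coefficient into its multiple by g in degree
      -- e + 1, where `top` in positive degree applies.
      topCoefficient : ∀ h e → (∀ d → suc e ≤ d → coeff h d ≈ 0#) → (∀ g → IB x g → IB x′ (h B.* g)) → IA x′ (coeff h e)
      topCoefficient h e h>e h* = colon bd x⊏x′ _ λ g g∈ → product g (lift x g∈)
        where
        product : ∀ g → Lifts x g → IA x′ (coeff h e * g)
        product g (r , m) = MA.resp (begin
          coeff (h B.* G) (suc e) ≈⟨ hG (suc e) ⟩
          g * coeff h e + r * coeff h (suc e) ≈⟨ +-cong (*-comm _ _) (trans (*-congˡ (h>e (suc e) ℕ.≤-refl)) (zeroʳ r)) ⟩
          coeff h e * g + 0# ≈⟨ +-identityʳ _ ⟩
          coeff h e * g ∎) (top bd (h B.* G) (suc e) (h* G m) vanish)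
          where
          G : B.Carrier
          G = Y B.* const g B.+ const r
          pred-coeff : ℕ → Carrier
          pred-coeff zero    = 0#
          pred-coeff (suc d) = coeff h d
          hG : ∀ d → coeff (h B.* G) d ≈ g * pred-coeff d + r * coeff h d
          hG d = begin
            coeff (h B.* G) d
              ≈⟨ coeff-cong (B.trans (B.distribˡ _ _ _) (B.+-cong (B.trans (DB.exchange _ _ _) (B.*-congˡ (B.*-comm _ _))) (B.*-comm _ _))) d ⟩
            coeff (Y B.* (const g B.* h) B.+ const r B.* h) d
              ≈⟨ coeff-+ _ _ d ⟩
            coeff (Y B.* (const g B.* h)) d + coeff (const r B.* h) d
              ≈⟨ +-cong (shifted d) (coeff-const-* r h d) ⟩
            g * pred-coeff d + r * coeff h d ∎
            where
            shifted : ∀ d → coeff (Y B.* (const g B.* h)) d ≈ g * pred-coeff d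
            shifted zero    = trans (coeff-Y*-zero _) (sym (zeroʳ g))
            shifted (suc d) = trans (coeff-Y*-suc _ d) (coeff-const-* g h d)
          vanish : ∀ d → suc e < d → coeff (h B.* G) d ≈ 0#
          vanish (suc d) (s≤s e<d) = trans (hG (suc d)) (trans (+-cong
            (trans (*-congˡ (h>e d e<d)) (zeroʳ g)) (trans (*-congˡ (h>e (suc d) (ℕ.m≤n⇒m≤1+n e<d))) (zeroʳ r))) (+-identityˡ 0#))
      -- At an inversion of `x′` the multipliers are taken from `IA (up j x)`, whose elements are
      -- constants in the ideal of `x`. The products then stay in degree 0, where `top` yields the
      -- smaller ideal.
      constant : ∀ h → (∀ d → 1 ≤ d → coeff h d ≈ 0#) → (∀ g → IB x g → IB x′ (h B.* g)) → IA x′ (coeff h 0) → IA (up j x′) (coeff h 0)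
      constant h h≥1 h* h₀∈ = split (x′ (suc j) <? x′ j)
        where
        product : ∀ g d → coeff (h B.* const g) d ≈ g * coeff h d
        product g d = trans (coeff-cong (B.*-comm _ _) d) (coeff-const-* g h d)
        split : Dec (Inv j x′) → IA (up j x′) (coeff h 0)
        split (no ¬inv′) = subst (λ z → IA z (coeff h 0)) (≡.sym (up-noninv ¬inv′)) h₀∈
        split (yes inv′) = colon (up-bounded j bd) (up-⊏ inv′ x⊏x′) _ λ g g∈ →
          MA.resp (trans (product g 0) (*-comm _ _)) (top bd (h B.* const g) 0 (h* _ (up⊆contracted x g∈))
            λ d 0<d → trans (product g d) (trans (*-congˡ (h≥1 d 0<d)) (zeroʳ g)))
      Claim : ℕ → Set (c ⊔ ℓ)
      Claim n = ∀ h → (∀ d → n ≤ d → coeff h d ≈ 0#) → (∀ g → IB x g → IB x′ (h B.* g)) → IB x′ h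
      reduce : ∀ e → Claim (suc e) → Claim (suc (suc e))
      reduce e previous h h≥n h* with lift x′ (topCoefficient h (suc e) h≥n h*)
      ... | r , m = Bᴵ.resp (B.trans (B.+-assoc _ _ _) (B.trans (B.+-congˡ (B.-‿inverseˡ _)) (B.+-identityʳ h)))
                      (Bᴵ.+∈ (previous h′ h′≥ h′*) S∈)
        where
        S h′ : B.Carrier
        -- h has degree at most e + 1 and the lift has degree at most 1, whence the shift by e.
        S = shift e (Y B.* const (coeff h (suc e)) B.+ const r)
        h′ = h B.+ B.- S
        S∈ : IB x′ S
        S∈ = shift∈ e m
        h′* : ∀ g → IB x g → IB x′ (h′ B.* g)
        h′* g g∈ = Bᴵ.resp (B.sym (B.distribʳ _ _ _)) (Bᴵ.+∈ (h* g g∈) (Bᴵ.∈* g (Bᴵ.neg∈ S∈)))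
        agrees : ∀ d → coeff h (e ℕ.+ suc d) ≈ coeff (Y B.* const (coeff h (suc e)) B.+ const r) (suc d)
        agrees zero    = trans (reflexive (cong (coeff h) (ℕ.+-comm e 1))) (sym (coeff-Y+const-one _ r))
        agrees (suc d) = trans (h≥n _ (subst (suc (suc e) ≤_) (≡.sym (≡.trans (ℕ.+-suc e (suc d)) (cong suc (ℕ.+-suc e d)))) (s≤s (s≤s (ℕ.m≤m+n e d)))))
                           (sym (coeff-Y+const-high _ r d))
        h′≥ : ∀ d → suc e ≤ d → coeff h′ d ≈ 0#
        h′≥ d e<d = begin
          coeff h′ d                    ≈⟨ trans (coeff-+ _ _ d) (+-congˡ (coeff-neg S d)) ⟩
          coeff h d + - coeff S d       ≡⟨ cong (λ i → coeff h i + - coeff S i) (≡.trans (ℕ.+-suc e _) (ℕ.m+[n∸m]≡n e<d)) ⟨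
          coeff h (e ℕ.+ suc i) + - coeff S (e ℕ.+ suc i) ≈⟨ +-congˡ (-‿cong (trans (coeff-shift e _ (suc i)) (sym (agrees i)))) ⟩
          coeff h (e ℕ.+ suc i) + - coeff h (e ℕ.+ suc i) ≈⟨ -‿inverseʳ _ ⟩
          0# ∎
          where
          i : ℕ
          i = d ℕ.∸ suc e
      go : ∀ n → Claim n
      go zero h h≥n h* = Bᴵ.zero∈ (coeff-ext (λ d → trans (h≥n d z≤n) (sym (coeff-0 d))))
      go (suc zero) h h≥n h* = Bᴵ.resp (const≈ h h≥n) (up⊆contracted x′ (constant h h≥n h* (topCoefficient h 0 h≥n h*)))
      go (suc (suc e)) = reduce e (go (suc e))

-- Iterating the degeneration

-- An entry (j , p , β) stands for an exchange of the columns j and j + 1, which introduces the variable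
-- in row p of the column that is column β of the original chart. The first entry carries the largest variable.
Steps : Set
Steps = List (ℕ × (ℕ × ℕ))

Monomial : Set
Monomial = ℕ → ℕ → ℕ

-- The exponents of leading monomials, by recursion on the degree in the largest variable.
Initial : Steps → (ℕ → ℕ) → Monomial → Set
Initial [] x m = ¬ (∀ a b → a ≤ rk x a b ⊎ b ≤ rk x a b)
Initial ((j , p , β) ∷ st) x m with m p β
... | zero  = Initial st (up j x) m
... | suc _ = Initial st x m

module Tower {c ℓ} (K : CommutativeRing c ℓ) where

  ring : Steps → CommutativeRing c ℓ
  ring []       = K
  ring (_ ∷ st) = ring st [y]

  δ : ℕ → ℕ → CommutativeRing.Carrier K
  δ zero    zero    = CommutativeRing.1# K
  δ zero    (suc _) = CommutativeRing.0# K
  δ (suc _) zero    = CommutativeRing.0# K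
  δ (suc a) (suc b) = δ a b

  matrix : ∀ st → ℕ → ℕ → CommutativeRing.Carrier (ring st)
  matrix []             = δ
  matrix ((j , _) ∷ st) = Step.M (ring st) (matrix st) j

  det-δ : ∀ k → CommutativeRing._≈_ K (Minors.minor K δ {k} toℕ toℕ) (CommutativeRing.1# K)
  det-δ zero    = reflexive (det-zero _)
    where
    open CommutativeRing K
    open Determinant K
  det-δ (suc k) = begin
    minor δ toℕ toℕ
      ≡⟨ ≡.trans (det-row k _) (asum-suc _) ⟩
    1# * minor δ {k} toℕ toℕ + - asum k _
      ≈⟨ +-cong (trans (*-identityˡ _) (det-δ k)) (trans (-‿cong (asum-zero (λ i → zeroˡ _))) -0#≈0#) ⟩
    1# + 0# ≈⟨ +-identityʳ _ ⟩
    1# ∎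
    where
    open CommutativeRing K hiding (zero)
    open RingProperties (CommutativeRing.ring K) using (-0#≈0#)
    open Determinant K
    open Minors K
    open SetoidReasoning setoid

  -- In the identity chart a strict inequality of ranks at (a , b) leaves room for the identity
  -- minor of size `suc (rk x a b)`. So 1 lies in the ideal of `x`, and h = h * 1 in that of `x′`.
  colon : ∀ st j → Step.Colon (ring st) (matrix st) j
  colon [] j {x} {x′} bd x⊏x′ h h* with _⊏_.strict x⊏x′
  ... | a , b , r<r′ = MinorIdeal.resp (*-identityʳ h) (h* 1# (MinorIdeal.resp (det-δ _)
        (MinorIdeal.gen a b toℕ toℕ ≡.refl
          (λ t → ℕ.<-≤-trans (Fin.toℕ<n t) (ℕ.≤-trans r<r′ (bd a b)))
          (λ t → ℕ.<-≤-trans (Fin.toℕ<n t) (ℕ.≤-trans r<r′ (rk≤ x′ a b))))))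
    where
    open CommutativeRing K
    open Minors K
  colon ((i , _) ∷ st) j = Step.Degeneration.colon-step (ring st) (matrix st) i (colon st i)

  Leading : ∀ st → CommutativeRing.Carrier (ring st) → Monomial → Set ℓ
  Leading []                  f m = ¬ (CommutativeRing._≈_ K f (CommutativeRing.0# K))
  Leading ((j , p , β) ∷ st) f m =
    (∀ d → m p β < d → CommutativeRing._≈_ (ring st) (coeff f d) (CommutativeRing.0# (ring st))) × Leading st (coeff f (m p β)) m
    where
    open Coefficients (ring st)

  -- Each step is `top`. At the end, if all ranks are full then every generator is oversized, the
  -- ideal is zero, and it contains no nonzero constant.
  leading∈initial : ∀ st {x} → RankBounded x → ∀ {f m} →
    Minors.MinorIdeal (ring st) (matrix st) (rk x) f → Leading st f m → Initial st x m
  leading∈initial [] {x} bd {f} f∈ f≉0 full = f≉0 (MinorIdeal-elim zeroIdeal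
    (λ { {k} a b R C ≡.refl R< C< → oversized-minor δ a b R C R< C< (Sum.map s≤s s≤s (full a b)) }) f∈)
    where
    open CommutativeRing K hiding (zero)
    open Minors K
    zeroIdeal : IsIdeal (_≈ 0#)
    zeroIdeal = record
      { resp = λ e → trans (sym e)
      ; 0∈ = refl
      ; +∈ = λ e e′ → trans (+-cong e e′) (+-identityˡ 0#)
      ; *∈ = λ h e → trans (*-congˡ e) (zeroʳ h)
      }
  leading∈initial ((j , p , β) ∷ st) {x} bd {f} {m} f∈ (f>m , lead) with m p β
  ... | zero  = leading∈initial st (up-bounded j bd) (Step.Degeneration.top (ring st) (matrix st) j (colon st j) bd f 0 f∈ f>m) lead
  ... | suc e = leading∈initial st bd (Step.Degeneration.top (ring st) (matrix st) j (colon st j) bd f (suc e) f∈ f>m) lead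

open import Data.Nat using (_+_)
open import Relation.Binary.PropositionalEquality using (refl; sym; trans; subst₂)

-- Maximal matchings

-- Permutations of ℕ with finite support, so that columns can be exchanged without carrying the
-- bound n.
record Perm : Set where
  field
    to      : ℕ → ℕ
    from    : ℕ → ℕ
    to-from : ∀ a → to (from a) ≡ a
    from-to : ∀ b → from (to b) ≡ b
    size    : ℕ
    fixed   : ∀ k → size ≤ k → to k ≡ k
  injective : ∀ {a b} → to a ≡ to b → a ≡ b
  injective {a} {b} e = trans (sym (from-to a)) (trans (cong from e) (from-to b))

open Perm

swapped : ℕ → Perm → Perm
swapped j π = record
  { to = to π ∘ sw j
  ; from = sw j ∘ from π
  ; to-from = λ a → trans (cong (to π) (sw-involutive j _)) (to-from π a)
  ; from-to = λ b → trans (cong (sw j) (from-to π _)) (sw-involutive j b)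
  ; size = size π ℕ.⊔ suc (suc j)
  ; fixed = λ k le → let j<k = ℕ.≤-trans (ℕ.m≤n⊔m (size π) (suc (suc j))) le in
      trans (cong (to π) (sw-else j (ℕ.>⇒≢ (ℕ.<-trans (ℕ.n<1+n j) j<k)) (ℕ.>⇒≢ j<k)))
        (fixed π k (ℕ.≤-trans (ℕ.m≤m⊔n (size π) (suc (suc j))) le))
  }

-- The same dots counted by rows. In the induction step a dot at (a , b) itself is counted once on
-- either side, since `to π b` is a exactly when `from π a` is b.
rk-row : ∀ π a b → rk (to π) (suc a) b ≡ [ from π a < b ] + rk (to π) a b
rk-row π a zero    = refl
rk-row π a (suc b) = begin
  [ to π b < suc a ] + rk (to π) (suc a) b                 ≡⟨ cong ([ to π b < suc a ] +_) (rk-row π a b) ⟩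
  [ to π b < suc a ] + ([ from π a < b ] + rk (to π) a b)  ≡⟨ ℕ.+-assoc [ to π b < suc a ] _ _ ⟨
  [ to π b < suc a ] + [ from π a < b ] + rk (to π) a b    ≡⟨ cong (_+ rk (to π) a b) cell ⟩
  [ from π a < suc b ] + [ to π b < a ] + rk (to π) a b    ≡⟨ ℕ.+-assoc [ from π a < suc b ] _ _ ⟩
  [ from π a < suc b ] + rk (to π) a (suc b) ∎
  where
  open ≡.≡-Reasoning
  widen : from π a ≢ b → [ from π a < b ] ≡ [ from π a < suc b ]
  widen ≢b with ℕ.<-cmp (from π a) b
  ... | tri< lt _ _ = trans ([<]-yes lt) (sym ([<]-yes (ℕ.m<n⇒m<1+n lt)))
  ... | tri≈ _ e _  = ⊥-elim (≢b e)
  ... | tri> _ _ gt = trans ([<]-no (ℕ.<⇒≤ gt)) (sym ([<]-no gt))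
  off : to π b ≢ a → from π a ≢ b
  off to≢ refl = to≢ (to-from π a)
  cell : [ to π b < suc a ] + [ from π a < b ] ≡ [ from π a < suc b ] + [ to π b < a ]
  cell with ℕ.<-cmp (to π b) a
  ... | tri< lt ≢a _ = trans (cong₂ _+_ ([<]-yes (ℕ.m<n⇒m<1+n lt)) (widen (off ≢a)))
                         (trans (ℕ.+-comm 1 _) (cong ([ from π a < suc b ] +_) (sym ([<]-yes lt))))
  ... | tri> _ ≢a gt = trans (cong₂ _+_ ([<]-no gt) (widen (off ≢a)))
                         (trans (ℕ.+-comm 0 _) (cong ([ from π a < suc b ] +_) (sym ([<]-no (ℕ.<⇒≤ gt)))))
  ... | tri≈ _ refl _ = trans (cong₂ _+_ ([<]-yes (ℕ.n<1+n (to π b))) ([<]-no (ℕ.≤-reflexive (sym (from-to π b)))))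
                         (sym (cong₂ _+_ ([<]-yes (ℕ.≤-reflexive (cong suc (from-to π b)))) ([<]-no (ℕ.≤-refl {to π b}))))

rank-bounded : ∀ π → RankBounded (to π)
rank-bounded π zero    b = ℕ.≤-reflexive (no-rows b)
  where
  no-rows : ∀ b → rk (to π) 0 b ≡ 0
  no-rows zero    = refl
  no-rows (suc b) = no-rows b
rank-bounded π (suc a) b = ℕ.≤-trans (ℕ.≤-reflexive (rk-row π a b)) (ℕ.+-mono-≤ indicator≤1 (rank-bounded π a b))
  where
  indicator≤1 : [ from π a < b ] ≤ 1
  indicator≤1 with from π a <? b
  ... | yes p = ℕ.≤-reflexive ([<]-yes p)
  ... | no ¬p = ℕ.≤-trans (ℕ.≤-reflexive ([<]-no (ℕ.≮⇒≥ ¬p))) z≤n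

InDiagram : Perm → ℕ → ℕ → Set
InDiagram π a b = a < to π b × b < from π a

rk-diagram : ∀ π {a b} → InDiagram π a b → rk (to π) (suc a) (suc b) ≡ rk (to π) a b
rk-diagram π {a} {b} (a<to , b<from) = trans (cong (_+ rk (to π) (suc a) b) ([<]-no a<to))
  (trans (rk-row π a b) (cong (_+ rk (to π) a b) ([<]-no (ℕ.<⇒≤ b<from))))

-- A rank that is not full excludes the identity. If n is the smallest moved index, both `to π n`
-- and `from π n` exceed n, so (n , n) is a box.
diagram-box : ∀ π → ¬ (∀ a b → a ≤ rk (to π) a b ⊎ b ≤ rk (to π) a b) → ∃₂ λ a b → InDiagram π a b
diagram-box π notFull with search (size π)
  where
  search : ∀ n → (∀ k → k < n → to π k ≡ k) ⊎ (∃₂ λ a b → InDiagram π a b)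
  search zero = inj₁ λ _ ()
  search (suc n) with search n
  ... | inj₂ box = inj₂ box
  ... | inj₁ fix with to π n ℕ.≟ n
  ...   | yes e = inj₁ λ k k<1+n → Sum.[ fix k , (λ { refl → e }) ] (ℕ.m≤n⇒m<n∨m≡n (ℕ.s≤s⁻¹ k<1+n))
  ...   | no n-moves = inj₂ (n , n , ℕ.≤∧≢⇒< (ℕ.≮⇒≥ (λ lt → n-moves (injective π (fix _ lt)))) (n-moves ∘ sym)
            , ℕ.≤∧≢⇒< (ℕ.≮⇒≥ (λ lt → n-moves (fixes (trans (sym (fix _ lt)) (to-from π n))))) (n-moves ∘ fixes ∘ sym))
    where
    fixes : from π n ≡ n → to π n ≡ n
    fixes e = trans (cong (to π) (sym e)) (to-from π n)
... | inj₂ box = box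
... | inj₁ fix = ⊥-elim (notFull full)
  where
  all-fixed : ∀ k → to π k ≡ k
  all-fixed k with k <? size π
  ... | yes p = fix k p
  ... | no ¬p = fixed π k (ℕ.≮⇒≥ ¬p)
  full : ∀ a b → a ≤ rk (to π) a b ⊎ b ≤ rk (to π) a b
  full a zero = inj₂ z≤n
  full a (suc b) with full a b | b <? a
  ... | inj₁ a≤ | _      = inj₁ (ℕ.≤-trans a≤ (ℕ.m≤n+m _ _))
  ... | inj₂ b≤ | no b≮a = inj₁ (ℕ.≤-trans (ℕ.≮⇒≥ b≮a) (ℕ.≤-trans b≤ (ℕ.m≤n+m _ _)))
  ... | inj₂ b≤ | yes p  = inj₂ (subst (λ z → suc b ≤ z + rk (to π) a b)
            (sym ([<]-yes (subst (_< a) (sym (all-fixed b)) p))) (s≤s b≤))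

sw-mono : ∀ j {i i′} → i < i′ → sw j i < sw j i′ ⊎ (i ≡ j × i′ ≡ suc j)
sw-mono zero    {zero}        {suc zero}     _ = inj₂ (refl , refl)
sw-mono zero    {zero}        {suc (suc i′)} _ = inj₁ (s≤s (s≤s z≤n))
sw-mono zero    {suc zero}    {suc zero}     (s≤s ())
sw-mono zero    {suc (suc i)} {suc zero}     (s≤s ())
sw-mono zero    {suc zero}    {suc (suc i′)} _ = inj₁ (s≤s z≤n)
sw-mono zero    {suc (suc i)} {suc (suc i′)} p = inj₁ p
sw-mono (suc j) {zero}        {suc i′}       _ = inj₁ (s≤s z≤n)
sw-mono (suc j) {suc i}       {suc i′} (s≤s p) = Sum.map s≤s (λ (e , e′) → cong suc e , cong suc e′) (sw-mono j p)

sw-mono⁻¹ : ∀ j {i i′} → sw j i < sw j i′ → i < i′ ⊎ (i ≡ suc j × i′ ≡ j)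
sw-mono⁻¹ j {i} {i′} p with sw-mono j p
... | inj₁ q = inj₁ (subst₂ _<_ (sw-involutive j i) (sw-involutive j i′) q)
... | inj₂ (e , e′) = inj₂ (trans (sym (sw-involutive j i)) (trans (cong (sw j) e) (sw-j j))
                         , trans (sym (sw-involutive j i′)) (trans (cong (sw j) e′) (sw-1+j j)))

Cell : Set
Cell = ℕ × ℕ

rows cols : List Cell → List ℕ
rows = map proj₁
cols = map proj₂

labels : Steps → List Cell
labels = map proj₂

LexLe : Steps → Monomial → Monomial → Set
LexLe [] m′ m = ⊤
LexLe ((_ , p , β) ∷ st) m′ m = m′ p β < m p β ⊎ (m′ p β ≡ m p β × LexLe st m′ m)

LexLe-resp : ∀ st {m′ m n′ n : Monomial} → (∀ a b → m′ a b ≡ n′ a b) → (∀ a b → m a b ≡ n a b) → LexLe st m′ m → LexLe st n′ n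
LexLe-resp []                 e f _ = _
LexLe-resp ((_ , p , β) ∷ st) e f (inj₁ lt)       = inj₁ (subst₂ _<_ (e p β) (f p β) lt)
LexLe-resp ((_ , p , β) ∷ st) e f (inj₂ (eq , l)) = inj₂ (trans (sym (e p β)) (trans eq (f p β)) , LexLe-resp st e f l)

LexLe-add : ∀ st (w m′ m : Monomial) → LexLe st m′ m → LexLe st (λ a b → w a b + m′ a b) (λ a b → w a b + m a b)
LexLe-add []                 w m′ m _ = _
LexLe-add ((_ , p , β) ∷ st) w m′ m (inj₁ lt)       = inj₁ (ℕ.+-monoʳ-< (w p β) lt)
LexLe-add ((_ , p , β) ∷ st) w m′ m (inj₂ (eq , l)) = inj₂ (cong (w p β +_) eq , LexLe-add st w m′ m l)

LexLe-cancel : ∀ st (w m′ m : Monomial) → LexLe st (λ a b → w a b + m′ a b) (λ a b → w a b + m a b) → LexLe st m′ m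
LexLe-cancel []                 w m′ m _ = _
LexLe-cancel ((_ , p , β) ∷ st) w m′ m (inj₁ lt)       = inj₁ (ℕ.+-cancelˡ-< (w p β) _ _ lt)
LexLe-cancel ((_ , p , β) ∷ st) w m′ m (inj₂ (eq , l)) = inj₂ (ℕ.+-cancelˡ-≡ (w p β) _ _ eq , LexLe-cancel st w m′ m l)

unique-↭ : ∀ {a} {A : Set a} {xs ys : List A} → xs ↭ ys → Unique xs → Unique ys
unique-↭ p = ↭ₛ.Unique-resp-↭ (≡.setoid _) (↭⇒↭ₛ p)

extract : ∀ {a} {A : Set a} {x : A} {xs} → x ∈ xs → ∃ λ ys → xs ↭ x ∷ ys
extract x∈ with ∈-∃++ x∈
... | ys , zs , refl = _ , ↭.shift _ ys zs

unique-image : ∀ {a b} {A : Set a} {B : Set b} (f : A → B) {xs} → Unique (map f xs) →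
  ∀ {x y} → x ∈ xs → y ∈ xs → f x ≡ f y → x ≡ y
unique-image f _         (here refl) (here refl) _ = refl
unique-image f {_ ∷ xs} (x∉ ∷ _) (here refl) (there y∈)  e = ⊥-elim (All.All¬⇒¬Any x∉ (subst (_∈ map f xs) (sym e) (∈-map⁺ f y∈)))
unique-image f {_ ∷ xs} (y∉ ∷ _) (there x∈)  (here refl) e = ⊥-elim (All.All¬⇒¬Any y∉ (subst (_∈ map f xs) e (∈-map⁺ f x∈)))
unique-image f (_ ∷ uxs) (there x∈)  (there y∈)  e = unique-image f uxs x∈ y∈ e

initial-cases : ∀ {j p β st x m} → Initial ((j , p , β) ∷ st) x m →
  (1 ≤ m p β × Initial st x m) ⊎ Initial st (up j x) m
initial-cases {p = p} {β} {m = m} init with m p β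
... | zero  = inj₂ init
... | suc _ = inj₁ (s≤s z≤n , init)

-- Cells are pairs (row , original column); u gives the positions of the entries 1.
module Chart (u : Perm) where

  weight : Cell → Monomial
  weight (a , β) c d with a ℕ.≟ to u β | a ℕ.≟ c | β ℕ.≟ d
  ... | no _ | yes _ | yes _ = 1
  ... | _    | _     | _     = 0

  weight-graph : ∀ {a β} c d → a ≡ to u β → weight (a , β) c d ≡ 0
  weight-graph {a} {β} c d e with a ℕ.≟ to u β | a ℕ.≟ c | β ℕ.≟ d
  ... | yes _ | _     | _     = refl
  ... | no ≢  | _     | _     = ⊥-elim (≢ e)

  weight-self : ∀ {a β} → a ≢ to u β → weight (a , β) a β ≡ 1
  weight-self {a} {β} a≢ with a ℕ.≟ to u β | a ℕ.≟ a | β ℕ.≟ β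
  ... | yes e | _     | _     = ⊥-elim (a≢ e)
  ... | no _  | yes _ | yes _ = refl
  ... | no _  | yes _ | no ≢  = ⊥-elim (≢ refl)
  ... | no _  | no ≢  | _     = ⊥-elim (≢ refl)

  weight-other : ∀ {q c d} → q ≢ (c , d) → weight q c d ≡ 0
  weight-other {a , β} {c} {d} q≢ with a ℕ.≟ to u β | a ℕ.≟ c | β ℕ.≟ d
  ... | yes _ | _     | _     = refl
  ... | no _  | no _  | _     = refl
  ... | no _  | yes _ | no _  = refl
  ... | no _  | yes e | yes f = ⊥-elim (q≢ (cong₂ _,_ e f))

  wt : List Cell → Monomial
  wt []       c d = 0
  wt (q ∷ ps) c d = weight q c d + wt ps c d

  wt-↭ : ∀ {ps qs} → ps ↭ qs → ∀ c d → wt ps c d ≡ wt qs c d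
  wt-↭ _↭_.refl c d = refl
  wt-↭ (_↭_.prep x p) c d = cong (weight x c d +_) (wt-↭ p c d)
  wt-↭ (_↭_.swap x y p) c d = trans (cong (λ z → weight x c d + (weight y c d + z)) (wt-↭ p c d))
    (+-exchange (weight x c d) (weight y c d) _)
  wt-↭ (_↭_.trans p q) c d = trans (wt-↭ p c d) (wt-↭ q c d)

  wt-absent : ∀ {ps c d} → (c , d) ∉ ps → wt ps c d ≡ 0
  wt-absent {[]}     _ = refl
  wt-absent {q ∷ ps} ∉ = cong₂ _+_ (weight-other (λ e → ∉ (here (sym e)))) (wt-absent (∉ ∘ there))

  -- The columns of u are read in the order τ; j is the last descent of u ∘ τ.
  data Word : Perm → Steps → Set where
    nil  : ∀ {τ} → (∀ k → to u (to τ k) ≡ k) → Word τ []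
    step : ∀ {τ st} j → Word (swapped j τ) st →
           to u (to τ (suc j)) < to u (to τ j) →
           (∀ k → suc j < k → to u (to τ (suc j)) < to u (to τ k)) →
           Word τ ((j , to u (to τ (suc j)) , to τ j) ∷ st)

  -- The inversions of u read in the order `τ`; for the identity order this is the Rothe diagram.
  InChart : Perm → Cell → Set
  InChart τ (a , β) = a < to u β × from τ β < from τ (from u a)

  private
    value : ∀ τ a → to u (to τ (from τ (from u a))) ≡ a
    value τ a = trans (cong (to u) (to-from τ _)) (to-from u a)
    graph-value : ∀ τ β → to u (to τ (from τ β)) ≡ to u β
    graph-value τ β = cong (to u) (to-from τ β)

  -- An exchange at a descent removes exactly one inversion, the pair of adjacent columns, and that
  -- inversion is the label of the step.
  label⇒ : ∀ {τ st q} → Word τ st → q ∈ labels st → InChart τ q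
  label⇒ {τ} (step j W p<q later) (here refl) =
    p<q , subst₂ _<_ (sym (from-to τ j)) (sym (trans (cong (from τ) (from-to u _)) (from-to τ (suc j)))) (ℕ.n<1+n j)
  label⇒ {τ} {q = a , β} (step j W p<q later) (there q∈) with label⇒ W q∈
  ... | a<uβ , lt with sw-mono⁻¹ j lt
  ...   | inj₁ lt′ = a<uβ , lt′
  ...   | inj₂ (e , e′) = ⊥-elim (ℕ.<-asym p<q (subst₂ _<_
            (trans (sym (value τ a)) (cong (to u ∘ to τ) e′))
            (trans (sym (graph-value τ β)) (cong (to u ∘ to τ) e)) a<uβ))

  ⇒label : ∀ {τ st q} → Word τ st → InChart τ q → q ∈ labels st
  ⇒label {τ} {q = a , β} (nil id) (a<uβ , lt) = ⊥-elim (ℕ.<-asym a<uβ (subst₂ _<_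
    (trans (sym (id _)) (graph-value τ β)) (trans (sym (id _)) (value τ a)) lt))
  ⇒label {τ} {q = a , β} (step j W p<q later) (a<uβ , lt) with sw-mono j lt
  ... | inj₁ lt′ = there (⇒label W (a<uβ , lt′))
  ... | inj₂ (e , e′) = here (cong₂ _,_ (trans (sym (value τ a)) (cong (to u ∘ to τ) e′))
                                        (trans (sym (to-from τ β)) (cong (to τ) e)))

  Nz : Steps → Cell → Set
  Nz st q = proj₁ q ≡ to u (proj₂ q) ⊎ q ∈ labels st

  -- A list of cells stands for the minor on its rows and columns together with a term of its expansion;
  -- it is maximal if no other term of the same minor has a larger monomial.
  Max : Steps → List Cell → Set
  Max st ps = All (Nz st) ps ×
    (∀ qs → All (Nz st) qs → rows qs ↭ rows ps → cols qs ↭ cols ps → LexLe st (wt qs) (wt ps))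

  -- Adding q to a competitor of the rest gives a competitor of the whole, and the weight of q
  -- cancels.
  max-delete : ∀ {st ps q qs} → Max st ps → ps ↭ q ∷ qs → Max st qs
  max-delete {st} {ps} {q} {qs} (nz , max) p with ↭.All-resp-↭ p nz
  ... | nz-q ∷ nz-qs = nz-qs , λ rs nz-rs rs-rows rs-cols → LexLe-cancel st (weight q) (wt rs) (wt qs)
      (LexLe-resp st (λ _ _ → refl) (wt-↭ p) (max (q ∷ rs) (nz-q ∷ nz-rs)
        (↭-trans (prep (proj₁ q) rs-rows) (↭-sym (↭.map⁺ proj₁ p)))
        (↭-trans (prep (proj₂ q) rs-cols) (↭-sym (↭.map⁺ proj₂ p)))))

  -- What stands for a minor during the recursion. Columns are bounded through their position in the
  -- order `τ`, and both bounds are inclusive, as for boxes, whereas the arguments of `rk` are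
  -- numbers of rows and columns.
  record Candidate (st : Steps) (τ : Perm) (a b k : ℕ) (m : Monomial) : Set where
    field
      cells       : List Cell
      maximal     : Max st cells
      count       : length cells ≡ k
      rows≤       : All (_≤ a) (rows cells)
      cols≤       : All (λ β → from τ β ≤ b) (cols cells)
      unique-rows : Unique (rows cells)
      unique-cols : Unique (cols cells)
      divides     : ∀ c d → wt cells c d ≤ m c d

  module _ {τ st} (j : ℕ) (W : Word (swapped j τ) st)
           (p<q : to u (to τ (suc j)) < to u (to τ j))
           (later : ∀ k → suc j < k → to u (to τ (suc j)) < to u (to τ k)) where
    private
      p βʸ βᵉ : ℕ
      p  = to u (to τ (suc j))
      βʸ = to τ j
      βᵉ = to τ (suc j)
      y : Cell
      y = p , βʸ
      st⁺ : Steps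
      st⁺ = (j , y) ∷ st

      βᵉ≢βʸ : βᵉ ≢ βʸ
      βᵉ≢βʸ e = ℕ.1+n≢n (injective τ e)

      fresh : y ∉ labels st
      fresh y∈ = ℕ.<-asym (ℕ.n<1+n j) (subst₂ _<_
        (trans (cong (sw j) (from-to τ j)) (sw-j j))
        (trans (cong (sw j) (trans (cong (from τ) (from-to u _)) (from-to τ _))) (sw-1+j j))
        (proj₂ (label⇒ W y∈)))

      -- Column j+1 of the chart is the unit vector in row p.
      unit-column : ∀ {a} → Nz st⁺ (a , βᵉ) → a ≡ p
      unit-column (inj₁ e) = e
      unit-column (inj₂ (here e)) = ⊥-elim (βᵉ≢βʸ (cong proj₂ e))
      unit-column {a} (inj₂ (there a∈)) with label⇒ W a∈
      ... | a<p , lt with ℕ.<-cmp i (suc j)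
        where
        i : ℕ
        i = from τ (from u a)
      ...   | tri> _ _ j<i = ⊥-elim (ℕ.<-asym a<p (subst (p <_) (value τ a) (later _ j<i)))
      ...   | tri≈ _ e _   = ⊥-elim (ℕ.<-irrefl (trans (sym (value τ a)) (cong (to u ∘ to τ) e)) a<p)
      ...   | tri< i≤j _ _ with ℕ.m≤n⇒m<n∨m≡n (ℕ.s≤s⁻¹ i≤j)
      ...     | inj₂ e   = ⊥-elim (ℕ.<-asym a<p (subst (p <_) (trans (sym (cong (to u ∘ to τ) e)) (value τ a)) p<q))
      ...     | inj₁ i<j = ⊥-elim (ℕ.<-asym i<j (subst₂ _<_
                  (trans (cong (sw j) (from-to τ (suc j))) (sw-1+j j))
                  (sw-else j (ℕ.<⇒≢ i<j) (ℕ.<⇒≢ i≤j)) lt))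

      unit-cell : ∀ {qs} → All (Nz st⁺) qs → βᵉ ∈ cols qs → (p , βᵉ) ∈ qs
      unit-cell nz β∈ with ∈-map⁻ proj₂ β∈
      ... | (a , _) , q∈ , refl with unit-column (All.lookup nz q∈)
      ...   | refl = q∈

      weaken : ∀ {qs} → All (Nz st) qs → All (Nz st⁺) qs
      weaken = All.map (Sum.map₂ there)

      strengthen : ∀ {qs} → y ∉ qs → All (Nz st⁺) qs → All (Nz st) qs
      strengthen y∉ nz = All.tabulate λ q∈ → strip (All.lookup nz q∈) q∈
        where
        strip : ∀ {q} → Nz st⁺ q → q ∈ _ → Nz st q
        strip (inj₁ e)           _  = inj₁ e
        strip (inj₂ (here refl)) q∈ = ⊥-elim (y∉ q∈)
        strip (inj₂ (there l))   _  = inj₂ l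

      y∉valid : ∀ {qs} → All (Nz st) qs → y ∉ qs
      y∉valid nz y∈ with All.lookup nz y∈
      ... | inj₁ e = ℕ.<⇒≢ p<q e
      ... | inj₂ l = fresh l

      -- If no term of the minor can contain the new variable, its terms are those of the smaller
      -- chart and maximality carries over. The next lemmas list three obstructions to y: its row is
      -- missing, its column is missing, or the unit column is present and takes its row.
      Avoids : List Cell → Set
      Avoids ps = ∀ qs → All (Nz st⁺) qs → rows qs ↭ rows ps → cols qs ↭ cols ps → y ∉ qs

      max-extend : ∀ {ps} → Max st ps → Avoids ps → Max st⁺ ps
      max-extend {ps} (nz , max) avoids = weaken nz , λ qs nz-qs r c →
        let y∉qs = avoids qs nz-qs r c in
        inj₂ (trans (wt-absent y∉qs) (sym (wt-absent (y∉valid nz))) , max qs (strengthen y∉qs nz-qs) r c)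

      avoids-row : ∀ {ps} → p ∉ rows ps → Avoids ps
      avoids-row p∉ qs _ r _ y∈ = p∉ (↭.∈-resp-↭ r (∈-map⁺ proj₁ y∈))

      avoids-col : ∀ {ps} → βʸ ∉ cols ps → Avoids ps
      avoids-col βʸ∉ qs _ _ c y∈ = βʸ∉ (↭.∈-resp-↭ c (∈-map⁺ proj₂ y∈))

      avoids-unit : ∀ {ps} → Unique (rows ps) → βᵉ ∈ cols ps → Avoids ps
      avoids-unit uniq βᵉ∈ qs nz r c y∈ = βᵉ≢βʸ (cong proj₂ (unique-image proj₁ (unique-↭ (↭-sym r) uniq)
        (unit-cell nz (↭.∈-resp-↭ (↭-sym c) βᵉ∈)) y∈ refl))

      -- Every competitor contains the cell of the unit column. Removing it uses up row p, so y
      -- cannot occur among the remaining cells.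
      max-trade : ∀ {ps} → Max st ps → Unique (p ∷ rows ps) → Max st⁺ ((p , βᵉ) ∷ ps)
      max-trade {ps} (nz , max) (p∉ ∷ uniq) = inj₁ refl ∷ weaken nz , λ qs nz-qs r c → bound qs nz-qs r c
        where
        bound : ∀ qs → All (Nz st⁺) qs → rows qs ↭ p ∷ rows ps → cols qs ↭ βᵉ ∷ cols ps →
                LexLe st⁺ (wt qs) (wt ((p , βᵉ) ∷ ps))
        bound qs nz-qs r c with extract (unit-cell nz-qs (↭.∈-resp-↭ (↭-sym c) (here refl)))
        ... | qs′ , π = LexLe-resp st⁺ (λ c d → sym (wt-qs c d)) (λ c d → cong (_+ wt ps c d) (sym (weight-graph c d refl)))
            (inj₂ (trans (wt-absent y∉qs′) (sym (wt-absent (y∉valid nz))) ,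
              max qs′ (strengthen y∉qs′ (All.tail (↭.All-resp-↭ π nz-qs))) r′ (↭.drop-∷ (↭-trans (↭-sym (↭.map⁺ proj₂ π)) c))))
          where
          r′ : rows qs′ ↭ rows ps
          r′ = ↭.drop-∷ (↭-trans (↭-sym (↭.map⁺ proj₁ π)) r)
          y∉qs′ : y ∉ qs′
          y∉qs′ y∈ = All.All¬⇒¬Any p∉ (↭.∈-resp-↭ r′ (∈-map⁺ proj₁ y∈))
          wt-qs : ∀ c d → wt qs c d ≡ wt qs′ c d
          wt-qs c d = trans (wt-↭ π c d) (cong (_+ wt qs′ c d) (weight-graph c d refl))

      -- A competitor without y is smaller in the largest variable. One with y becomes a competitor
      -- in the smaller chart when y is replaced by the entry 1 of the unit column.
      max-variable : ∀ {ps} → Max st ((p , βᵉ) ∷ ps) → Unique (p ∷ rows ps) → Max st⁺ (y ∷ ps)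
      max-variable {ps} (_ ∷ nz , max) (p∉ ∷ uniq) = inj₂ (here refl) ∷ weaken nz , λ qs nz-qs r c → bound qs nz-qs r c (y ∈? qs)
        where
        open DecMembership (Product.≡-dec ℕ._≟_ ℕ._≟_) using (_∈?_)
        p≢uβʸ : p ≢ to u βʸ
        p≢uβʸ = ℕ.<⇒≢ p<q
        at-y : wt (y ∷ ps) p βʸ ≡ 1
        at-y = cong₂ _+_ (weight-self p≢uβʸ) (wt-absent (y∉valid nz))
        bound : ∀ qs → All (Nz st⁺) qs → rows qs ↭ p ∷ rows ps → cols qs ↭ βʸ ∷ cols ps → Dec (y ∈ qs) →
                LexLe st⁺ (wt qs) (wt (y ∷ ps))
        bound qs nz-qs r c (no y∉) = inj₁ (subst₂ _<_ (sym (wt-absent y∉)) (sym at-y) (s≤s z≤n))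
        bound qs nz-qs r c (yes y∈) with extract y∈
        ... | qs′ , π = inj₂ (trans (wt-↭ π p βʸ) (trans (cong₂ _+_ (weight-self p≢uβʸ) (wt-absent y∉qs′)) (sym at-y)) ,
            LexLe-resp st (λ c d → sym (wt-↭ π c d)) (λ _ _ → refl) (LexLe-add st (weight y) (wt qs′) (wt ps)
              (LexLe-cancel st (weight (p , βᵉ)) (wt qs′) (wt ps) (max ((p , βᵉ) ∷ qs′)
                (inj₁ refl ∷ strengthen y∉qs′ (All.tail (↭.All-resp-↭ π nz-qs)))
                (prep p r′) (prep βᵉ (↭.drop-∷ (↭-trans (↭-sym (↭.map⁺ proj₂ π)) c)))))))
          where
          r′ : rows qs′ ↭ rows ps
          r′ = ↭.drop-∷ (↭-trans (↭-sym (↭.map⁺ proj₁ π)) r)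
          y∉qs′ : y ∉ qs′
          y∉qs′ y∈ = All.All¬⇒¬Any p∉ (↭.∈-resp-↭ r′ (∈-map⁺ proj₁ y∈))

      -- The first b + 1 columns are the same set before and after the exchange unless it crosses
      -- their edge, that is unless b is j.
      region : ∀ {b i} → b ≢ j → sw j i ≤ b → i ≤ b
      region {b} {i} b≢j le with i ℕ.≟ j | i ℕ.≟ suc j
      ... | yes refl | _        = ℕ.≤-trans (ℕ.n≤1+n j) (subst (_≤ b) (sw-j j) le)
      ... | no _     | yes refl = ℕ.≤∧≢⇒< (subst (_≤ b) (sw-1+j j) le) (b≢j ∘ sym)
      ... | no ≢j    | no ≢1+j  = subst (_≤ b) (sw-else j ≢j ≢1+j) le

      open DecMembership ℕ._≟_ using (_∈?_)

    nz-unit-column : ∀ {a} → Nz st⁺ (a , βᵉ) → a ≡ p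
    nz-unit-column = unit-column

    label-fresh : y ∉ labels st
    label-fresh = fresh

    lift-candidate : ∀ {a b k m} → b ≢ j → Candidate st (swapped j τ) a b k m → Candidate st⁺ τ a b k m
    lift-candidate {a} {b} {k} {m} b≢j cand = decide (p ∈? rows cells) (βʸ ∈? cols cells) (βᵉ ∈? cols cells)
      where
      open Candidate cand
      keep : Avoids cells → Candidate st⁺ τ a b k m
      keep avoids = record
        { cells = cells ; maximal = max-extend maximal avoids ; count = count ; rows≤ = rows≤
        ; cols≤ = All.map (region b≢j) cols≤ ; unique-rows = unique-rows ; unique-cols = unique-cols ; divides = divides }
      decide : Dec (p ∈ rows cells) → Dec (βʸ ∈ cols cells) → Dec (βᵉ ∈ cols cells) → Candidate st⁺ τ a b k m
      decide (no p∉) _ _ = keep (avoids-row p∉)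
      decide (yes _) (no βʸ∉) _ = keep (avoids-col βʸ∉)
      decide (yes _) (yes _) (yes βᵉ∈) = keep (avoids-unit unique-rows βᵉ∈)
      -- Here a term through y might exceed the given one. The cell in row p, whatever its column,
      -- is replaced by the entry 1 of the unit column: the weight can only drop, and y is excluded
      -- from the new minor. Column `βᵉ` is allowed because `βʸ`, which takes its place in the
      -- exchanged order, was.
      decide (yes p∈) (yes βʸ∈) (no βᵉ∉) with ∈-map⁻ proj₁ p∈
      ... | q , q∈ , refl with extract q∈
      ...   | ps , π = record
        { cells = (p , βᵉ) ∷ ps
        ; maximal = max-trade (max-delete maximal π) uniq
        ; count = trans (sym (↭.↭-length π)) count
        ; rows≤ = ↭.All-resp-↭ (↭.map⁺ proj₁ π) rows≤
        ; cols≤ = subst (_≤ b) (sym (from-to τ (suc j)))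
                    (subst (_≤ b) (trans (cong (sw j) (from-to τ j)) (sw-j j)) (All.lookup cols≤ βʸ∈))
                  ∷ All.map (region b≢j) (All.tail (↭.All-resp-↭ (↭.map⁺ proj₂ π) cols≤))
        ; unique-rows = uniq
        ; unique-cols = All.tabulate (λ β∈ e → βᵉ∉ (↭.∈-resp-↭ (↭-sym (↭.map⁺ proj₂ π)) (there (subst (_∈ cols ps) (sym e) β∈))))
                        ∷ AllPairs.tail (unique-↭ (↭.map⁺ proj₂ π) unique-cols)
        ; divides = λ c d → ℕ.≤-trans (ℕ.≤-reflexive (cong (_+ wt ps c d) (weight-graph c d refl)))
            (ℕ.≤-trans (ℕ.m≤n+m (wt ps c d) (weight q c d)) (ℕ.≤-trans (ℕ.≤-reflexive (sym (wt-↭ π c d))) (divides c d)))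
        }
        where
        uniq : Unique (p ∷ rows ps)
        uniq = unique-↭ (↭.map⁺ proj₁ π) unique-rows

    -- Positions up to j in the exchanged order may use the unit column but not column `βʸ`. If the
    -- unit column is used, its entry 1 is turned into y, which the exponent of `m` permits.
    lift-variable : ∀ {a k m} → 1 ≤ m p βʸ → Candidate st (swapped j τ) a j k m → Candidate st⁺ τ a j k m
    lift-variable {a} {k} {m} 1≤m cand = decide (βᵉ ∈? cols cells)
      where
      open Candidate cand
      strict : ∀ {β} → β ≢ βᵉ → sw j (from τ β) ≤ j → from τ β < j
      strict {β} ≢ le with from τ β ℕ.≟ j | from τ β ℕ.≟ suc j
      ... | yes e | _     = ⊥-elim (ℕ.<-irrefl refl (subst (_≤ j) (trans (cong (sw j) e) (sw-j j)) le))
      ... | no _  | yes e = ⊥-elim (≢ (trans (sym (to-from τ β)) (cong (to τ) e)))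
      ... | no ≢j | no ≢1+j = ℕ.≤∧≢⇒< (subst (_≤ j) (sw-else j ≢j ≢1+j) le) ≢j
      decide : Dec (βᵉ ∈ cols cells) → Candidate st⁺ τ a j k m
      decide (no βᵉ∉) = record
        { cells = cells ; maximal = max-extend maximal (avoids-col βʸ∉) ; count = count ; rows≤ = rows≤
        ; cols≤ = All.tabulate (λ β∈ → ℕ.<⇒≤ (small β∈)) ; unique-rows = unique-rows ; unique-cols = unique-cols ; divides = divides }
        where
        small : ∀ {β} → β ∈ cols cells → from τ β < j
        small β∈ = strict (λ e → βᵉ∉ (subst (_∈ cols cells) e β∈)) (All.lookup cols≤ β∈)
        βʸ∉ : βʸ ∉ cols cells
        βʸ∉ β∈ = ℕ.<-irrefl (from-to τ j) (small β∈)
      decide (yes βᵉ∈) with extract (unit-cell (weaken (proj₁ maximal)) βᵉ∈)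
      ... | ps , π = record
        { cells = y ∷ ps
        ; maximal = max-variable max-π uniq
        ; count = trans (sym (↭.↭-length π)) count
        ; rows≤ = ↭.All-resp-↭ (↭.map⁺ proj₁ π) rows≤
        ; cols≤ = ℕ.≤-reflexive (from-to τ j) ∷ All.tabulate (λ β∈ → ℕ.<⇒≤ (small β∈))
        ; unique-rows = uniq
        ; unique-cols = All.tabulate (λ β∈ e → ℕ.<-irrefl (from-to τ j) (small (subst (_∈ cols ps) (sym e) β∈)))
                        ∷ AllPairs.tail uniqᶜ
        ; divides = bound
        }
        where
        uniq : Unique (p ∷ rows ps)
        uniq = unique-↭ (↭.map⁺ proj₁ π) unique-rows
        uniqᶜ : Unique (βᵉ ∷ cols ps)
        uniqᶜ = unique-↭ (↭.map⁺ proj₂ π) unique-cols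
        max-π : Max st ((p , βᵉ) ∷ ps)
        max-π = ↭.All-resp-↭ π (proj₁ maximal) , λ qs nz r c → LexLe-resp st (λ _ _ → refl) (wt-↭ π)
          (proj₂ maximal qs nz (↭-trans r (↭-sym (↭.map⁺ proj₁ π))) (↭-trans c (↭-sym (↭.map⁺ proj₂ π))))
        small : ∀ {β} → β ∈ cols ps → from τ β < j
        small β∈ = strict (λ { refl → All.All¬⇒¬Any (AllPairs.head uniqᶜ) β∈ }) (All.lookup (All.tail (↭.All-resp-↭ (↭.map⁺ proj₂ π) cols≤)) β∈)
        y∉ps : y ∉ ps
        y∉ps = y∉valid (All.tail (proj₁ max-π))
        bound : ∀ c d → weight y c d + wt ps c d ≤ m c d
        bound c d with Product.≡-dec ℕ._≟_ ℕ._≟_ y (c , d)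
        ... | yes refl = ℕ.≤-trans (ℕ.≤-reflexive (cong₂ _+_ (weight-self (ℕ.<⇒≢ p<q)) (wt-absent y∉ps))) 1≤m
        ... | no y≢ = ℕ.≤-trans (ℕ.≤-reflexive (cong (_+ wt ps c d) (weight-other y≢)))
            (ℕ.≤-trans (ℕ.m≤n+m (wt ps c d) (weight (p , βᵉ) c d)) (ℕ.≤-trans (ℕ.≤-reflexive (sym (wt-↭ π c d))) (divides c d)))

    -- One cell may be dropped. It is taken from the unit column if possible, otherwise from column
    -- `βʸ`; either choice, like the absence of both columns, excludes y and leaves only positions
    -- up to j.
    lift-smaller : ∀ {a k m} → Candidate st (swapped j τ) a (suc j) (suc k) m → Candidate st⁺ τ a j k m
    lift-smaller {a} {k} {m} cand = decide (βᵉ ∈? cols cells) (βʸ ∈? cols cells)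
      where
      open Candidate cand
      ≤j : ∀ {β} → β ≢ βᵉ → sw j (from τ β) ≤ suc j → from τ β ≤ j
      ≤j {β} ≢ le = ℕ.s≤s⁻¹ (ℕ.≤∧≢⇒< (region ℕ.1+n≢n le) (λ e → ≢ (trans (sym (to-from τ β)) (cong (to τ) e))))
      delete : ∀ {q ps} → cells ↭ q ∷ ps → Avoids ps → βᵉ ∉ cols ps → Candidate st⁺ τ a j k m
      delete {q} {ps} π avoids βᵉ∉ = record
        { cells = ps
        ; maximal = max-extend (max-delete maximal π) avoids
        ; count = ℕ.suc-injective (trans (sym (↭.↭-length π)) count)
        ; rows≤ = All.tail (↭.All-resp-↭ (↭.map⁺ proj₁ π) rows≤)
        ; cols≤ = All.tabulate (λ β∈ → ≤j (λ e → βᵉ∉ (subst (_∈ cols ps) e β∈))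
                    (All.lookup (All.tail (↭.All-resp-↭ (↭.map⁺ proj₂ π) cols≤)) β∈))
        ; unique-rows = AllPairs.tail (unique-↭ (↭.map⁺ proj₁ π) unique-rows)
        ; unique-cols = AllPairs.tail (unique-↭ (↭.map⁺ proj₂ π) unique-cols)
        ; divides = λ c d → ℕ.≤-trans (ℕ.m≤n+m (wt ps c d) (weight q c d)) (ℕ.≤-trans (ℕ.≤-reflexive (sym (wt-↭ π c d))) (divides c d))
        }
      removed : ∀ {q ps β} → cells ↭ q ∷ ps → β ∉ cols cells → β ∉ cols ps
      removed π β∉ β∈ = β∉ (↭.∈-resp-↭ (↭-sym (↭.map⁺ proj₂ π)) (there β∈))
      decide : Dec (βᵉ ∈ cols cells) → Dec (βʸ ∈ cols cells) → Candidate st⁺ τ a j k m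
      decide (yes βᵉ∈) _ with extract (unit-cell (weaken (proj₁ maximal)) βᵉ∈)
      ... | ps , π = delete π (avoids-row (All.All¬⇒¬Any (AllPairs.head (unique-↭ (↭.map⁺ proj₁ π) unique-rows))))
                              (All.All¬⇒¬Any (AllPairs.head (unique-↭ (↭.map⁺ proj₂ π) unique-cols)))
      decide (no βᵉ∉) (yes βʸ∈) with ∈-map⁻ proj₂ βʸ∈
      ... | q , q∈ , refl with extract q∈
      ...   | ps , π = delete π (avoids-col (All.All¬⇒¬Any (AllPairs.head (unique-↭ (↭.map⁺ proj₂ π) unique-cols)))) (removed π βᵉ∉)
      decide (no βᵉ∉) (no βʸ∉) with cells in eq
      ... | []     = ⊥-elim (ℕ.0≢1+n (trans (cong length (sym eq)) count))
      ... | q ∷ ps = delete π (avoids-col (βʸ∉ ∘ there)) (βᵉ∉ ∘ there)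
        where
        π : cells ↭ q ∷ ps
        π = subst (cells ↭_) eq ↭-refl

  Reached : Steps → Perm → Perm → Monomial → Set
  Reached st τ π m = ∃₂ λ a b → InDiagram π a b × Candidate st τ a b (suc (rk (to π) (suc a) (suc b))) m

  -- At a column without inversion, boxes of the diagram can be moved to the right with the same rank.
  avoid-column : ∀ {st τ π m} j → ¬ Inv j (to π) →
    Reached st τ π m → ∃₂ λ a b → b ≢ j × InDiagram π a b × Candidate st τ a b (suc (rk (to π) (suc a) (suc b))) m
  avoid-column {st} {τ} {π} {m} j ¬inv (a , b , box@(a<to , b<from) , cand) with b ℕ.≟ j
  ... | no b≢ = a , b , b≢ , box , cand
  ... | yes refl = a , suc b , ℕ.1+n≢n , (a<to′ , ℕ.≤∧≢⇒< b<from (λ e → ℕ.<⇒≢ a<to′ (trans (sym (to-from π a)) (cong (to π) (sym e))))) , record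
        { cells = cells ; maximal = maximal ; count = trans count (cong (λ z → suc (z + rk (to π) (suc a) (suc j))) (sym ([<]-no a<to′)))
        ; rows≤ = rows≤ ; cols≤ = All.map ℕ.m≤n⇒m≤1+n cols≤ ; unique-rows = unique-rows ; unique-cols = unique-cols ; divides = divides }
    where
    open Candidate cand
    a<to′ : a < to π (suc b)
    a<to′ = ℕ.<-≤-trans a<to (ℕ.≮⇒≥ ¬inv)

  -- Follows the recursion of `Initial`. In the identity chart a box exists because some rank is not
  -- full, and the candidate is the diagonal minor, whose term is 1.
  reached : ∀ {τ st} → Word τ st → ∀ π {m} → Initial st (to π) m → Reached st τ π m
  reached {τ} (nil id) π {m} init with diagram-box π init
  ... | a , b , box@(a<to , b<from) = a , b , box , record
    { cells = cells
    ; maximal = All.map⁺ (All.applyUpTo⁺₁ (λ i → i) k (λ _ → inj₁ (sym (id _)))) , λ _ _ _ _ → _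
    ; count = trans (length-map diagonal (applyUpTo (λ i → i) k)) (length-applyUpTo (λ i → i) k)
    ; rows≤ = subst (All (_≤ a)) (sym rows≡) (All.applyUpTo⁺₁ (λ i → i) k λ i<k → ℕ.s≤s⁻¹ (ℕ.≤-trans i<k (s≤s r≤a)))
    ; cols≤ = subst (All (λ β → from τ β ≤ b)) (sym cols≡) (All.map⁺ (All.applyUpTo⁺₁ (λ i → i) k λ i<k →
        ℕ.≤-trans (ℕ.≤-reflexive (from-to τ _)) (ℕ.s≤s⁻¹ (ℕ.≤-trans i<k (s≤s r≤b)))))
    ; unique-rows = subst Unique (sym rows≡) (Unique.applyUpTo⁺₁ (λ i → i) k λ i<j _ → ℕ.<⇒≢ i<j)
    ; unique-cols = subst Unique (sym cols≡) (Unique.map⁺ (injective τ) (Unique.applyUpTo⁺₁ (λ i → i) k λ i<j _ → ℕ.<⇒≢ i<j))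
    ; divides = λ c d → subst (_≤ m c d) (sym (no-weight (applyUpTo (λ i → i) k) c d)) z≤n
    }
    where
    k : ℕ
    k = suc (rk (to π) (suc a) (suc b))
    r≤a : rk (to π) (suc a) (suc b) ≤ a
    r≤a = ℕ.≤-trans (ℕ.≤-reflexive (rk-diagram π box)) (rank-bounded π a b)
    r≤b : rk (to π) (suc a) (suc b) ≤ b
    r≤b = ℕ.≤-trans (ℕ.≤-reflexive (rk-diagram π box)) (rk≤ (to π) a b)
    diagonal : ℕ → Cell
    diagonal i = i , to τ i
    cells : List Cell
    cells = map diagonal (applyUpTo (λ i → i) k)
    rows≡ : rows cells ≡ applyUpTo (λ i → i) k
    rows≡ = trans (sym (map-∘ (applyUpTo (λ i → i) k))) (map-id _)
    cols≡ : cols cells ≡ map (to τ) (applyUpTo (λ i → i) k)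
    cols≡ = sym (map-∘ (applyUpTo (λ i → i) k))
    no-weight : ∀ is c d → wt (map diagonal is) c d ≡ 0
    no-weight []       c d = refl
    no-weight (i ∷ is) c d = cong₂ _+_ (weight-graph c d (sym (id i))) (no-weight is c d)
  reached {τ} (step {st = st} j W p<q later) π {m} init = split (to π (suc j) <? to π j)
    where
    st⁺ : Steps
    st⁺ = (j , to u (to τ (suc j)) , to τ j) ∷ st
    lift≢ : (∃₂ λ a b → b ≢ j × InDiagram π a b × Candidate st (swapped j τ) a b (suc (rk (to π) (suc a) (suc b))) m) → Reached st⁺ τ π m
    lift≢ (a , b , b≢j , box , cand) = a , b , box , lift-candidate j W p<q later b≢j cand
    split : Dec (Inv j (to π)) → Reached st⁺ τ π m
    split (no ¬inv) = lift≢ (avoid-column {π = π} j ¬inv (reached W π init′))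
      where
      init′ : Initial st (to π) m
      init′ = Sum.[ proj₂ , subst (λ x → Initial st x m) (up-noninv {j} {to π} ¬inv) ] (initial-cases {j} {to u (to τ (suc j))} {to τ j} {st} {to π} {m} init)
    split (yes inv) with initial-cases {j} {to u (to τ (suc j))} {to τ j} {st} {to π} {m} init
    ... | inj₁ (1≤m , init′) with reached W π init′
    ...   | a , b , box , cand with b ℕ.≟ j
    ...     | no b≢j   = lift≢ (a , b , b≢j , box , cand)
    ...     | yes refl = a , b , box , lift-variable b W p<q later 1≤m cand
    -- The exchanged permutation has no inversion at j, so its box can be taken outside column j.
    split (yes inv) | inj₂ init′ with avoid-column {π = swapped j π} j noninv (reached W (swapped j π) (subst (λ x → Initial st x m) (up-inv {j} {to π} inv) init′))
      where
      noninv : ¬ Inv j (to π ∘ sw j)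
      noninv lt = ℕ.<-asym inv (subst₂ _<_ (cong (to π) (sw-1+j j)) (cong (to π) (sw-j j)) lt)
    ...   | a , b , b≢j , (a<to , b<from) , cand with b ℕ.≟ suc j
    ...     | no b≢1+j = lift≢ (a , b , b≢j , (subst (λ z → a < to π z) (sw-else j b≢j b≢1+j) a<to , b<from′) ,
                subst (λ k → Candidate st (swapped j τ) a b (suc k) m) same-rank cand)
      where
      same-rank : rk (to π ∘ sw j) (suc a) (suc b) ≡ rk (to π) (suc a) (suc b)
      same-rank = trans (cong (λ x → rk x (suc a) (suc b)) (sym (up-inv {j} {to π} inv))) (rk-up-≢ (to π) j (suc a) (suc b) (b≢j ∘ ℕ.suc-injective))
      b<from′ : b < from π a
      b<from′ with sw-mono⁻¹ j (subst (_< sw j (from π a)) (sym (sw-else j b≢j b≢1+j)) b<from)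
      ... | inj₁ lt = lt
      ... | inj₂ (e , _) = ⊥-elim (b≢1+j e)
    -- A box of the exchanged permutation in column j + 1 is also one of `π`, unless the dot of `π`
    -- in column j + 1 lies in row a or below. Then (a , j) is a box of `π` and its rank is smaller
    -- by one, which is why a cell is dropped.
    ...     | yes refl with a <? to π (suc j)
    ...       | yes a<to′ = lift≢ (a , suc j , b≢j , (a<to′ , 1+j<from) , subst (λ k → Candidate st (swapped j τ) a (suc j) (suc k) m) same-rank cand)
      where
      same-rank : rk (to π ∘ sw j) (suc a) (suc (suc j)) ≡ rk (to π) (suc a) (suc (suc j))
      same-rank = rk-sw-> (to π) j (suc a) (suc (suc j)) ℕ.≤-refl
      1+j<from : suc j < from π a
      1+j<from with sw-mono⁻¹ j {j} (subst (_< sw j (from π a)) (sym (sw-j j)) b<from)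
      ... | inj₂ (e , _) = ⊥-elim (ℕ.1+n≢n (sym e))
      ... | inj₁ lt = ℕ.≤∧≢⇒< lt λ e → ℕ.<-asym b<from (subst (_< suc j) (sym (trans (cong (sw j) (sym e)) (sw-1+j j))) (ℕ.n<1+n j))
    ...       | no a≮to = a , j , (subst (a <_) (cong (to π) (sw-1+j j)) a<to , j<from) ,
                lift-smaller j W p<q later (subst (λ k → Candidate st (swapped j τ) a (suc j) (suc k) m) rank-drop cand)
      where
      rank-drop : rk (to π ∘ sw j) (suc a) (suc (suc j)) ≡ suc (rk (to π) (suc a) (suc j))
      rank-drop = trans (rk-sw-> (to π) j (suc a) (suc (suc j)) ℕ.≤-refl) (cong (_+ rk (to π) (suc a) (suc j)) ([<]-yes (s≤s (ℕ.≮⇒≥ a≮to))))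
      j<from : j < from π a
      j<from with sw-mono⁻¹ j {j} (subst (_< sw j (from π a)) (sym (sw-j j)) b<from)
      ... | inj₂ (e , _) = ⊥-elim (ℕ.1+n≢n (sym e))
      ... | inj₁ lt = lt

-- Sorting words and the order of the variables

infix 4 _≻_
_≻_ : Cell → Cell → Set
(a , b) ≻ (c , d) = d < b ⊎ (d ≡ b × a < c)

identity : Perm
identity = record
  { to = λ k → k ; from = λ k → k ; to-from = λ _ → refl ; from-to = λ _ → refl ; size = 0 ; fixed = λ _ _ → refl }

size-closed : ∀ π {k} → k < size π → to π k < size π
size-closed π {k} k<n = ℕ.≰⇒> λ n≤ → ℕ.<⇒≱ k<n (subst (size π ≤_) (injective π (fixed π _ n≤)) n≤)

-- The inverse is increasing too, and an increasing map of ℕ moves no index down.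
strictly-increasing⇒id : (f g : ℕ → ℕ) → (∀ k → f (g k) ≡ k) → (∀ k → g (f k) ≡ k) →
  (∀ k l → k < l → f k < f l) → ∀ k → f k ≡ k
strictly-increasing⇒id f g fg gf mono k =
  ℕ.≤-antisym (subst (f k ≤_) (gf k) (expanding g g-mono (f k))) (expanding f mono k)
  where
  expanding : ∀ h → (∀ k l → k < l → h k < h l) → ∀ k → k ≤ h k
  expanding h m zero    = z≤n
  expanding h m (suc k) = ℕ.≤-<-trans (expanding h m k) (m k (suc k) (ℕ.n<1+n k))
  g-mono : ∀ k l → k < l → g k < g l
  g-mono k l k<l with ℕ.<-cmp (g k) (g l)
  ... | tri< lt _ _ = lt
  ... | tri≈ _ e _  = ⊥-elim (ℕ.<⇒≢ k<l (trans (sym (fg k)) (trans (cong f e) (fg l))))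
  ... | tri> _ _ gt = ⊥-elim (ℕ.<-asym k<l (subst₂ _<_ (fg l) (fg k) (mono _ _ gt)))

-- Insertion sort of the values of u from the right: each exchange is a step of the word.
module Sorting (u : Perm) where
  open Chart u

  private
    N : ℕ
    N = size u

  SortedWord : Perm → Set
  SortedWord τ = ∃ λ st → Word τ st × AllPairs _≻_ (labels st)

  record SortedFrom (b : ℕ) (τ : Perm) : Set where
    field
      low    : ∀ k → k < b → to τ k ≡ k
      high   : ∀ k → N ≤ k → to τ k ≡ k
      sorted : ∀ k l → b ≤ k → k < l → to u (to τ k) < to u (to τ l)

  record Inserting (b i : ℕ) (τ : Perm) : Set where
    field
      low     : ∀ k → k < b → to τ k ≡ k
      high    : ∀ k → N ≤ k → to τ k ≡ k
      b≤i     : b ≤ i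
      b<N     : b < N
      current : to τ i ≡ b
      sorted  : ∀ k l → b ≤ k → k < l → k ≢ i → l ≢ i → to u (to τ k) < to u (to τ l)
      passed  : ∀ k → b ≤ k → k < i → to u (to τ k) < to u (to τ i)

  inserted : ∀ {b i τ} → Inserting b i τ → ¬ to u (to τ (suc i)) < to u (to τ i) → SortedFrom b τ
  inserted {b} {i} {τ} ins ≮ = record { low = low ; high = high ; sorted = sorted′ }
    where
    open Inserting ins
    next : to u (to τ i) < to u (to τ (suc i))
    next = ℕ.≤∧≢⇒< (ℕ.≮⇒≥ ≮) (λ e → ℕ.1+n≢n (sym (injective τ (injective u e))))
    sorted′ : ∀ k l → b ≤ k → k < l → to u (to τ k) < to u (to τ l)
    sorted′ k l b≤k k<l with k ℕ.≟ i | l ℕ.≟ i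
    ... | no k≢i   | no l≢i   = sorted k l b≤k k<l k≢i l≢i
    ... | no _     | yes refl = passed k b≤k k<l
    ... | yes refl | _ with ℕ.m≤n⇒m<n∨m≡n k<l
    ...   | inj₂ refl = next
    ...   | inj₁ 1+i<l = ℕ.<-trans next (sorted (suc k) l (ℕ.m≤n⇒m≤1+n b≤k) 1+i<l ℕ.1+n≢n (ℕ.>⇒≢ k<l))

  module _ {b i τ} (ins : Inserting b i τ) (lt : to u (to τ (suc i)) < to u (to τ i)) where
    open Inserting ins
    private
      1+i<N : suc i < N
      -- From position N on the value equals the position, while the value being inserted is below
      -- N; so no exchange happens there.
      1+i<N = ℕ.≰⇒> λ N≤1+i → ℕ.<⇒≱ (size-closed u b<N)
        (ℕ.≤-trans N≤1+i (ℕ.≤-trans (ℕ.≤-reflexive (sym (trans (cong (to u) (high _ N≤1+i)) (fixed u _ N≤1+i))))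
          (ℕ.≤-trans (ℕ.<⇒≤ lt) (ℕ.≤-reflexive (cong (to u) current)))))
      same : ∀ {k} → k ≢ i → k ≢ suc i → to (swapped i τ) k ≡ to τ k
      same k≢i k≢1+i = cong (to τ) (sw-else i k≢i k≢1+i)
      at-i : to (swapped i τ) i ≡ to τ (suc i)
      at-i = cong (to τ) (sw-j i)
      at-1+i : to (swapped i τ) (suc i) ≡ to τ i
      at-1+i = cong (to τ) (sw-1+j i)

    later : ∀ k → suc i < k → to u (to τ (suc i)) < to u (to τ k)
    later k 1+i<k = sorted (suc i) k (ℕ.m≤n⇒m≤1+n b≤i) 1+i<k ℕ.1+n≢n (ℕ.>⇒≢ (ℕ.<-trans (ℕ.n<1+n i) 1+i<k))

    exchanged : Inserting b (suc i) (swapped i τ)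
    exchanged = record
      { low = λ k k<b → let k<i = ℕ.<-≤-trans k<b b≤i in
          trans (same (ℕ.<⇒≢ k<i) (ℕ.<⇒≢ (ℕ.m<n⇒m<1+n k<i))) (low k k<b)
      ; high = λ k N≤k → let 1+i<k = ℕ.<-≤-trans 1+i<N N≤k in
          trans (same (ℕ.>⇒≢ (ℕ.<-trans (ℕ.n<1+n i) 1+i<k)) (ℕ.>⇒≢ 1+i<k)) (high k N≤k)
      ; b≤i = ℕ.m≤n⇒m≤1+n b≤i
      ; b<N = b<N
      ; current = trans at-1+i current
      ; sorted = sorted′
      ; passed = passed′
      }
      where
      sorted′ : ∀ k l → b ≤ k → k < l → k ≢ suc i → l ≢ suc i → to u (to (swapped i τ) k) < to u (to (swapped i τ) l)
      sorted′ k l b≤k k<l k≢ l≢ with k ℕ.≟ i | l ℕ.≟ i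
      ... | no k≢i   | no l≢i   = subst₂ _<_ (cong (to u) (sym (same k≢i k≢))) (cong (to u) (sym (same l≢i l≢)))
                                    (sorted k l b≤k k<l k≢i l≢i)
      ... | no k≢i   | yes refl = subst₂ _<_ (cong (to u) (sym (same k≢i k≢))) (cong (to u) (sym at-i))
                                    (sorted k (suc l) b≤k (ℕ.m<n⇒m<1+n k<l) k≢i ℕ.1+n≢n)
      ... | yes refl | no l≢i   = subst₂ _<_ (cong (to u) (sym at-i)) (cong (to u) (sym (same l≢i l≢)))
                                    (later l (ℕ.≤∧≢⇒< k<l (l≢ ∘ sym)))
      ... | yes refl | yes refl = ⊥-elim (ℕ.<-irrefl refl k<l)
      passed′ : ∀ k → b ≤ k → k < suc i → to u (to (swapped i τ) k) < to u (to (swapped i τ) (suc i))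
      passed′ k b≤k k≤i with ℕ.m≤n⇒m<n∨m≡n (ℕ.s≤s⁻¹ k≤i)
      ... | inj₂ refl = subst₂ _<_ (cong (to u) (sym at-i)) (cong (to u) (sym at-1+i)) lt
      ... | inj₁ k<i  = subst₂ _<_ (cong (to u) (sym (same (ℕ.<⇒≢ k<i) (ℕ.<⇒≢ k≤i)))) (cong (to u) (sym at-1+i)) (passed k b≤k k<i)

    -- The remaining inversions in the inserted column lie in higher rows, because the values still
    -- to be passed are increasing; all others lie in columns further to the left.
    largest : ∀ {st} → Word (swapped i τ) st → All ((to u (to τ (suc i)) , to τ i) ≻_) (labels st)
    largest W = All.tabulate λ {q} q∈ → compare q (label⇒ W q∈)
      where
      open Inserting exchanged using () renaming (low to low′; sorted to sorted′; passed to passed′)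
      compare : ∀ q → InChart (swapped i τ) q → (to u (to τ (suc i)) , to τ i) ≻ q
      compare (a , β) (a<uβ , i₀<i₁) with from (swapped i τ) β <? b
      ... | yes i₀<b = inj₁ (subst (_< to τ i) (trans (sym (low′ _ i₀<b)) (to-from (swapped i τ) β))
                         (subst (from (swapped i τ) β <_) (sym current) i₀<b))
      ... | no  i₀≮b with from (swapped i τ) β ℕ.≟ suc i | from (swapped i τ) (from u a) ℕ.≟ suc i
      ...   | yes e | _ = inj₂ (trans (sym (to-from (swapped i τ) β)) (trans (cong (to (swapped i τ)) e) at-1+i)
                , subst (to u (to τ (suc i)) <_) (trans (cong (to u) (trans (sym (same (ℕ.>⇒≢ (ℕ.<-trans (ℕ.n<1+n i) 1+i<)) (ℕ.>⇒≢ 1+i<))) (to-from (swapped i τ) (from u a)))) (to-from u a)) (later _ 1+i<))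
        where
        1+i< : suc i < from (swapped i τ) (from u a)
        1+i< = subst (_< from (swapped i τ) (from u a)) e i₀<i₁
      ...   | no i₀≢ | yes e = ⊥-elim (ℕ.<-asym a<uβ (subst₂ _<_
                (cong (to u) (to-from (swapped i τ) β))
                (trans (cong (to u ∘ to (swapped i τ)) (sym e)) (trans (cong (to u) (to-from (swapped i τ) _)) (to-from u a)))
                (passed′ _ (ℕ.≮⇒≥ i₀≮b) (subst (from (swapped i τ) β <_) e i₀<i₁))))
      ...   | no i₀≢ | no i₁≢ = ⊥-elim (ℕ.<-asym a<uβ (subst₂ _<_
                (cong (to u) (to-from (swapped i τ) β))
                (trans (cong (to u) (to-from (swapped i τ) _)) (to-from u a))
                (sorted′ _ _ (ℕ.≮⇒≥ i₀≮b) i₀<i₁ i₀≢ i₁≢)))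

    fuel-positive : ¬ N ≤ i
    fuel-positive N≤i = ℕ.<⇒≱ 1+i<N (ℕ.m≤n⇒m≤1+n N≤i)

  insert : ∀ {b} → (∀ τ → SortedFrom b τ → SortedWord τ) →
           ∀ fuel i τ → N ≤ fuel + i → Inserting b i τ → SortedWord τ
  insert rest fuel i τ le ins with to u (to τ (suc i)) <? to u (to τ i)
  insert rest fuel       i τ le ins | no ≮   = rest τ (inserted ins ≮)
  insert rest zero       i τ le ins | yes lt = ⊥-elim (fuel-positive ins lt le)
  insert rest (suc fuel) i τ le ins | yes lt
    with insert rest fuel (suc i) (swapped i τ) (subst (N ≤_) (sym (ℕ.+-suc fuel i)) le) (exchanged ins lt)
  ... | st , W , sorted = _ , step i W lt (later ins lt) , largest ins lt W ∷ sorted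

  -- The rightmost column is inserted first, so its variables head the word, in agreement with the
  -- term order.
  sort-from : ∀ b → b ≤ N → ∀ τ → SortedFrom b τ → SortedWord τ
  sort-from zero    _   τ s = [] , nil (strictly-increasing⇒id (to u ∘ to τ) (from τ ∘ from u)
      (λ k → trans (cong (to u) (to-from τ _)) (to-from u k)) (λ k → trans (cong (from τ) (from-to u _)) (from-to τ k))
      (λ k l → SortedFrom.sorted s k l z≤n)) , []
  sort-from (suc b) b<N τ s = insert (sort-from b (ℕ.<⇒≤ b<N)) N b τ (ℕ.m≤m+n N b) record
    { low = λ k k<b → low k (ℕ.m<n⇒m<1+n k<b)
    ; high = high
    ; b≤i = ℕ.≤-refl
    ; b<N = b<N
    ; current = low b ℕ.≤-refl
    ; sorted = λ k l b≤k k<l k≢b _ → sorted k l (ℕ.≤∧≢⇒< b≤k (k≢b ∘ sym)) k<l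
    ; passed = λ k b≤k k<b → ⊥-elim (ℕ.<⇒≱ k<b b≤k)
    }
    where
    open SortedFrom s

  sorted-word : SortedWord identity
  sorted-word = sort-from N ℕ.≤-refl identity record
    { low = λ _ _ → refl
    ; high = λ _ _ → refl
    ; sorted = λ k l N≤k k<l → subst₂ _<_ (sym (fixed u k N≤k)) (sym (fixed u l (ℕ.≤-trans N≤k (ℕ.<⇒≤ k<l)))) k<l
    }

-- Permutations and Rothe diagrams

bottomSum : (ℕ → ℕ) → ℕ → ℕ
bottomSum g zero    = 0
bottomSum g (suc m) = g 0 + bottomSum (g ∘ suc) m

bottomSum-top : ∀ g m → bottomSum g (suc m) ≡ g m + bottomSum g m
bottomSum-top g zero    = refl
bottomSum-top g (suc m) = trans (cong (g 0 +_) (bottomSum-top (g ∘ suc) m)) (+-exchange (g 0) (g (suc m)) _)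

length-filter-tabulate : ∀ {A : Set} {P : A → Set} (P? : ∀ x → Dec (P x)) m (f : Fin m → A) (g : ℕ → ℕ) →
  (∀ i → P (f i) → g (toℕ i) ≡ 1) → (∀ i → ¬ P (f i) → g (toℕ i) ≡ 0) →
  length (filter P? (tabulate f)) ≡ bottomSum g m
length-filter-tabulate P? zero    f g y n = refl
length-filter-tabulate P? (suc m) f g y n with P? (f zero)
... | yes p = cong₂ _+_ (sym (y zero p)) (length-filter-tabulate P? m (f ∘ suc) (g ∘ suc) (y ∘ suc) (n ∘ suc))
... | no ¬p = cong₂ _+_ (sym (n zero ¬p)) (length-filter-tabulate P? m (f ∘ suc) (g ∘ suc) (y ∘ suc) (n ∘ suc))

module _ {n : ℕ} (v : Permutation′ n) where
  private
    toᵛ fromᵛ : ℕ → ℕ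
    toᵛ k with k <? n
    ... | yes k<n = toℕ (opposite (v ⟨$⟩ʳ fromℕ< k<n))
    ... | no  _   = k
    fromᵛ a with a <? n
    ... | yes a<n = toℕ (v ⟨$⟩ˡ opposite (fromℕ< a<n))
    ... | no  _   = a

    toᵛ-toℕ : ∀ b → toᵛ (toℕ b) ≡ toℕ (opposite (v ⟨$⟩ʳ b))
    toᵛ-toℕ b with toℕ b <? n
    ... | yes lt = cong (λ i → toℕ (opposite (v ⟨$⟩ʳ i))) (Fin.fromℕ<-toℕ b lt)
    ... | no ≮   = ⊥-elim (≮ (Fin.toℕ<n b))

    fromᵛ-toℕ : ∀ a → fromᵛ (toℕ a) ≡ toℕ (v ⟨$⟩ˡ opposite a)
    fromᵛ-toℕ a with toℕ a <? n
    ... | yes lt = cong (λ i → toℕ (v ⟨$⟩ˡ opposite i)) (Fin.fromℕ<-toℕ a lt)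
    ... | no ≮   = ⊥-elim (≮ (Fin.toℕ<n a))

    toᵛ-≮ : ∀ {k} → ¬ k < n → toᵛ k ≡ k
    toᵛ-≮ {k} ≮ with k <? n
    ... | yes lt = ⊥-elim (≮ lt)
    ... | no _   = refl

    fromᵛ-≮ : ∀ {k} → ¬ k < n → fromᵛ k ≡ k
    fromᵛ-≮ {k} ≮ with k <? n
    ... | yes lt = ⊥-elim (≮ lt)
    ... | no _   = refl

  -- The permutation of ℕ taking a column to the row, counted from the bottom, of its entry 1 in Z⁽ᵛ⁾.
  flipped : Perm
  flipped = record
    { to = toᵛ
    ; from = fromᵛ
    ; to-from = to-from′
    ; from-to = from-to′
    ; size = n
    ; fixed = λ k n≤k → toᵛ-≮ (ℕ.≤⇒≯ n≤k)
    }
    where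
    to-from′ : ∀ a → toᵛ (fromᵛ a) ≡ a
    to-from′ a with a <? n
    ... | yes lt = trans (toᵛ-toℕ _) (trans (cong (toℕ ∘ opposite) (Permutation.inverseʳ v))
                     (trans (cong toℕ (Fin.opposite-involutive _)) (Fin.toℕ-fromℕ< lt)))
    ... | no ≮   = toᵛ-≮ ≮
    from-to′ : ∀ b → fromᵛ (toᵛ b) ≡ b
    from-to′ b with b <? n
    ... | yes lt = trans (fromᵛ-toℕ _) (trans (cong (λ i → toℕ (v ⟨$⟩ˡ i)) (Fin.opposite-involutive _))
                     (trans (cong toℕ (Permutation.inverseˡ v)) (Fin.toℕ-fromℕ< lt)))
    ... | no ≮   = fromᵛ-≮ ≮

  to-toℕ : ∀ b → to flipped (toℕ b) ≡ toℕ (opposite (v ⟨$⟩ʳ b))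
  to-toℕ = toᵛ-toℕ

  from-toℕ : ∀ a → from flipped (toℕ a) ≡ toℕ (v ⟨$⟩ˡ opposite a)
  from-toℕ = fromᵛ-toℕ

  InD⇒ : ∀ {a b} → InD v a b → InDiagram flipped (toℕ a) (toℕ b)
  InD⇒ {a} {b} (p , q) = subst (toℕ a <_) (sym (to-toℕ b)) p , subst (toℕ b <_) (sym (from-toℕ a)) q

  ⇒InD : ∀ {a b} → InDiagram flipped (toℕ a) (toℕ b) → InD v a b
  ⇒InD {a} {b} (p , q) = subst (toℕ a <_) (to-toℕ b) p , subst (toℕ b <_) (from-toℕ a) q

  diagram-bounded : ∀ {a b} → InDiagram flipped a b → a < n × b < n
  diagram-bounded {a} {b} (a<to , b<from) with b <? n
  ... | yes b<n = ℕ.<-trans a<to (Fin.toℕ<n _) , b<n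
  ... | no b≮n with a <? n
  ...   | yes a<n = ⊥-elim (b≮n (ℕ.<-trans b<from (Fin.toℕ<n _)))
  ...   | no _    = ⊥-elim (ℕ.<-asym a<to b<from)

  -- Reversing the values turns the condition on `v ⟨$⟩ʳ k` into an upper bound by row a, and a box
  -- (a , b) spans a + 1 rows and b + 1 columns.
  rank-flipped : ∀ a b → rank v a b ≡ rk (to flipped) (suc (toℕ a)) (suc (toℕ b))
  rank-flipped a b = begin
    rank v a b                                                  ≡⟨ length-filter-tabulate P? n (λ i → i) indicator indicator-yes indicator-no ⟩
    bottomSum indicator n                                       ≡⟨ bottomSum-rk n ⟩
    rk x (suc (toℕ a)) (n ℕ.⊓ suc (toℕ b))                       ≡⟨ cong (rk x (suc (toℕ a))) (ℕ.m≥n⇒m⊓n≡n (Fin.toℕ<n b)) ⟩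
    rk x (suc (toℕ a)) (suc (toℕ b))                            ∎
    where
    open ≡.≡-Reasoning
    x : ℕ → ℕ
    x = to flipped
    P : Fin n → Set
    P k = k Fin.≤ b × opposite a Fin.≤ (v ⟨$⟩ʳ k)
    P? : ∀ k → Dec (P k)
    P? k = (k Fin.≤? b) ×-dec (opposite a Fin.≤? (v ⟨$⟩ʳ k))
    indicator : ℕ → ℕ
    indicator k with k <? suc (toℕ b)
    ... | yes _ = [ x k < suc (toℕ a) ]
    ... | no  _ = 0
    flip≤ : ∀ {i j : Fin n} → opposite i Fin.≤ j → opposite j Fin.≤ i
    flip≤ {i} {j} le = subst (toℕ (opposite j) ≤_) (cong toℕ (Fin.opposite-involutive i))
      (subst₂ _≤_ (sym (Fin.opposite-prop j)) (sym (Fin.opposite-prop (opposite i))) (ℕ.∸-monoʳ-≤ n (s≤s le)))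
    indicator-yes : ∀ k → P k → indicator (toℕ k) ≡ 1
    indicator-yes k (k≤b , le) with toℕ k <? suc (toℕ b)
    ... | yes _ = [<]-yes (s≤s (subst (_≤ toℕ a) (sym (to-toℕ k)) (flip≤ {a} le)))
    ... | no ≮  = ⊥-elim (≮ (s≤s k≤b))
    indicator-no : ∀ k → ¬ P k → indicator (toℕ k) ≡ 0
    indicator-no k ¬P with toℕ k <? suc (toℕ b)
    ... | no _  = refl
    ... | yes k≤b = [<]-no (ℕ.≰⇒> λ le → ¬P (ℕ.s≤s⁻¹ k≤b , flip≤ (subst (_≤ toℕ a) (to-toℕ k) le)))
    bottomSum-rk : ∀ m → bottomSum indicator m ≡ rk x (suc (toℕ a)) (m ℕ.⊓ suc (toℕ b))
    bottomSum-rk zero    = refl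
    bottomSum-rk (suc m) = trans (bottomSum-top indicator m) (trans (cong (indicator m +_) (bottomSum-rk m)) split)
      where
      split : indicator m + rk x (suc (toℕ a)) (m ℕ.⊓ suc (toℕ b)) ≡ rk x (suc (toℕ a)) (suc m ℕ.⊓ suc (toℕ b))
      split with m <? suc (toℕ b)
      ... | yes lt = trans (cong (λ z → [ x m < suc (toℕ a) ] + rk x (suc (toℕ a)) z) (ℕ.m≤n⇒m⊓n≡m (ℕ.<⇒≤ lt)))
                       (cong (rk x (suc (toℕ a))) (sym (ℕ.m≤n⇒m⊓n≡m lt)))
      ... | no ≮ = cong (rk x (suc (toℕ a))) (trans (ℕ.m≥n⇒m⊓n≡n (ℕ.≮⇒≥ ≮)) (sym (ℕ.m≥n⇒m⊓n≡n (ℕ.m≤n⇒m≤1+n (ℕ.≮⇒≥ ≮)))))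

  Essential : ℕ → ℕ → Set
  Essential a b = InDiagram flipped a b × ¬ InDiagram flipped (suc a) b × ¬ InDiagram flipped a (suc b)

  essential⇒ : ∀ {a b} → Essential (toℕ a) (toℕ b) → IsEssential v a b
  essential⇒ {a} {b} (box , ¬up , ¬right) = ⇒InD box
    , (λ a′ e d → ¬up (subst (λ z → InDiagram flipped z (toℕ b)) e (InD⇒ d)))
    , (λ b′ e d → ¬right (subst (InDiagram flipped (toℕ a)) e (InD⇒ d)))

  inDiagram? : ∀ a b → Dec (InDiagram flipped a b)
  inDiagram? a b = (a <? to flipped b) ×-dec (b <? from flipped a)


  -- Moving up or right inside the diagram preserves the rank, so every box is dominated by an essential one.
  essential-above : ∀ {a b} → InDiagram flipped a b → ∃₂ λ a′ b′ → Essential a′ b′ × a ≤ a′ × b ≤ b′ ×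
    rk (to flipped) (suc a′) (suc b′) ≡ rk (to flipped) (suc a) (suc b)
  essential-above {a} {b} box = go (n + n) a b (ℕ.m≤m+n (n + n) (a + b)) box
    where
    x : ℕ → ℕ
    x = to flipped
    go : ∀ fuel a b → n + n ≤ fuel + (a + b) → InDiagram flipped a b → ∃₂ λ a′ b′ → Essential a′ b′ × a ≤ a′ × b ≤ b′ ×
      rk x (suc a′) (suc b′) ≡ rk x (suc a) (suc b)
    go zero a b le box = let a<n , b<n = diagram-bounded box in ⊥-elim (ℕ.<⇒≱ (ℕ.+-mono-< a<n b<n) le)
    go (suc fuel) a b le box with inDiagram? (suc a) b | inDiagram? a (suc b)
    ... | no ¬up | no ¬right = a , b , (box , ¬up , ¬right) , ℕ.≤-refl , ℕ.≤-refl , refl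
    ... | yes up | _ with go fuel (suc a) b (subst (n + n ≤_) (sym (ℕ.+-suc fuel (a + b))) le) up
    ...   | a′ , b′ , ess , a≤ , b≤ , e = a′ , b′ , ess , ℕ.<⇒≤ a≤ , b≤ , trans e
            (trans (rk-row flipped (suc a) (suc b)) (cong (_+ rk x (suc a) (suc b)) ([<]-no (proj₂ up))))
    go (suc fuel) a b le box | no _ | yes right
      with go fuel a (suc b) (subst (n + n ≤_) (sym (trans (cong (fuel +_) (ℕ.+-suc a b)) (ℕ.+-suc fuel (a + b)))) le) right
    ...   | a′ , b′ , ess , a≤ , b≤ , e = a′ , b′ , ess , a≤ , ℕ.<⇒≤ b≤ , trans e
            (cong (_+ rk x (suc a) (suc b)) ([<]-no (proj₁ right)))

-- Monomials of minors

tabulate-extract : ∀ {a} {A : Set a} {k} (C : Fin (suc k) → A) j → tabulate C ↭ C j ∷ tabulate (C ∘ punchIn j)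
tabulate-extract C zero = ↭-refl
tabulate-extract {k = suc k} C (suc j) = ↭-trans (prep (C zero) (tabulate-extract (C ∘ suc) j)) (swap (C zero) (C (suc j)) ↭-refl)

module TermLists {c ℓ} (K : Field c ℓ) (n : ℕ) where
  open Field K hiding (refl; sym; trans; zero; _+_)
  private module F = Field K
  open RingProperties ring using (-0#≈0#; -‿+-comm; -‿involutive)
  open Polynomials K n

  summand : ∀ k → (Fin (suc k) → Fin (suc k) → Poly) → Fin (suc k) → Poly
  summand k M j = alt (toℕ j) (M zero j *ₚ det k (λ r s → M (suc r) (punchIn j s)))

  private
    fold-unique : ∀ {k} (f : List (Fin k) → Poly) X → f [] ≡ [] → (∀ j js → f (j ∷ js) ≡ X j ++ f js) → ∀ js → f js ≡ concatMap X js
    fold-unique f X e e′ []       = e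
    fold-unique f X e e′ (j ∷ js) = trans (e′ j js) (cong (X j ++_) (fold-unique f X e e′ js))

    -- The recursion over columns in det is a local function of Defs; unification recovers it.
    mutual
      unfolded : ∀ k → (Fin (suc k) → Fin (suc k) → Poly) → List (Fin (suc k)) → Poly
      unfolded k M = _

      det-unfold : ∀ k M → det (suc k) M ≡ summand k M zero ++ unfolded k M (tabulate (λ x → suc x))
      det-unfold k M with tabulate {n = k} (λ x → suc x)
      ... | js = refl

  det-suc : ∀ k M → det (suc k) M ≡ concatMap (summand k M) (allFin (suc k))
  det-suc k M = trans (det-unfold k M) (cong (summand k M zero ++_)
    (fold-unique (unfolded k M) (summand k M) refl (λ _ _ → refl) (tabulate (λ x → suc x))))

  module _ {q} {Q : Mon n → Set q} where
    AllMon : Poly → Set _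
    AllMon = All (Q ∘ proj₂)

    allMon-concatMap : ∀ {A : Set} {X : A → Poly} → (∀ j → AllMon (X j)) → ∀ js → AllMon (concatMap X js)
    allMon-concatMap h []       = []
    allMon-concatMap h (j ∷ js) = All.++⁺ (h j) (allMon-concatMap h js)

    allMon-alt : ∀ k {p} → AllMon p → AllMon (alt k p)
    allMon-alt zero    h = h
    allMon-alt (suc k) h = All.map⁺ (allMon-alt k h)

  allMon-* : ∀ {q q₁ q₂} {Q : Mon n → Set q} {Q₁ : Mon n → Set q₁} {Q₂ : Mon n → Set q₂} →
    (∀ {m₁ m₂} → Q₁ m₁ → Q₂ m₂ → Q (m₁ ⊕ₘ m₂)) → ∀ {p p′} → All (Q₁ ∘ proj₂) p → All (Q₂ ∘ proj₂) p′ → All (Q ∘ proj₂) (p *ₚ p′)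
  allMon-* h []         ms′ = []
  allMon-* h (m₁ ∷ ms) ms′ = All.++⁺ (All.map⁺ (All.map (h m₁) ms′)) (allMon-* h ms ms′)

  _≗ₘ_ : Mon n → Mon n → Set
  m ≗ₘ m′ = ∀ a b → m a b ≡ m′ a b

  coeff-++ : ∀ p q m → coeff (p ++ q) m ≈ coeff p m F.+ coeff q m
  coeff-++ []            q m = F.sym (+-identityˡ _)
  coeff-++ ((k , m′) ∷ p) q m with monEq? m′ m
  ... | yes _ = F.trans (+-congˡ (coeff-++ p q m)) (F.sym (+-assoc _ _ _))
  ... | no _  = coeff-++ p q m

  coeff-neg : ∀ p m → coeff (-ₚ p) m ≈ - coeff p m
  coeff-neg []             m = F.sym -0#≈0#
  coeff-neg ((k , m′) ∷ p) m with monEq? m′ m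
  ... | yes _ = F.trans (+-congˡ (coeff-neg p m)) (-‿+-comm _ _)
  ... | no _  = coeff-neg p m

  coeff-absent : ∀ {p m} → All (λ t → ¬ (proj₂ t ≗ₘ m)) p → coeff p m ≈ 0#
  coeff-absent []                      = F.refl
  coeff-absent {(k , m′) ∷ p} {m} (≢ ∷ h) with monEq? m′ m
  ... | yes e = ⊥-elim (≢ e)
  ... | no _  = coeff-absent h

  coeff-≗ : ∀ p {m m′} → m ≗ₘ m′ → coeff p m ≡ coeff p m′
  coeff-≗ []             e = refl
  coeff-≗ ((k , m₀) ∷ p) {m} {m′} e with monEq? m₀ m | monEq? m₀ m′
  ... | yes _ | yes _ = cong (k F.+_) (coeff-≗ p e)
  ... | no _  | no _  = coeff-≗ p e
  ... | yes f | no ≢  = ⊥-elim (≢ λ a b → trans (f a b) (e a b))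
  ... | no ≢  | yes f = ⊥-elim (≢ λ a b → trans (f a b) (sym (e a b)))

  coeff-shift : ∀ m₀ p {m m′} → m ≗ₘ (m₀ ⊕ₘ m′) → coeff (((1# , m₀) ∷ []) *ₚ p) m ≈ coeff p m′
  coeff-shift m₀ p {m} {m′} e = F.trans (coeff-++ (map _ p) [] m) (F.trans (+-identityʳ _) (go p))
    where
    go : ∀ p → coeff (map (λ t′ → (1# * proj₁ t′ , m₀ ⊕ₘ proj₂ t′)) p) m ≈ coeff p m′
    go [] = F.refl
    go ((k , m″) ∷ p) with monEq? (m₀ ⊕ₘ m″) m | monEq? m″ m′
    ... | yes _ | yes _ = +-cong (*-identityˡ k) (go p)
    ... | no _  | no _  = go p
    ... | yes f | no ≢  = ⊥-elim (≢ λ a b → ℕ.+-cancelˡ-≡ (m₀ a b) _ _ (trans (f a b) (e a b)))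
    ... | no ≢  | yes f = ⊥-elim (≢ λ a b → trans (cong (m₀ a b +_) (f a b)) (sym (e a b)))

  -- Being 1 or -1 is what survives expansion without cancellation, and it gives a nonzero
  -- coefficient in every characteristic.
  IsSign : Carrier → Set ℓ
  IsSign k = k ≈ 1# ⊎ k ≈ - 1#

  sign-≈ : ∀ {k k′} → k ≈ k′ → IsSign k′ → IsSign k
  sign-≈ e = Sum.map (F.trans e) (F.trans e)

  sign-nonzero : ∀ {k} → IsSign k → ¬ k ≈ 0#
  sign-nonzero (inj₁ e) e′ = 1#≉0# (F.trans (F.sym e) e′)
  sign-nonzero (inj₂ e) e′ = 1#≉0# (F.trans (F.sym (-‿involutive 1#)) (F.trans (-‿cong (F.trans (F.sym e) e′)) -0#≈0#))

  coeff-alt-sign : ∀ k p m → IsSign (coeff p m) → IsSign (coeff (alt k p) m)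
  coeff-alt-sign zero    p m s = s
  coeff-alt-sign (suc k) p m s = sign-≈ (coeff-neg (alt k p) m) (Sum.[ (λ e → inj₂ (-‿cong e)) , (λ e → inj₁ (F.trans (-‿cong e) (-‿involutive 1#))) ] (coeff-alt-sign k p m s))

  coeff-concatMap-sign : ∀ {k} (X : Fin k → Poly) j₀ m → IsSign (coeff (X j₀) m) → (∀ j → j ≢ j₀ → coeff (X j) m ≈ 0#) →
    IsSign (coeff (concatMap X (allFin k)) m)
  coeff-concatMap-sign {k} X j₀ m s z = sign-≈ (only k (λ i → i) j₀ refl (λ _ ≢ → ≢)) s
    where
    all-absent : ∀ l (f : Fin l → Fin k) → (∀ i → f i ≢ j₀) → coeff (concatMap X (tabulate f)) m ≈ 0#
    all-absent zero    f ≢ = F.refl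
    all-absent (suc l) f ≢ = F.trans (coeff-++ (X (f zero)) _ m) (F.trans (+-cong (z _ (≢ zero)) (all-absent l (f ∘ suc) (≢ ∘ suc))) (+-identityˡ 0#))
    only : ∀ l (f : Fin l → Fin k) i → f i ≡ j₀ → (∀ i′ → i′ ≢ i → f i′ ≢ j₀) →
      coeff (concatMap X (tabulate f)) m ≈ coeff (X j₀) m
    only (suc l) f zero e ≢ = F.trans (coeff-++ (X (f zero)) _ m) (F.trans
      (+-cong (F.reflexive (cong (λ j → coeff (X j) m) e)) (all-absent l (f ∘ suc) (λ i → ≢ (suc i) λ ()))) (+-identityʳ _))
    only (suc l) f (suc i) e ≢ = F.trans (coeff-++ (X (f zero)) _ m) (F.trans
      (+-cong (z _ (≢ zero λ ())) (only l (f ∘ suc) i e (λ i′ i′≢ → ≢ (suc i′) (i′≢ ∘ Fin.suc-injective)))) (+-identityˡ _))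

module Matchings {c ℓ} (K : Field c ℓ) {n : ℕ} (v : Permutation′ n)
                 {st : Steps} (W : Chart.Word (flipped v) identity st) where
  open Field K using (_≈_; 0#; 1#; -_)
  open Polynomials K n
  open TermLists K n
  private
    u : Perm
    u = flipped v
  open Chart u

  infix 4 _∼_
  _∼_ : Mon n → Monomial → Set
  m ∼ M = ∀ a b → m a b ≡ M (toℕ a) (toℕ b)

  cell : Fin n → Fin n → Cell
  cell a b = toℕ a , toℕ b

  graph⇒ : ∀ {a b} → a ≡ opposite (v ⟨$⟩ʳ b) → toℕ a ≡ to u (toℕ b)
  graph⇒ {b = b} e = trans (cong toℕ e) (sym (to-toℕ v b))

  ⇒graph : ∀ {a b} → toℕ a ≡ to u (toℕ b) → a ≡ opposite (v ⟨$⟩ʳ b)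
  ⇒graph {b = b} e = Fin.toℕ-injective (trans e (to-toℕ v b))

  label⇔ : ∀ {a b} → (cell a b ∈ labels st → InD v a b) × (InD v a b → cell a b ∈ labels st)
  label⇔ = (⇒InD v ∘ label⇒ W) , (⇒label W ∘ InD⇒ v)

  data Entry (a b : Fin n) : Poly → Set c where
    zero-entry : ¬ Nz st (cell a b) → Entry a b []
    term-entry : ∀ m → Nz st (cell a b) → m ∼ weight (cell a b) → Entry a b ((1# , m) ∷ [])

  var-entry : ∀ a b → Nz st (cell a b) → ¬ a ≡ opposite (v ⟨$⟩ʳ b) → Entry a b (var a b)
  var-entry a b nz off = term-entry _ nz pointwise
    where
    first : Poly → Mon n
    first []      = 1ₘ
    first (t ∷ _) = proj₂ t
    pointwise : first (var a b) ∼ weight (cell a b)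
    pointwise c d with a Fin.≟ c | b Fin.≟ d
    ... | yes refl | yes refl = sym (weight-self (off ∘ ⇒graph))
    ... | no ≢     | _        = sym (weight-other (λ e → ≢ (Fin.toℕ-injective (cong proj₁ e))))
    ... | yes _    | no ≢     = sym (weight-other (λ e → ≢ (Fin.toℕ-injective (cong proj₂ e))))

  entry : ∀ a b → Entry a b (Z v a b)
  entry a b with a Fin.≟ opposite (v ⟨$⟩ʳ b)
  ... | yes e = term-entry 1ₘ (inj₁ (graph⇒ e)) (λ c d → sym (weight-graph (toℕ c) (toℕ d) (graph⇒ e)))
  ... | no off with InD? v a b
  ...   | yes d  = var-entry a b (inj₂ (proj₂ label⇔ d)) off
  ...   | no ¬d = zero-entry Sum.[ off ∘ ⇒graph , ¬d ∘ proj₁ label⇔ ]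

  Matching : ∀ {k} → (Fin k → Fin n) → (Fin k → Fin n) → List Cell → Set
  Matching R C qs = All (Nz st) qs × rows qs ↭ tabulate (toℕ ∘ R) × cols qs ↭ tabulate (toℕ ∘ C)

  matrixᶻ : ∀ {k} → (Fin k → Fin n) → (Fin k → Fin n) → Fin k → Fin k → Poly
  matrixᶻ R C s t = Z v (R s) (C t)

  private
    Weighs : ∀ {k} → (Fin k → Fin n) → (Fin k → Fin n) → Mon n → Set
    Weighs R C m = ∃ λ qs → Matching R C qs × m ∼ wt qs

    EntryMon : Fin n → Fin n → Mon n → Set
    EntryMon a b m = Nz st (cell a b) × m ∼ weight (cell a b)

    entry-mon : ∀ a b → All (EntryMon a b ∘ proj₂) (Z v a b)
    entry-mon a b with Z v a b | entry a b
    ... | .[] | zero-entry _ = []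
    ... | ._  | term-entry m nz e = (nz , e) ∷ []

    extend : ∀ {k} (R : Fin (suc k) → Fin n) (C : Fin (suc k) → Fin n) j {qs} → Nz st (cell (R zero) (C j)) →
      Matching (R ∘ suc) (C ∘ punchIn j) qs → Matching R C (cell (R zero) (C j) ∷ qs)
    extend R C j nz (nzs , r , c) = nz ∷ nzs , prep _ r , ↭-trans (prep _ c) (↭-sym (tabulate-extract (toℕ ∘ C) j))

  det-terms : ∀ k (R C : Fin k → Fin n) → All (Weighs R C ∘ proj₂) (det k (matrixᶻ R C))
  -- Keeps the cell of the first row, by which `det-coeff` tells the summands of an expansion apart.
  summand-terms : ∀ k (R C : Fin (suc k) → Fin n) j →
    All ((λ m → ∃ λ qs → Matching R C (cell (R zero) (C j) ∷ qs) × m ∼ wt (cell (R zero) (C j) ∷ qs)) ∘ proj₂) (summand k (matrixᶻ R C) j)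
  det-terms zero R C = ([] , ([] , ↭-refl , ↭-refl) , λ _ _ → refl) ∷ []
  det-terms (suc k) R C = subst (All (Weighs R C ∘ proj₂)) (sym (det-suc k (matrixᶻ R C)))
    (allMon-concatMap (λ j → All.map (λ (qs , M , e) → _ ∷ qs , M , e) (summand-terms k R C j)) (allFin (suc k)))
  summand-terms k R C j = allMon-alt (toℕ j) (allMon-* combine (entry-mon (R zero) (C j)) (det-terms k (R ∘ suc) (C ∘ punchIn j)))
    where
    combine : ∀ {m₁ m₂} → EntryMon (R zero) (C j) m₁ → Weighs (R ∘ suc) (C ∘ punchIn j) m₂ →
      ∃ λ qs → Matching R C (cell (R zero) (C j) ∷ qs) × (m₁ ⊕ₘ m₂) ∼ wt (cell (R zero) (C j) ∷ qs)
    combine (nz , e₁) (qs , M , e₂) = qs , extend R C j nz M , λ a b → cong₂ _+_ (e₁ a b) (e₂ a b)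

  wt-support : ∀ {qs c d} → All (Nz st) qs → (c , d) ∉ labels st → wt qs c d ≡ 0
  wt-support {[]}          []         _ = refl
  wt-support {q ∷ qs} {c} {d} (nz ∷ nzs) ∉ = cong₂ _+_ (head-zero nz) (wt-support nzs ∉)
    where
    head-zero : Nz st q → weight q c d ≡ 0
    head-zero (inj₁ e) = weight-graph c d e
    head-zero (inj₂ l) = weight-other λ { refl → ∉ l }

  wt-present : ∀ {qs a β} → a ≢ to u β → (a , β) ∈ qs → 1 ≤ wt qs a β
  wt-present off (here refl) = ℕ.≤-trans (ℕ.≤-reflexive (sym (weight-self off))) (ℕ.m≤m+n _ _)
  wt-present off (there q∈)  = ℕ.≤-trans (wt-present off q∈) (ℕ.m≤n+m _ _)

  SameWeight : List Cell → List Cell → Set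
  SameWeight qs qs′ = ∀ c d → (c , d) ∈ labels st → wt qs c d ≡ wt qs′ c d

  variable-determined : ∀ {qs qs′ a β} → SameWeight qs qs′ → Nz st (a , β) → a ≢ to u β → (a , β) ∈ qs → (a , β) ∈ qs′
  variable-determined e (inj₁ g) off _ = ⊥-elim (off g)
  variable-determined {qs} {qs′} {a} {β} e (inj₂ l) off q∈ with (a , β) ∈? qs′
    where
    open DecMembership (Product.≡-dec ℕ._≟_ ℕ._≟_) using (_∈?_)
  ... | yes q∈′ = q∈′
  ... | no q∉   = ⊥-elim (ℕ.<⇒≢ (wt-present off q∈) (sym (trans (e a β l) (wt-absent q∉))))

  -- A variable cell is visible in the weight. If neither cell in the row is a variable, both are
  -- the position of the 1 in that row, and there is only one.
  row-determined : ∀ {qs qs′ a β β′} → Unique (rows qs) → Unique (rows qs′) → SameWeight qs qs′ →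
    Nz st (a , β) → Nz st (a , β′) → (a , β) ∈ qs → (a , β′) ∈ qs′ → β ≡ β′
  row-determined {a = a} {β} {β′} uq uq′ e nz nz′ q∈ q∈′ with a ℕ.≟ to u β | a ℕ.≟ to u β′
  ... | yes g  | yes g′ = injective u (trans (sym g) g′)
  ... | no off | _      = cong proj₂ (unique-image proj₁ uq′ (variable-determined e nz off q∈) q∈′ refl)
  ... | yes _  | no off = cong proj₂ (unique-image proj₁ uq q∈ (variable-determined (λ c d l → sym (e c d l)) nz′ off q∈′) refl)

  -- By `row-determined` the monomial fixes the cell in the first row, so a single summand of the
  -- expansion contributes and the coefficient is found by induction.
  det-coeff : ∀ k (R C : Fin k → Fin n) → (∀ {s t} → R s ≡ R t → s ≡ t) → (∀ {s t} → C s ≡ C t → s ≡ t) →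
    ∀ {qs m} → Matching R C qs → m ∼ wt qs → IsSign (coeff (det k (matrixᶻ R C)) m)
  det-coeff zero R C R-inj C-inj {[]} {m} M e with monEq? 1ₘ m
  ... | yes _ = inj₁ (Field.+-identityʳ K 1#)
  ... | no ≢  = ⊥-elim (≢ λ a b → sym (e a b))
  det-coeff zero R C R-inj C-inj {q ∷ qs} (_ , r , _) e with ↭.↭-length r
  ... | ()
  det-coeff (suc k) R C R-inj C-inj {qs} {m} (nzs , r , c) e with ∈-map⁻ proj₁ (↭.∈-resp-↭ (↭-sym r) (here refl))
  ... | (a , β) , q∈ , refl with ∈-tabulate⁻ {f = toℕ ∘ C} (↭.∈-resp-↭ c (∈-map⁺ proj₂ q∈))
  ...   | j₀ , refl with extract q∈
  ...     | qs′ , π = subst (λ p → IsSign (coeff p m)) (sym (det-suc k (matrixᶻ R C)))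
              (coeff-concatMap-sign (summand k (matrixᶻ R C)) j₀ m main others)
    where
    nz₀ : Nz st (cell (R zero) (C j₀))
    nz₀ = All.lookup nzs q∈
    M′ : Matching (R ∘ suc) (C ∘ punchIn j₀) qs′
    M′ = All.tail (↭.All-resp-↭ π nzs)
       , ↭.drop-∷ (↭-trans (↭-sym (↭.map⁺ proj₁ π)) r)
       , ↭.drop-∷ (↭-trans (↭-sym (↭.map⁺ proj₂ π)) (↭-trans c (tabulate-extract (toℕ ∘ C) j₀)))
    minor₀ : Poly
    minor₀ = det k (matrixᶻ (R ∘ suc) (C ∘ punchIn j₀))
    m′ : Mon n
    m′ a b = wt qs′ (toℕ a) (toℕ b)
    leading-entry : ∀ {p} → Entry (R zero) (C j₀) p → IsSign (coeff (p *ₚ minor₀) m)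
    leading-entry (zero-entry ∉) = ⊥-elim (∉ nz₀)
    leading-entry (term-entry m₀ _ e₀) = sign-≈ (coeff-shift m₀ minor₀ {m} {m′}
        (λ a b → trans (e a b) (trans (wt-↭ π (toℕ a) (toℕ b)) (cong (_+ m′ a b) (sym (e₀ a b))))))
      (det-coeff k (R ∘ suc) (C ∘ punchIn j₀) (Fin.suc-injective ∘ R-inj) (Fin.punchIn-injective j₀ _ _ ∘ C-inj) M′ (λ _ _ → refl))
    main : IsSign (coeff (summand k (matrixᶻ R C) j₀) m)
    main = coeff-alt-sign (toℕ j₀) _ m (leading-entry (entry (R zero) (C j₀)))
    unique-matching : ∀ {ps} → rows ps ↭ tabulate (toℕ ∘ R) → Unique (rows ps)
    unique-matching r = unique-↭ (↭-sym r) (Unique.tabulate⁺ (R-inj ∘ Fin.toℕ-injective))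
    others : ∀ j → j ≢ j₀ → Field._≈_ K (coeff (summand k (matrixᶻ R C) j) m) 0#
    others j j≢ = coeff-absent (All.map (λ {t} → differ t) (summand-terms k R C j))
      where
      differ : ∀ t → (∃ λ ps → Matching R C (cell (R zero) (C j) ∷ ps) × proj₂ t ∼ wt (cell (R zero) (C j) ∷ ps)) → ¬ (proj₂ t ≗ₘ m)
      differ t (ps , (nzs′ , r′ , c′) , e′) same = j≢ (C-inj (Fin.toℕ-injective
        (row-determined (unique-matching {cell (R zero) (C j) ∷ ps} r′) (unique-matching {qs} r) weights (All.head nzs′) nz₀ (here refl) q∈)))
        where
        weights : SameWeight (cell (R zero) (C j) ∷ ps) qs
        weights x y l with diagram-bounded v (label⇒ W l)
        ... | x<n , y<n = subst₂ (λ x y → wt (cell (R zero) (C j) ∷ ps) x y ≡ wt qs x y) (Fin.toℕ-fromℕ< x<n) (Fin.toℕ-fromℕ< y<n)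
              (trans (sym (e′ (fromℕ< x<n) (fromℕ< y<n))) (trans (same (fromℕ< x<n) (fromℕ< y<n)) (e (fromℕ< x<n) (fromℕ< y<n))))

-- Comparison of monomial orders

≻-asym : ∀ {l l′} → l ≻ l′ → ¬ l′ ≻ l
≻-asym (inj₁ p) (inj₁ q) = ℕ.<-asym p q
≻-asym (inj₁ p) (inj₂ (e , _)) = ℕ.<⇒≢ p (sym e)
≻-asym (inj₂ (e , _)) (inj₁ q) = ℕ.<⇒≢ q (sym e)
≻-asym (inj₂ (_ , p)) (inj₂ (_ , q)) = ℕ.<-asym p q

-- Lexicographic comparison expressed through the order of cells instead of along the list; this is
-- the form that `_≺ₘ_` has.
Exceeds : Steps → Monomial → Monomial → Set
Exceeds st M M′ = ∃₂ λ p β → (p , β) ∈ labels st × M p β < M′ p β × (∀ c d → (c , d) ∈ labels st → (c , d) ≻ (p , β) → M c d ≡ M′ c d)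

exceeds⇒≰ : ∀ st {M M′} → AllPairs _≻_ (labels st) → Exceeds st M M′ → ¬ LexLe st M′ M
exceeds⇒≰ (_ ∷ st) (s≻ ∷ ap) (p , β , here refl , lt , _) (inj₁ lt′) = ℕ.<-asym lt lt′
exceeds⇒≰ (_ ∷ st) (s≻ ∷ ap) (p , β , here refl , lt , _) (inj₂ (e , _)) = ℕ.<⇒≢ lt (sym e)
exceeds⇒≰ (_ ∷ st) (s≻ ∷ ap) (p , β , there l , lt , above) (inj₁ lt′) = ℕ.<⇒≢ lt′ (sym (above _ _ (here refl) (All.lookup s≻ l)))
exceeds⇒≰ (_ ∷ st) (s≻ ∷ ap) (p , β , there l , lt , above) (inj₂ (_ , le)) =
  exceeds⇒≰ st ap (p , β , l , lt , λ c d l′ → above c d (there l′)) le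

LexLt : Steps → Monomial → Monomial → Set
LexLt [] M M′ = ⊥
LexLt ((_ , p , β) ∷ st) M M′ = M p β < M′ p β ⊎ (M p β ≡ M′ p β × LexLt st M M′)

LexLt⇒exceeds : ∀ st {M M′} → AllPairs _≻_ (labels st) → LexLt st M M′ → Exceeds st M M′
LexLt⇒exceeds ((_ , p , β) ∷ st) {M} {M′} (s≻ ∷ ap) (inj₁ lt) = p , β , here refl , lt , above
  where
  above : ∀ c d → (c , d) ∈ ((p , β) ∷ labels st) → (c , d) ≻ (p , β) → M c d ≡ M′ c d
  above _ _ (here refl) gt = ⊥-elim (≻-asym gt gt)
  above _ _ (there l)   gt = ⊥-elim (≻-asym gt (All.lookup s≻ l))
LexLt⇒exceeds ((_ , p , β) ∷ st) {M} {M′} (s≻ ∷ ap) (inj₂ (e , lt)) with LexLt⇒exceeds st ap lt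
... | p′ , β′ , l , lt′ , above = p′ , β′ , there l , lt′ , λ { _ _ (here refl) _ → e ; c d (there l′) gt → above c d l′ gt }

module _ {n : ℕ} where
  ≺v⇒≻ : ∀ {a b c d : Fin n} → (a , b) ≺v (c , d) → (toℕ c , toℕ d) ≻ (toℕ a , toℕ b)
  ≺v⇒≻ = Sum.map₂ λ (e , lt) → cong toℕ e , lt

  ≻⇒≺v : ∀ {a b c d : Fin n} → (toℕ c , toℕ d) ≻ (toℕ a , toℕ b) → (a , b) ≺v (c , d)
  ≻⇒≺v = Sum.map₂ λ (e , lt) → Fin.toℕ-injective e , lt

module LeadingMinor {c ℓ} (K : Field c ℓ) {n : ℕ} (v : Permutation′ n)
  {st : Steps} (W : Chart.Word (flipped v) identity st) (descending : AllPairs _≻_ (labels st)) where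
  open Polynomials K n
  open TermLists K n
  open Matchings K v W
  open Chart (flipped v)

  -- The monomial occurs with a sign as coefficient, and every term of the minor is a matching on
  -- the same rows and columns, to which the maximality in `Max` applies.
  det-leading : ∀ {k} (R C : Fin k → Fin n) → (∀ {s t} → R s ≡ R t → s ≡ t) → (∀ {s t} → C s ≡ C t → s ≡ t) →
    ∀ {qs} → Max st qs → rows qs ↭ tabulate (toℕ ∘ R) → cols qs ↭ tabulate (toℕ ∘ C) →
    IsLeadingMonomial (det k (matrixᶻ R C)) (λ a b → wt qs (toℕ a) (toℕ b))
  det-leading {k} R C R-inj C-inj {qs} (nz , max) r c =
    sign-nonzero (det-coeff k R C R-inj C-inj (nz , r , c) (λ _ _ → refl)) ,
    λ m′ lt → coeff-absent (All.map (λ {t} → bounded m′ lt t) (det-terms k R C))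
    where
    bounded : ∀ m′ → (λ a b → wt qs (toℕ a) (toℕ b)) ≺ₘ m′ → ∀ t → (∃ λ ps → Matching R C ps × proj₂ t ∼ wt ps) → ¬ (proj₂ t ≗ₘ m′)
    bounded m′ (a , b , lt , above) t (ps , (nz′ , r′ , c′) , e) same =
      exceeds⇒≰ st descending (toℕ a , toℕ b , label , subst (_ <_) (weight-of a b) lt , above′)
        (max ps nz′ (↭-trans r′ (↭-sym r)) (↭-trans c′ (↭-sym c)))
      where
      weight-of : ∀ a b → m′ a b ≡ wt ps (toℕ a) (toℕ b)
      weight-of a b = trans (sym (same a b)) (e a b)
      -- The exponent of `m′` is positive here, and the weight of a matching is supported on the
      -- labels.
      label : cell a b ∈ labels st
      label with InD? v a b
      ... | yes d = proj₂ label⇔ d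
      ... | no ¬d = ⊥-elim (ℕ.n≮0 (subst (_ <_) (trans (weight-of a b) (wt-support nz′ (¬d ∘ proj₁ label⇔))) lt))
      above′ : ∀ x y → (x , y) ∈ labels st → (x , y) ≻ cell a b → wt qs x y ≡ wt ps x y
      above′ x y l gt with diagram-bounded v (label⇒ W l)
      ... | x<n , y<n = subst₂ (λ x y → wt qs x y ≡ wt ps x y) (Fin.toℕ-fromℕ< x<n) (Fin.toℕ-fromℕ< y<n)
            (trans (above (fromℕ< x<n) (fromℕ< y<n) (≻⇒≺v (subst₂ (λ x y → (x , y) ≻ cell a b)
              (sym (Fin.toℕ-fromℕ< x<n)) (sym (Fin.toℕ-fromℕ< y<n)) gt))) (weight-of (fromℕ< x<n) (fromℕ< y<n)))

-- Monomials and coefficients in the iterated polynomial ring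

module Powers {c ℓ} (A : CommutativeRing c ℓ) where
  open CommutativeRing A using (Carrier; _≈_; 0#)
  open Coefficients A
  private
    module A = CommutativeRing A
    module B = CommutativeRing (A [y])
    module BP = RingProperties B.ring

  Y^_·_ : ℕ → B.Carrier → B.Carrier
  Y^ zero  · p = p
  Y^ suc n · p = Y B.* (Y^ n · p)

  Y^-cong : ∀ n {p q} → p B.≈ q → Y^ n · p B.≈ Y^ n · q
  Y^-cong zero    e = e
  Y^-cong (suc n) e = B.*-congˡ (Y^-cong n e)

  Y^-*ˡ : ∀ n p q → (Y^ n · p) B.* q B.≈ Y^ n · (p B.* q)
  Y^-*ˡ zero    p q = B.refl
  Y^-*ˡ (suc n) p q = B.trans (B.*-assoc _ _ _) (B.*-congˡ (Y^-*ˡ n p q))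

  Y^-* : ∀ m n p q → (Y^ m · p) B.* (Y^ n · q) B.≈ Y^ (m + n) · (p B.* q)
  Y^-* zero    n p q = B.trans (B.*-comm _ _) (B.trans (Y^-*ˡ n q p) (Y^-cong n (B.*-comm _ _)))
  Y^-* (suc m) n p q = B.trans (B.*-assoc _ _ _) (B.*-congˡ (Y^-* m n p q))

  Y^-neg : ∀ n p → Y^ n · (B.- p) B.≈ B.- (Y^ n · p)
  Y^-neg zero    p = B.refl
  Y^-neg (suc n) p = B.trans (B.*-congˡ (Y^-neg n p)) (B.sym (BP.-‿distribʳ-* _ _))

  coeff-Y^-const : ∀ n a → coeff (Y^ n · const a) n A.≈ a
  coeff-Y^-const zero    a = coeff-const-zero a
  coeff-Y^-const (suc n) a = A.trans (coeff-Y*-suc _ n) (coeff-Y^-const n a)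

  coeff-Y^-const-≢ : ∀ n d a → d ≢ n → coeff (Y^ n · const a) d A.≈ 0#
  coeff-Y^-const-≢ zero    zero    a ≢ = ⊥-elim (≢ refl)
  coeff-Y^-const-≢ zero    (suc d) a ≢ = coeff-const-suc a d
  coeff-Y^-const-≢ (suc n) zero    a ≢ = coeff-Y*-zero _
  coeff-Y^-const-≢ (suc n) (suc d) a ≢ = A.trans (coeff-Y*-suc _ d) (coeff-Y^-const-≢ n d a (≢ ∘ cong suc))

module TowerMonomials {c ℓ} (K : CommutativeRing c ℓ) where
  open Tower K
  private
    module K = CommutativeRing K
    module R st = CommutativeRing (ring st)

  term : ∀ st → K.Carrier → Monomial → R.Carrier st
  term []                 a M = a
  term ((_ , p , β) ∷ st) a M = Y^ M p β · const (term st a M)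
    where
    open Powers (ring st)
    open Coefficients (ring st)

  term-cong : ∀ st {a a′ M M′} → a K.≈ a′ → (∀ p β → (p , β) ∈ labels st → M p β ≡ M′ p β) → R._≈_ st (term st a M) (term st a′ M′)
  term-cong []                 ea eM = ea
  term-cong ((_ , p , β) ∷ st) {a} {a′} {M} {M′} ea eM = B.trans
    (B.reflexive (cong (λ e → Y^ e · const (term st a M)) (eM p β (here refl))))
    (Y^-cong (M′ p β) (const-cong (term-cong st ea (λ p β l → eM p β (there l)))))
    where
    open Powers (ring st)
    open Coefficients (ring st)
    module B = CommutativeRing (ring st [y])

  term-* : ∀ st a a′ M M′ → R._≈_ st (R._*_ st (term st a M) (term st a′ M′)) (term st (a K.* a′) (λ p β → M p β + M′ p β))
  term-* []                 a a′ M M′ = K.refl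
  term-* ((_ , p , β) ∷ st) a a′ M M′ = B.trans (Y^-* (M p β) (M′ p β) _ _)
    (Y^-cong (M p β + M′ p β) (B.trans (B.sym (const-* _ _)) (const-cong (term-* st a a′ M M′))))
    where
    open Powers (ring st)
    open Coefficients (ring st)
    module B = CommutativeRing (ring st [y])

  term-neg : ∀ st a M → R._≈_ st (term st (K.- a) M) (R.-_ st (term st a M))
  term-neg []                 a M = K.refl
  term-neg ((_ , p , β) ∷ st) a M = B.trans (Y^-cong (M p β) (B.trans (const-cong (term-neg st a M)) (const-neg _))) (Y^-neg (M p β) _)
    where
    open Powers (ring st)
    open Coefficients (ring st)
    module B = CommutativeRing (ring st [y])

  term-1 : ∀ st → R._≈_ st (term st K.1# (λ _ _ → 0)) (R.1# st)
  term-1 []       = K.refl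
  term-1 (_ ∷ st) = B.trans (const-cong (term-1 st)) (B.sym coeff-1)
    where
    open Coefficients (ring st)
    module B = CommutativeRing (ring st [y])

  coefficient : ∀ st → R.Carrier st → Monomial → K.Carrier
  coefficient []                 f M = f
  coefficient ((_ , p , β) ∷ st) f M = coefficient st (coeff f (M p β)) M
    where
    open Coefficients (ring st)

  coefficient-cong : ∀ st {f g} → R._≈_ st f g → ∀ M → coefficient st f M K.≈ coefficient st g M
  coefficient-cong []                 e M = e
  coefficient-cong ((_ , p , β) ∷ st) e M = coefficient-cong st (coeff-cong e (M p β)) M
    where
    open Coefficients (ring st)

  coefficient-≡ : ∀ st f {M M′} → (∀ p β → (p , β) ∈ labels st → M p β ≡ M′ p β) → coefficient st f M ≡ coefficient st f M′
  coefficient-≡ []                 f e = refl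
  coefficient-≡ ((_ , p , β) ∷ st) f {M} {M′} e = trans (cong (λ d → coefficient st (coeff f d) M) (e p β (here refl)))
    (coefficient-≡ st _ (λ p β l → e p β (there l)))
    where
    open Coefficients (ring st)

  coefficient-0 : ∀ st M → coefficient st (R.0# st) M K.≈ K.0#
  coefficient-0 []                 M = K.refl
  coefficient-0 ((_ , p , β) ∷ st) M = K.trans (coefficient-cong st (coeff-0 (M p β)) M) (coefficient-0 st M)
    where
    open Coefficients (ring st)

  coefficient-+ : ∀ st f g M → coefficient st (R._+_ st f g) M K.≈ coefficient st f M K.+ coefficient st g M
  coefficient-+ []                 f g M = K.refl
  coefficient-+ ((_ , p , β) ∷ st) f g M = K.trans (coefficient-cong st (coeff-+ f g (M p β)) M) (coefficient-+ st _ _ M)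
    where
    open Coefficients (ring st)

  coefficient-term : ∀ st a M M′ → (∀ p β → (p , β) ∈ labels st → M p β ≡ M′ p β) → coefficient st (term st a M) M′ K.≈ a
  coefficient-term []                 a M M′ e = K.refl
  coefficient-term ((_ , p , β) ∷ st) a M M′ e = K.trans
    (coefficient-cong st (subst (λ d → coeff (Y^ M p β · const (term st a M)) d ≈ term st a M) (e p β (here refl)) (coeff-Y^-const (M p β) _)) M′)
    (coefficient-term st a M M′ (λ p β l → e p β (there l)))
    where
    open Powers (ring st)
    open Coefficients (ring st)
    open CommutativeRing (ring st) using (_≈_)

  coefficient-term-≢ : ∀ st a M M′ → ¬ (∀ p β → (p , β) ∈ labels st → M p β ≡ M′ p β) → coefficient st (term st a M) M′ K.≈ K.0#
  coefficient-term-≢ []                 a M M′ ≢ = ⊥-elim (≢ λ _ _ ())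
  coefficient-term-≢ ((_ , p , β) ∷ st) a M M′ ≢ with M′ p β ℕ.≟ M p β
  ... | no d≢ = K.trans (coefficient-cong st (coeff-Y^-const-≢ (M p β) (M′ p β) _ d≢) M′) (coefficient-0 st M′)
    where
    open Powers (ring st)
  ... | yes e = K.trans
      (coefficient-cong st (subst (λ d → coeff (Y^ M p β · const (term st a M)) d ≈ term st a M) (sym e) (coeff-Y^-const (M p β) _)) M′)
      (coefficient-term-≢ st a M M′ (λ h → ≢ λ { _ _ (here refl) → sym e ; p β (there l) → h p β l }))
    where
    open Powers (ring st)
    open Coefficients (ring st)
    open CommutativeRing (ring st) using (_≈_)

  update : Monomial → Cell → ℕ → Monomial
  update M (p , β) d a b with a ℕ.≟ p | b ℕ.≟ β
  ... | yes _ | yes _ = d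
  ... | _     | _     = M a b

  update-at : ∀ M p β d → update M (p , β) d p β ≡ d
  update-at M p β d with p ℕ.≟ p | β ℕ.≟ β
  ... | yes _ | yes _ = refl
  ... | yes _ | no ≢  = ⊥-elim (≢ refl)
  ... | no ≢  | _     = ⊥-elim (≢ refl)

  update-off : ∀ M p β d {a b} → (a , b) ≢ (p , β) → update M (p , β) d a b ≡ M a b
  update-off M p β d {a} {b} ≢ with a ℕ.≟ p | b ℕ.≟ β
  ... | yes e | yes f = ⊥-elim (≢ (cong₂ _,_ e f))
  ... | yes _ | no _  = refl
  ... | no _  | _     = refl

  -- Setting the exponent of the first variable does not disturb the others, because the ordering of
  -- the labels makes them distinct.
  coefficient-update : ∀ s st → AllPairs _≻_ (labels (s ∷ st)) → ∀ f M d →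
    coefficient (s ∷ st) f (update M (proj₂ s) d) ≡ coefficient st (Coefficients.coeff (ring st) f d) M
  coefficient-update (_ , p , β) st (s≻ ∷ _) f M d = trans
    (cong (λ e → coefficient st (coeff f e) (update M (p , β) d)) (update-at M p β d))
    (coefficient-≡ st _ λ a b l → update-off M p β d λ { refl → let gt = All.lookup s≻ l in ≻-asym gt gt })
    where
    open Coefficients (ring st)

  coefficients-vanish : ∀ st → AllPairs _≻_ (labels st) → ∀ f → (∀ M → coefficient st f M K.≈ K.0#) → R._≈_ st f (R.0# st)
  coefficients-vanish []       _  f z = z (λ _ _ → 0)
  coefficients-vanish (s ∷ st) ap@(_ ∷ ap′) f z = coeff-ext λ d → R.trans st
    (coefficients-vanish st ap′ (coeff f d) (λ M → K.trans (K.reflexive (sym (coefficient-update s st ap f M d))) (z _)))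
    (R.sym st (coeff-0 d))
    where
    open Coefficients (ring st)

  -- Passes from lexicographic comparison of all exponents to the nested notion: coefficients in
  -- higher degree vanish because all monomials in them are larger, whatever their other exponents.
  leading : ∀ st → AllPairs _≻_ (labels st) → ∀ f M → ¬ coefficient st f M K.≈ K.0# →
    (∀ M′ → LexLt st M M′ → coefficient st f M′ K.≈ K.0#) → Leading st f M
  leading []                      _              f M nz above = nz
  leading (s@(_ , p , β) ∷ st) ap@(s≻ ∷ ap′) f M nz above =
    (λ d lt → coefficients-vanish st ap′ (coeff f d) λ M′ → K.trans (K.reflexive (sym (coefficient-update s st ap f M′ d)))
        (above _ (inj₁ (subst (M p β <_) (sym (update-at M′ p β d)) lt)))) ,
    leading st ap′ (coeff f (M p β)) M nz λ M′ lt → K.trans (K.reflexive (sym (coefficient-update s st ap f M′ (M p β))))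
        (above _ (inj₂ (sym (update-at M′ p β (M p β)) , unaffected st s≻ lt)))
    where
    open Coefficients (ring st)
    unaffected : ∀ st {M′} → All ((p , β) ≻_) (labels st) → LexLt st M M′ → LexLt st M (update M′ (p , β) (M p β))
    unaffected ((_ , q , γ) ∷ st) {M′} (gt ∷ gts) lt = Sum.map
      (subst (M q γ <_) (sym off)) (λ (e , lt′) → trans e (sym off) , unaffected st gts lt′) lt
      where
      off : update M′ (p , β) (M p β) q γ ≡ M′ q γ
      off = update-off M′ p β (M p β) λ { refl → ≻-asym gt gt }

-- From lists of terms to iterated polynomial rings

module MatrixEntries {c ℓ} (K : CommutativeRing c ℓ) (u : Perm) where
  open Tower K
  open TowerMonomials K
  open Chart u
  private
    module K = CommutativeRing K
    module R st = CommutativeRing (ring st)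

  data MatrixEntry (st : Steps) (q : Cell) (f : R.Carrier st) : Set ℓ where
    nonzero : Nz st q → R._≈_ st f (term st K.1# (weight q)) → MatrixEntry st q f
    vanishing : ¬ Nz st q → R._≈_ st f (R.0# st) → MatrixEntry st q f

  -- Position b of the tower matrix holds the original column `to τ b`; in the identity order this
  -- is the matrix of the chart itself.
  matrix-entry : ∀ {τ st} → Word τ st → ∀ a b → MatrixEntry st (a , to τ b) (matrix st a b)
  matrix-entry {τ} (nil id) a b with a ℕ.≟ b
  ... | yes refl = nonzero (inj₁ (sym (id a))) (diagonal a)
    where
    diagonal : ∀ a → δ a a K.≈ K.1#
    diagonal zero    = K.refl
    diagonal (suc a) = diagonal a
  ... | no a≢b = vanishing Sum.[ (λ e → a≢b (trans e (id b))) , (λ ()) ] (off a b a≢b)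
    where
    off : ∀ a b → a ≢ b → δ a b K.≈ K.0#
    off zero    zero    n≢ = ⊥-elim (n≢ refl)
    off zero    (suc b) n≢ = K.refl
    off (suc a) zero    n≢ = K.refl
    off (suc a) (suc b) n≢ = off a b (n≢ ∘ cong suc)
  matrix-entry {τ} (step {st = st} j W p<q later) a b = by-column (b ℕ.≟ j) (b ℕ.≟ suc j)
    where
    open Coefficients (ring st)
    open Powers (ring st)
    open Step (ring st) (matrix st) j using (M; M-j; M-1+j; M-else)
    module B = CommutativeRing (ring st [y])
    module A = CommutativeRing (ring st)
    p βʸ βᵉ : ℕ
    p  = to u (to τ (suc j))
    βʸ = to τ j
    βᵉ = to τ (suc j)
    y : Cell
    y = p , βʸ
    st⁺ : Steps
    st⁺ = (j , y) ∷ st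

    lift-entry : ∀ {q f} → q ≢ y → MatrixEntry st q f → MatrixEntry st⁺ q (const f)
    lift-entry {q} q≢ (nonzero nz e) = nonzero (Sum.map₂ there nz) (B.trans (const-cong e)
      (B.reflexive (cong (λ i → Y^ i · const (term st K.1# (weight q))) (sym (weight-other q≢)))))
    lift-entry q≢ (vanishing ¬nz e) = vanishing
      Sum.[ ¬nz ∘ inj₁ , (λ { (here e) → q≢ e ; (there l) → ¬nz (inj₂ l) }) ] (B.trans (const-cong e) const-0)

    entry-cong : ∀ {q f g} → g B.≈ f → MatrixEntry st⁺ q f → MatrixEntry st⁺ q g
    entry-cong e (nonzero nz e′) = nonzero nz (B.trans e e′)
    entry-cong e (vanishing ¬nz e′) = vanishing ¬nz (B.trans e e′)

    previous : ∀ a b {c} → sw j b ≡ c → MatrixEntry st (a , to τ c) (matrix st a b)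
    previous a b e = subst (λ c → MatrixEntry st (a , to τ c) (matrix st a b)) e (matrix-entry W a b)

    new-column : MatrixEntry st (a , βᵉ) (matrix st a j) → MatrixEntry st (a , βʸ) (matrix st a (suc j)) → MatrixEntry st⁺ (a , βʸ) (M a j)
    new-column (vanishing ¬nz e) old = entry-cong (B.trans (B.reflexive (M-j a)) (B.trans (B.+-congʳ (B.trans (B.*-congˡ
        (B.trans (const-cong e) const-0)) (B.zeroʳ Y))) (B.+-identityˡ _)))
      (lift-entry (λ e → ¬nz (inj₁ (cong proj₁ e))) old)
    new-column (nonzero nz e) old with nz-unit-column {τ} j W p<q later (Sum.map₂ there nz)
    -- In row p the unit vector contributes y. The other column has no entry there, since y is not
    -- yet a label and p is not the row of its 1.
    ... | refl = unit old
      where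
      unit : MatrixEntry st (a , βʸ) (matrix st a (suc j)) → MatrixEntry st⁺ (a , βʸ) (M a j)
      unit (nonzero nz′ _) = ⊥-elim (Sum.[ ℕ.<⇒≢ p<q , label-fresh {τ} j W p<q later ] nz′)
      unit (vanishing _ e′) = nonzero (inj₂ (here refl)) (B.trans (B.reflexive (M-j a)) (B.trans
        (B.+-cong (B.*-congˡ (const-cong (A.trans e (term-cong st K.refl no-weight)))) (B.trans (const-cong e′) const-0))
        (B.trans (B.+-identityʳ _) (B.reflexive (cong (λ i → Y^ i · const (term st K.1# (weight y))) (sym (weight-self (ℕ.<⇒≢ p<q))))))))
        where
        no-weight : ∀ c d → (c , d) ∈ labels st → weight (p , βᵉ) c d ≡ weight y c d
        no-weight c d l = trans (weight-graph c d refl) (sym (weight-other λ { refl → label-fresh {τ} j W p<q later l }))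

    by-column : Dec (b ≡ j) → Dec (b ≡ suc j) → MatrixEntry st⁺ (a , to τ b) (M a b)
    by-column (yes refl) _ = new-column (previous a j (sw-j j)) (previous a (suc j) (sw-1+j j))
    by-column (no _) (yes refl) = entry-cong (B.reflexive (M-1+j a)) (lift-entry (λ e → ℕ.1+n≢n (injective τ (cong proj₂ e))) (previous a j (sw-j j)))
    by-column (no b≢j) (no b≢1+j) = entry-cong (B.reflexive (M-else a b≢j b≢1+j))
      (lift-entry (λ e → b≢j (injective τ (cong proj₂ e))) (previous a b (sw-else j b≢j b≢1+j)))

module Evaluation {c ℓ} (K : Field c ℓ) {n : ℕ} (v : Permutation′ n)
  {st : Steps} (W : Chart.Word (flipped v) identity st) (descending : AllPairs _≻_ (labels st)) where
  private
    KR : CommutativeRing c ℓ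
    KR = Field.commutativeRing K
    module F = CommutativeRing KR
  open Polynomials K n
  open TermLists K n
  open Matchings K v W
  open Chart (flipped v)
  open Tower KR
  open TowerMonomials KR
  open MatrixEntries KR (flipped v)
  private
    module A = CommutativeRing (ring st)
    module AP = RingProperties A.ring
    module D = Determinant (ring st)
    module MA = Minors (ring st)

  extended : Mon n → Monomial
  extended m a b with a <? n | b <? n
  ... | yes a<n | yes b<n = m (fromℕ< a<n) (fromℕ< b<n)
  ... | _       | _       = 0

  extended-toℕ : ∀ m a b → extended m (toℕ a) (toℕ b) ≡ m a b
  extended-toℕ m a b with toℕ a <? n | toℕ b <? n
  ... | yes a<n | yes b<n = cong₂ m (Fin.fromℕ<-toℕ a a<n) (Fin.fromℕ<-toℕ b b<n)
  ... | yes _   | no ≮    = ⊥-elim (≮ (Fin.toℕ<n b))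
  ... | no ≮    | _       = ⊥-elim (≮ (Fin.toℕ<n a))

  at-label : ∀ {P : ℕ → ℕ → Set} → (∀ a b → InD v a b → P (toℕ a) (toℕ b)) → ∀ x y → (x , y) ∈ labels st → P x y
  at-label {P} h x y l with diagram-bounded v (label⇒ W l)
  ... | x<n , y<n = subst₂ P (Fin.toℕ-fromℕ< x<n) (Fin.toℕ-fromℕ< y<n) (h _ _ (proj₁ label⇔
        (subst₂ (λ x y → (x , y) ∈ labels st) (sym (Fin.toℕ-fromℕ< x<n)) (sym (Fin.toℕ-fromℕ< y<n)) l)))

  ev : Poly → A.Carrier
  ev []            = A.0#
  ev ((k , m) ∷ p) = term st k (extended m) A.+ ev p

  ev-++ : ∀ p q → ev (p ++ q) A.≈ ev p A.+ ev q
  ev-++ []            q = A.sym (A.+-identityˡ _)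
  ev-++ ((k , m) ∷ p) q = A.trans (A.+-congˡ (ev-++ p q)) (A.sym (A.+-assoc _ _ _))

  ev-neg : ∀ p → ev (-ₚ p) A.≈ A.- ev p
  ev-neg []            = A.sym AP.-0#≈0#
  ev-neg ((k , m) ∷ p) = A.trans (A.+-cong (term-neg st k (extended m)) (ev-neg p)) (AP.-‿+-comm _ _)

  ev-* : ∀ p q → ev (p *ₚ q) A.≈ ev p A.* ev q
  ev-* []            q = A.sym (A.zeroˡ _)
  ev-* ((k , m) ∷ p) q = A.trans (ev-++ (map _ q) _) (A.trans (A.+-cong (scaled q) (ev-* p q)) (A.sym (A.distribʳ _ _ _)))
    where
    scaled : ∀ q → ev (map (λ t′ → (k F.* proj₁ t′ , m ⊕ₘ proj₂ t′)) q) A.≈ term st k (extended m) A.* ev q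
    scaled [] = A.sym (A.zeroʳ _)
    scaled ((k′ , m′) ∷ q) = A.trans (A.+-cong (A.trans (term-cong st F.refl
        (at-label {λ x y → extended (m ⊕ₘ m′) x y ≡ extended m x y + extended m′ x y}
          λ a b _ → trans (extended-toℕ (m ⊕ₘ m′) a b) (sym (cong₂ _+_ (extended-toℕ m a b) (extended-toℕ m′ a b)))))
        (A.sym (term-* st k k′ (extended m) (extended m′)))) (scaled q)) (A.sym (A.distribˡ _ _ _))

  opaque
    unfolding D.asum D.det

    ev-alternating : ∀ m (f : Fin m → Poly) → ev (concat (tabulate (λ j → alt (toℕ j) (f j)))) A.≈ D.asum m (ev ∘ f)
    ev-alternating zero    f = A.refl
    ev-alternating (suc m) f = A.trans (ev-++ (f zero) _) (A.+-congˡ (A.trans (negated m (λ j → alt (toℕ j) (f (suc j))))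
      (A.-‿cong (ev-alternating m (f ∘ suc)))))
      where
      negated : ∀ m (g : Fin m → Poly) → ev (concat (tabulate (λ j → -ₚ g j))) A.≈ A.- ev (concat (tabulate g))
      negated zero    g = A.sym AP.-0#≈0#
      negated (suc m) g = A.trans (ev-++ (-ₚ g zero) _) (A.trans (A.+-cong (ev-neg (g zero)) (negated m (g ∘ suc)))
        (A.trans (AP.-‿+-comm _ _) (A.-‿cong (A.sym (ev-++ (g zero) _)))))

    ev-det : ∀ k M → ev (det k M) A.≈ D.det k (λ s t → ev (M s t))
    ev-det zero    M = A.trans (A.+-identityʳ _) (A.trans (term-cong st F.refl (at-label {λ x y → extended 1ₘ x y ≡ 0} λ a b _ → extended-toℕ 1ₘ a b)) (term-1 st))
    ev-det (suc k) M = begin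
      ev (det (suc k) M)
        ≡⟨ cong ev (trans (det-suc k M) (cong concat (map-tabulate (λ j → j) (summand k M)))) ⟩
      ev (concat (tabulate (summand k M)))
        ≈⟨ ev-alternating (suc k) (λ j → M zero j *ₚ det k (λ r s → M (suc r) (punchIn j s))) ⟩
      D.asum (suc k) (λ j → ev (M zero j *ₚ det k (λ r s → M (suc r) (punchIn j s))))
        ≈⟨ D.asum-cong (λ j → A.trans (ev-* (M zero j) (det k (λ r s → M (suc r) (punchIn j s)))) (A.*-congˡ (ev-det k (λ r s → M (suc r) (punchIn j s))))) ⟩
      D.det (suc k) (λ s t → ev (M s t)) ∎
      where
      open SetoidReasoning A.setoid

  ev-Z : ∀ a b → ev (Z v a b) A.≈ matrix st (toℕ a) (toℕ b)
  ev-Z a b = compare (entry a b) (matrix-entry W (toℕ a) (toℕ b))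
    where
    compare : ∀ {p} → Entry a b p → MatrixEntry st (cell a b) (matrix st (toℕ a) (toℕ b)) → ev p A.≈ matrix st (toℕ a) (toℕ b)
    compare (zero-entry ¬nz)    (nonzero nz _)    = ⊥-elim (¬nz nz)
    compare (zero-entry ¬nz)    (vanishing _ e)   = A.sym e
    compare (term-entry m nz _) (vanishing ¬nz _) = ⊥-elim (¬nz nz)
    compare (term-entry m nz ∼) (nonzero _ e)     = A.trans (A.+-identityʳ _) (A.trans (term-cong st F.refl
      (at-label {λ x y → extended m x y ≡ weight (cell a b) x y} λ c d _ → trans (extended-toℕ m c d) (∼ c d))) (A.sym e))

  -- The transpose accounts for `minor` being indexed by column first.
  ev-minor : ∀ k (R C : Fin k → Fin n) → ev (det k (matrixᶻ R C)) A.≈ MA.minor (matrix st) (toℕ ∘ R) (toℕ ∘ C)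
  ev-minor k R C = A.trans (ev-det k (matrixᶻ R C)) (A.trans (D.det-cong k (λ s t → ev-Z (R s) (C t))) (D.det-transpose k _))

  -- Elements of the tower see only exponents at labels; the others are set to zero so that the
  -- result can be matched with the terms of a supported polynomial.
  cut : Monomial → Mon n
  cut M a b with InD? v a b
  ... | yes _ = M (toℕ a) (toℕ b)
  ... | no _  = 0

  cut-in : ∀ M {a b} → InD v a b → cut M a b ≡ M (toℕ a) (toℕ b)
  cut-in M {a} {b} d with InD? v a b
  ... | yes _ = refl
  ... | no ¬d = ⊥-elim (¬d d)

  coefficient-ev : ∀ {p} → SupportedPoly (InD v) p → ∀ M → coefficient st (ev p) M F.≈ coeff p (cut M)
  coefficient-ev []                  M = coefficient-0 st M
  coefficient-ev {(k , m) ∷ p} (supp ∷ supps) M with monEq? m (cut M)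
  ... | yes e = F.trans (coefficient-+ st _ _ M) (F.+-cong (coefficient-term st k (extended m) M
        (at-label {λ x y → extended m x y ≡ M x y} λ a b d → trans (extended-toℕ m a b) (trans (e a b) (cut-in M d))))
        (coefficient-ev supps M))
  ... | no ≢ = F.trans (coefficient-+ st _ _ M) (F.trans (F.+-cong (coefficient-term-≢ st k (extended m) M differ)
        (coefficient-ev supps M)) (F.+-identityˡ _))
    where
    differ : ¬ (∀ x y → (x , y) ∈ labels st → extended m x y ≡ M x y)
    differ h = ≢ pointwise
      where
      pointwise : ∀ a b → m a b ≡ cut M a b
      pointwise a b with InD? v a b
      ... | yes d = trans (sym (extended-toℕ m a b)) (h _ _ (proj₂ label⇔ d))
      ... | no ¬d = supp a b ¬d

  leading-supported : ∀ {p m} → SupportedPoly (InD v) p → ¬ coeff p m F.≈ F.0# → SupportedMon (InD v) m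
  leading-supported {p} {m} supp nz a b ¬d with m a b ℕ.≟ 0
  ... | yes e = e
  ... | no m≢0 = ⊥-elim (nz (coeff-absent (All.map (λ s same → m≢0 (trans (sym (same a b)) (s a b ¬d))) supp)))

  -- `coefficient-ev` identifies the coefficients, and `LexLt⇒exceeds` turns a lexicographically
  -- larger exponent vector into a `≺ₘ`-larger monomial.
  ev-leading : ∀ {p m} → SupportedPoly (InD v) p → IsLeadingMonomial p m → Leading st (ev p) (extended m)
  ev-leading {p} {m} supp (nz , above) = leading st descending (ev p) (extended m)
    (λ e → nz (F.trans (F.reflexive (coeff-≗ p (λ a b → sym (cut-extended a b)))) (F.trans (F.sym (coefficient-ev supp (extended m))) e)))
    (λ M′ lt → F.trans (coefficient-ev supp M′) (above (cut M′) (exceeds (LexLt⇒exceeds st descending lt))))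
    where
    m-supp : SupportedMon (InD v) m
    m-supp = leading-supported supp nz
    cut-extended : ∀ a b → cut (extended m) a b ≡ m a b
    cut-extended a b with InD? v a b
    ... | yes _ = extended-toℕ m a b
    ... | no ¬d = sym (m-supp a b ¬d)
    exceeds : ∀ {M′} → Exceeds st (extended m) M′ → m ≺ₘ cut M′
    exceeds {M′} (x , y , l , lt , agree) with diagram-bounded v (label⇒ W l)
    ... | x<n , y<n = a , b , subst₂ _<_ (extended-toℕ m a b) (sym (cut-in M′ d)) lt′ , above′
      where
      a b : Fin n
      a = fromℕ< x<n
      b = fromℕ< y<n
      back : (x , y) ≡ cell a b
      back = sym (cong₂ _,_ (Fin.toℕ-fromℕ< x<n) (Fin.toℕ-fromℕ< y<n))
      d : InD v a b
      d = proj₁ label⇔ (subst (_∈ labels st) back l)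
      lt′ : extended m (toℕ a) (toℕ b) < M′ (toℕ a) (toℕ b)
      lt′ = subst (λ (x , y) → extended m x y < M′ x y) back lt
      above′ : ∀ c e → (a , b) ≺v (c , e) → m c e ≡ cut M′ c e
      above′ c e gt with InD? v c e
      ... | no ¬d = m-supp c e ¬d
      ... | yes d′ = trans (sym (extended-toℕ m c e)) (agree _ _ (proj₂ label⇔ d′)
              (subst (cell c e ≻_) (sym back) (≺v⇒≻ gt)))

  minor-supported : ∀ k (R C : Fin k → Fin n) → SupportedPoly (InD v) (det k (matrixᶻ R C))
  minor-supported k R C = All.map (λ (qs , (nzs , _) , e) a b ¬d → trans (e a b) (wt-support nzs (¬d ∘ proj₁ label⇔))) (det-terms k R C)

-- The Gröbner basis

open Data.List.Sort ℕ.≤-decTotalOrder using (sort; sort-↭; sort-↗)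

allPairs-lookup : ∀ {a r} {A : Set a} {R : A → A → Set r} {xs} → AllPairs R xs →
  ∀ s t → s Fin.< t → R (lookup xs s) (lookup xs t)
allPairs-lookup (x∼ ∷ _)  zero    (suc t) _         = All.lookup x∼ (∈-lookup t)
allPairs-lookup (_ ∷ xs∼) (suc s) (suc t) (s≤s s<t) = allPairs-lookup xs∼ s t s<t

-- `IsMinor` asks for increasing index maps, while a candidate lists its rows and columns in the
-- order of its cells.
increasing-enumeration : ∀ {n k a} (xs : List ℕ) → length xs ≡ k → Unique xs → All (_≤ a) xs → a < n →
  ∃ λ (R : Fin k → Fin n) → (∀ s t → s Fin.< t → R s Fin.< R t) × (∀ t → toℕ (R t) ≤ a) × xs ↭ tabulate (toℕ ∘ R)
increasing-enumeration {n} {k} {a} xs len uniq xs≤ a<n = enumerate (sort xs)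
    (trans (↭.↭-length (sort-↭ xs)) len) (unique-↭ (↭-sym (sort-↭ xs)) uniq) (↭.All-resp-↭ (↭-sym (sort-↭ xs)) xs≤)
    (Linked.Linked⇒AllPairs ℕ.≤-trans (sort-↗ xs)) (↭-sym (sort-↭ xs))
  where
  enumerate : ∀ ys → length ys ≡ k → Unique ys → All (_≤ a) ys → AllPairs _≤_ ys → xs ↭ ys →
    ∃ λ (R : Fin k → Fin n) → (∀ s t → s Fin.< t → R s Fin.< R t) × (∀ t → toℕ (R t) ≤ a) × xs ↭ tabulate (toℕ ∘ R)
  enumerate ys refl uniq ys≤ sorted π = R
    , (λ s t s<t → subst₂ _<_ (sym (toℕ-R s)) (sym (toℕ-R t)) (allPairs-lookup strict s t s<t))
    , (λ t → subst (_≤ a) (sym (toℕ-R t)) (bound t))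
    , subst (xs ↭_) (trans (sym (tabulate-lookup ys)) (tabulate-cong (sym ∘ toℕ-R))) π
    where
    bound : ∀ t → lookup ys t ≤ a
    bound t = All.lookup ys≤ (∈-lookup t)
    R : Fin (length ys) → Fin n
    R t = fromℕ< (ℕ.≤-<-trans (bound t) a<n)
    toℕ-R : ∀ t → toℕ (R t) ≡ lookup ys t
    toℕ-R t = Fin.toℕ-fromℕ< _
    strict : AllPairs _<_ ys
    strict = AllPairs.zipWith (λ (le , ne) → ℕ.≤∧≢⇒< le ne) (sorted , uniq)

increasing⇒injective : ∀ {k n} {R : Fin k → Fin n} → (∀ s t → s Fin.< t → R s Fin.< R t) → ∀ {s t} → R s ≡ R t → s ≡ t
increasing⇒injective incr {s} {t} e with Fin.<-cmp s t
... | tri< s<t _ _ = ⊥-elim (ℕ.<⇒≢ (incr s t s<t) (cong toℕ e))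
... | tri≈ _ s≡t _ = s≡t
... | tri> _ _ t<s = ⊥-elim (ℕ.<⇒≢ (incr t s t<s) (cong toℕ (sym e)))

module _ {c ℓ} (K : Field c ℓ) (n : ℕ) (v w : Permutation′ n) where
  open Polynomials K n
  open TermLists K n
  private
    module F = Field K
    KR : CommutativeRing c ℓ
    KR = Field.commutativeRing K

  essential∈ideal : ∀ g → EssentialMinor v w g → InIdeal (InD v) (KLGenerator v w) g
  essential∈ideal g (a , b , _ , minor) = _ , cons ((λ _ _ _ → refl) ∷ []) (a , b , minor) nil ,
    λ m → F.sym (F.trans (coeff-++ (1ₚ *ₚ g) [] m) (F.trans (F.+-identityʳ _) (coeff-shift 1ₘ g (λ _ _ → refl))))

  module _ {st : Steps} (W : Chart.Word (flipped v) identity st) (descending : AllPairs _≻_ (labels st)) where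
    open Tower KR
    open Matchings K v W
    open Evaluation K v W descending
    open LeadingMinor K v W descending
    open Chart (flipped v)
    private
      module A = CommutativeRing (ring st)
      module M = Minors (ring st)
      I : A.Carrier → Set (c ⊔ ℓ)
      I = M.MinorIdeal (matrix st) (rk (to (flipped w)))

    generator : ∀ {g} → KLGenerator v w g → SupportedPoly (InD v) g × I (ev g)
    generator (a , b , R , C , _ , _ , R≤ , C≤ , refl) = minor-supported _ R C , M.resp (A.sym (ev-minor _ R C))
      (M.gen (suc (toℕ a)) (suc (toℕ b)) (toℕ ∘ R) (toℕ ∘ C) (cong suc (rank-flipped w a b)) (s≤s ∘ R≤) (s≤s ∘ C≤))

    combination : ∀ {q} → Combination (InD v) (KLGenerator v w) q → SupportedPoly (InD v) q × I (ev q)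
    combination nil = [] , M.0∈
    combination (cons {h} {g} {q} h-supp g∈ comb) with generator g∈ | combination comb
    ... | g-supp , evg∈ | q-supp , evq∈ =
        All.++⁺ (allMon-* (λ s s′ a b ¬d → cong₂ _+_ (s a b ¬d) (s′ a b ¬d)) h-supp g-supp) q-supp
      , M.resp (A.sym (A.trans (ev-++ (h *ₚ g) q) (A.+-congʳ (ev-* h g)))) (M.+∈ (M.*∈ (ev h) evg∈) evq∈)

    essential-divides : ∀ f → InIdeal (InD v) (KLGenerator v w) f → ∀ m → IsLeadingMonomial f m →
      ∃ λ g → EssentialMinor v w g × ∃ λ mg → IsLeadingMonomial g mg × (mg ∣ₘ m)
    essential-divides f (q , comb , f≈q) m (nz , above) with combination comb
    ... | q-supp , evq∈ with reached W (flipped w) (leading∈initial st (rank-bounded (flipped w)) evq∈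
            (ev-leading q-supp ((λ e → nz (F.trans (f≈q m) e)) , λ m′ lt → F.trans (F.sym (f≈q m′)) (above m′ lt))))
    -- The essential box dominates (a , b) and has the same rank, so the candidate has the right
    -- size and already lies within its rows and columns.
    ...   | a , b , box , cand with essential-above w box
    ...     | a′ , b′ , ess , a≤a′ , b≤b′ , rank≡ with diagram-bounded w (proj₁ ess)
    ...       | a′<n , b′<n = minor
                (increasing-enumeration (rows cells) (trans (length-map proj₁ cells) size≡) unique-rows (All.map (λ le → ℕ.≤-trans le a≤a′) rows≤) a′<n)
                (increasing-enumeration (cols cells) (trans (length-map proj₂ cells) size≡) unique-cols (All.map (λ le → ℕ.≤-trans le b≤b′) cols≤) b′<n)
      where
      open Candidate cand
      α β : Fin n
      α = fromℕ< a′<n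
      β = fromℕ< b′<n
      α≡ : a′ ≡ toℕ α
      α≡ = sym (Fin.toℕ-fromℕ< a′<n)
      β≡ : b′ ≡ toℕ β
      β≡ = sym (Fin.toℕ-fromℕ< b′<n)
      size≡ : length cells ≡ suc (rank w α β)
      size≡ = trans count (cong suc (trans (sym rank≡)
        (trans (cong₂ (λ i j → rk (to (flipped w)) (suc i) (suc j)) α≡ β≡) (sym (rank-flipped w α β)))))
      Enumeration : List ℕ → ℕ → Set
      Enumeration xs a = ∃ λ (R : Fin (suc (rank w α β)) → Fin n) → (∀ s t → s Fin.< t → R s Fin.< R t) × (∀ t → toℕ (R t) ≤ a) × xs ↭ tabulate (toℕ ∘ R)
      minor : Enumeration (rows cells) a′ → Enumeration (cols cells) b′ →
        ∃ λ g → EssentialMinor v w g × ∃ λ mg → IsLeadingMonomial g mg × (mg ∣ₘ m)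
      minor (R , R-incr , R≤ , r) (C , C-incr , C≤ , c) = det _ (matrixᶻ R C)
        , (α , β , essential⇒ w (subst₂ (Essential w) α≡ β≡ ess) , R , C , R-incr , C-incr
          , (λ t → subst (toℕ (R t) ≤_) α≡ (R≤ t)) , (λ t → subst (toℕ (C t) ≤_) β≡ (C≤ t)) , refl)
        , _ , det-leading R C (increasing⇒injective R-incr) (increasing⇒injective C-incr) maximal r c
        , λ x y → subst (wt cells (toℕ x) (toℕ y) ≤_) (extended-toℕ m x y) (divides (toℕ x) (toℕ y))

mainTheorem1 : ∀ {c ℓ} (K : Field c ℓ) (n : ℕ) (v w : Permutation′ n) →
    Polynomials.IsGroebnerBasis K n (InD v)
    (Polynomials.EssentialMinor K n v w)
    (Polynomials.KLGenerator K n v w)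
mainTheorem1 K n v w with Sorting.sorted-word (flipped v)
... | st , W , descending = essential∈ideal K n v w , essential-divides K n v w W descending
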